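{- Let $(X,(\gamma_t)_{t\ge 0},\mathrm{obs})$ be a Feller-Dynkin process and let $x,y\in X$ be two states. If $x$ and $y$ are bisimilar in the sense of Chen, Clerc and Panangaden (that is, related by some bisimulation equivalence relation on $X$), then $x$ and $y$ are behaviourally equivalent in the corresponding $\mathsf{Samp}_{\mathbb{R}_{\ge0}}$-graded coalgebra $(X,\hat\gamma)$.
   Context: Let $\mathcal{G}_{\le}$ be the subprobability measure monad on the category $\mathbf{Meas}$ of measurable spaces. Feller-Dynkin process: a family of transition kernels $\gamma_t\colon X\to\mathcal{G}_{\le}(X)$ ($t\in\mathbb{R}_{\ge0}$) with $\gamma_0(x)$ the Dirac measure at $x$ and $\gamma_{s+t}(x)(C)=\int\gamma_t(z)(C)\,\gamma_s(x)(dz)$, together with a measurable map $\mathrm{obs}\colon X\to B:=2^A$, where $A$ is a finite set (of atomic propositions) and $B$ is discrete. In addition, the state space is topological (with its Borel $\sigma$-algebra) and the kernels satisfy the Feller-Dynkin continuity conditions, which ensure that the process can be realised with cadlag (right-continuous with left limits) trajectories. No further use of these conditions is made in the statement, beyond the existence of the path laws below. Path laws: missing mass is sent to an absorbing point $\partial$ adjoined to $X$; a trajectory is a cadlag map $\omega\colon\mathbb{R}_{\ge0}\to X\cup\{\partial\}$ that stays at $\partial$ once it reaches it; the $\sigma$-algebra on trajectories is generated by the evaluations $\omega\mapsto\omega(t)$; $P^x$ denotes the law on trajectories of the Markov process with transition kernels $(\gamma_t)_t$ started at $x$. Bisimulation: an equivalence relation $R$ on $X$ (extended to $X\cup\{\partial\}$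 by relating $\partial$ only to itself) such that, whenever $x\mathrel{R}y$: (i) $\mathrm{obs}(x)=\mathrm{obs}(y)$; and (ii) $P^x(U)=P^y(U)$ for every measurable set $U$ of trajectories that is time-$R$-closed, meaning that if $\omega\in U$ and $\omega(t)\mathrel{R}\omega'(t)$ for all $t\ge0$ then $\omega'\in U$. States $x,y$ are bisimilar if $x\mathrel{R}y$ for some bisimulation $R$. Sampling monoid: $\mathsf{Samp}_{\mathbb{R}_{\ge0}}$ is the coproduct (free product) of the monoids $(\mathbb{R}_{\ge0},+,0)$ and $(\mathbb{N},+,0)$; its elements are lists $w=(t_0,k_0,\dots,t_n,k_n)$ with $t_i\in\mathbb{R}_{\ge0}$, $k_i\in\mathbb{N}$, $t_i\ne0$ for $i\ge1$ and $k_i>0$ for $i<n$; its unit is $(0,0)$. Write $k(w)=k_0+\dots+k_n$. Graded monad: $N_w=\mathcal{G}_{\le}(B^{k(w)}\times-)$ is a $\mathsf{Samp}_{\mathbb{R}_{\ge0}}$-graded monad on $\mathbf{Meas}$, with unit given by Dirac measures and multiplication $\mathcal{G}_{\le}(B^{j}\times\mathcal{G}_{\le}(B^{k}\times X))\to\mathcal{G}_{\le}(B^{j+k}\times X)$, $\Phi\mapsto\big(S\mapsto\int\rho(\{(c,z):(b,c,z)\in S\})\,\Phi(db,d\rho)\big)$. Corresponding graded coalgebra: $\hat\gamma_w\colon X\to\mathcal{G}_{\le}(B^{k(w)}\times X)$ where $\hat\gamma_{(t,k)}(x)$ is the push-forward of $\gamma_t(x)$ along $z\mapsto(\mathrm{obs}(z),\dots,\mathrm{obs}(z),z)$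 ($k$ copies of $\mathrm{obs}(z)$), and $\hat\gamma_{(t_0,k_0,\dots,t_{n+1},k_{n+1})}$ is obtained by first running $\hat\gamma_{(t_0,k_0,\dots,t_n,k_n)}$ and then running $\hat\gamma_{(t_{n+1},k_{n+1})}$ from the resulting state, concatenating the recorded observations. Graded coalgebras: for a $T$-graded monad $N$ with unit $\eta$ and multiplications $\mu^{s,t}$ (where $T$ is a monoid with unit $e$), a graded coalgebra is an object $X$ with maps $\gamma_t\colon X\to N_tX$ such that $\gamma_e=\eta_X$ and $\gamma_{s\cdot t}=\mu^{s,t}_X\circ N_s\gamma_t\circ\gamma_s$; a homomorphism $h\colon(X,\gamma)\to(Y,\delta)$ is a map $h\colon X\to Y$ with $N_th\circ\gamma_t=\delta_t\circ h$ for all $t$. States $x$ of $(X,\gamma)$ and $y$ of $(Y,\delta)$ are behaviourally equivalent if there are a graded coalgebra $(Z,\xi)$ and homomorphisms $g\colon(X,\gamma)\to(Z,\xi)$, $h\colon(Y,\delta)\to(Z,\xi)$ with $g(x)=h(y)$. -}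

-- Sets are setoids and subsets are predicates.  The mathematics is classical: excluded
-- middle at Set₁ is a parameter wherever it is used.  Carriers and equalities live in Set₁
-- and subsets in Set, so that the Giry construction does not raise the level; under
-- excluded middle every Set₁-valued predicate is equivalent to a Set-valued one.

module Defs where

open import Axiom.ExcludedMiddle using (ExcludedMiddle)
open import Data.Empty using (⊥; ⊥-elim)
open import Data.Fin.Subset using (Subset)
open import Data.List.Base using (List; []; _∷_)
open import Data.List.Relation.Unary.Any using (Any)
open import Data.Maybe.Base using (Maybe; just; nothing)
import Data.Maybe.Relation.Binary.Pointwise as Maybeₚ
open import Data.Nat.Base as ℕ using (ℕ; zero; suc)
import Data.Nat.Properties as ℕₚ
open import Data.Product using (Σ-syntax; ∃-syntax; _×_; _,_; proj₁; proj₂)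
open import Data.Product.Relation.Binary.Pointwise.NonDependent using (×-setoid)
open import Data.Rational.Base using (ℚ; 0ℚ; 1ℚ; _+_; _-_; _*_; -_; _≤_; _<_)
import Data.Rational.Properties as ℚₚ
open import Data.Sum.Base using (_⊎_; inj₁; inj₂)
open import Data.Unit.Base using (⊤; tt)
open import Data.Vec.Base as Vec using (Vec; []; _++_; replicate)
open import Level using (Level; 0ℓ; Lift; lift; lower) renaming (suc to lsuc)
open import Relation.Binary.Bundles using (Setoid)
open import Relation.Binary.Core using (Rel)
open import Relation.Binary.PropositionalEquality as ≡ using (_≡_; _≢_; refl; sym; trans; cong; subst)
open import Relation.Binary.Structures using (IsEquivalence)
open import Relation.Nullary using (¬_; Dec; yes; no)
open import Relation.Nullary.Decidable using (map′; decidable-stable)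
open import Relation.Unary using (Pred; _≐_; ∁; U; ⋃; _∩_; _⊢_; _⊆_)

1ℓ : Level
1ℓ = lsuc 0ℓ

-- a ∋ q means q < a; the negative rationals belong to every cut, and ∞ is the cut ℚ.
record [0,∞] : Set₁ where
  infix 4 _∋_
  field
    _∋_        : ℚ → Set
    ∋-negative : ∀ {q} → q < 0ℚ → _∋_ q
    ∋-down     : ∀ {p q} → p ≤ q → _∋_ q → _∋_ p
    ∋-open     : ∀ {q} → _∋_ q → ∃[ r ] (q < r × _∋_ r)

open [0,∞] public

infix 4 _≤∞_ _≈∞_

_≤∞_ : Rel [0,∞] 0ℓ
a ≤∞ b = ∀ q → a ∋ q → b ∋ q

_≈∞_ : Rel [0,∞] 0ℓ
a ≈∞ b = (a ≤∞ b) × (b ≤∞ a)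

private
  <⇒<0 : ∀ {p q} → p ≤ q → q < 0ℚ → p < 0ℚ
  <⇒<0 = ℚₚ.≤-<-trans

  split : ∀ q m → q ≡ m + (q - m)
  split q m = sym (begin
    m + (q - m)     ≡⟨ ℚₚ.+-comm m (q - m) ⟩
    (q - m) + m     ≡⟨ ℚₚ.+-assoc q (- m) m ⟩
    q + (- m + m)   ≡⟨ cong (q +_) (ℚₚ.+-inverseˡ m) ⟩
    q + 0ℚ          ≡⟨ ℚₚ.+-identityʳ q ⟩
    q               ∎)
    where open ≡.≡-Reasoning

  q-m<0 : ∀ {q m} → q < m → q - m < 0ℚ
  q-m<0 {q} {m} q<m = subst (q - m <_) (ℚₚ.+-inverseʳ m) (ℚₚ.+-monoˡ-< (- m) q<m)

0∞ : [0,∞]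
0∞ = record
  { _∋_        = _< 0ℚ
  ; ∋-negative = λ q<0 → q<0
  ; ∋-down     = <⇒<0
  ; ∋-open     = λ q<0 → let r , q<r , r<0 = ℚₚ.<-dense q<0 in r , q<r , r<0
  }

infixl 6 _+∞_

_+∞_ : [0,∞] → [0,∞] → [0,∞]
a +∞ b = record
  { _∋_        = λ q → ∃[ r ] ∃[ s ] (a ∋ r × b ∋ s × q ≤ r + s)
  ; ∋-negative = λ {q} q<0 → let m , q<m , m<0 = ℚₚ.<-dense q<0 in
                   m , q - m , ∋-negative a m<0 , ∋-negative b (q-m<0 q<m) ,
                   ℚₚ.≤-reflexive (split q m)
  ; ∋-down     = λ p≤q (r , s , ar , bs , q≤) → r , s , ar , bs , ℚₚ.≤-trans p≤q q≤
  ; ∋-open     = λ (r , s , ar , bs , q≤) → let r′ , r<r′ , ar′ = ∋-open a ar in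
                   r′ + s , ℚₚ.≤-<-trans q≤ (ℚₚ.+-monoˡ-< s r<r′) ,
                   r′ , s , ar′ , bs , ℚₚ.≤-refl
  }

-- Multiplication by a rational c; it is used only for 0 ≤ c.
infixr 7 _·∞_

_·∞_ : ℚ → [0,∞] → [0,∞]
c ·∞ a = record
  { _∋_        = λ q → q < 0ℚ ⊎ ∃[ r ] (a ∋ r × q < c * r)
  ; ∋-negative = inj₁
  ; ∋-down     = λ { p≤q (inj₁ q<0)          → inj₁ (<⇒<0 p≤q q<0)
                   ; p≤q (inj₂ (r , ar , q<)) → inj₂ (r , ar , ℚₚ.≤-<-trans p≤q q<) }
  ; ∋-open     = λ { (inj₁ q<0) → let m , q<m , m<0 = ℚₚ.<-dense q<0 in m , q<m , inj₁ m<0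
                   ; (inj₂ (r , ar , q<)) → let m , q<m , m< = ℚₚ.<-dense q< in
                       m , q<m , inj₂ (r , ar , m<) }
  }

-- a if P holds, and 0 otherwise.
infixr 7 ⟦_⟧·_

⟦_⟧·_ : Set → [0,∞] → [0,∞]
⟦ P ⟧· a = record
  { _∋_        = λ q → q < 0ℚ ⊎ (P × a ∋ q)
  ; ∋-negative = inj₁
  ; ∋-down     = λ { p≤q (inj₁ q<0)     → inj₁ (<⇒<0 p≤q q<0)
                   ; p≤q (inj₂ (p , aq)) → inj₂ (p , ∋-down a p≤q aq) }
  ; ∋-open     = λ { (inj₁ q<0) → let m , q<m , m<0 = ℚₚ.<-dense q<0 in m , q<m , inj₁ m<0
                   ; (inj₂ (p , aq)) → let m , q<m , am = ∋-open a aq in m , q<m , inj₂ (p , am) }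
  }

-- max 0 c
ofℚ : ℚ → [0,∞]
ofℚ c = record
  { _∋_        = λ q → q < 0ℚ ⊎ q < c
  ; ∋-negative = inj₁
  ; ∋-down     = λ { p≤q (inj₁ q<0) → inj₁ (<⇒<0 p≤q q<0)
                   ; p≤q (inj₂ q<c) → inj₂ (ℚₚ.≤-<-trans p≤q q<c) }
  ; ∋-open     = λ { (inj₁ q<0) → let m , q<m , m<0 = ℚₚ.<-dense q<0 in m , q<m , inj₁ m<0
                   ; (inj₂ q<c) → let m , q<m , m<c = ℚₚ.<-dense q<c in m , q<m , inj₂ m<c }
  }

1∞ : [0,∞]
1∞ = ofℚ 1ℚ

indicator : Set → [0,∞]
indicator P = ⟦ P ⟧· 1∞

-- max 0 (1 - a): ¬ (a ∋ r) means a ≤ r.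
1-_ : [0,∞] → [0,∞]
1- a = record
  { _∋_        = λ q → q < 0ℚ ⊎ ∃[ r ] (¬ (a ∋ r) × q + r < 1ℚ)
  ; ∋-negative = inj₁
  ; ∋-down     = λ { p≤q (inj₁ q<0)          → inj₁ (<⇒<0 p≤q q<0)
                   ; p≤q (inj₂ (r , ¬ar , q<)) →
                       inj₂ (r , ¬ar , ℚₚ.≤-<-trans (ℚₚ.+-monoˡ-≤ r p≤q) q<) }
  ; ∋-open     = λ { (inj₁ q<0) → let m , q<m , m<0 = ℚₚ.<-dense q<0 in m , q<m , inj₁ m<0
                   ; {q} (inj₂ (r , ¬ar , q<)) → let m , q+r<m , m<1 = ℚₚ.<-dense q< in
                       m - r
                     , subst (_< m - r) (cancelʳ q r) (ℚₚ.+-monoˡ-< (- r) q+r<m)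
                     , inj₂ (r , ¬ar , subst (_< 1ℚ) (sym (cancelʳ′ m r)) m<1) }
  }
  where
  cancelʳ : ∀ q r → (q + r) - r ≡ q
  cancelʳ q r = trans (ℚₚ.+-assoc q r (- r))
               (trans (cong (q +_) (ℚₚ.+-inverseʳ r)) (ℚₚ.+-identityʳ q))
  cancelʳ′ : ∀ m r → (m - r) + r ≡ m
  cancelʳ′ m r = trans (ℚₚ.+-assoc m (- r) r)
                (trans (cong (m +_) (ℚₚ.+-inverseˡ r)) (ℚₚ.+-identityʳ m))

∑< : ℕ → (ℕ → [0,∞]) → [0,∞]
∑< zero    a = 0∞
∑< (suc n) a = ∑< n a +∞ a n

∑ : (ℕ → [0,∞]) → [0,∞]
∑ a = record
  { _∋_        = λ q → ∃[ n ] (∑< n a ∋ q)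
  ; ∋-negative = λ q<0 → 0 , q<0
  ; ∋-down     = λ p≤q (n , h) → n , ∋-down (∑< n a) p≤q h
  ; ∋-open     = λ (n , h) → let r , q<r , h′ = ∋-open (∑< n a) h in r , q<r , n , h′
  }

record ℝ≥0 : Set₁ where
  constructor _,fin_
  field
    value  : [0,∞]
    finite : ∃[ q ] ¬ (value ∋ q)

open ℝ≥0 public

infix 4 _≤ᵣ_ _<ᵣ_ _≈ᵣ_

_≤ᵣ_ _<ᵣ_ _≈ᵣ_ : Rel ℝ≥0 0ℓ
s ≤ᵣ t = value s ≤∞ value t
s <ᵣ t = ¬ (t ≤ᵣ s)
s ≈ᵣ t = value s ≈∞ value t

0ᵣ : ℝ≥0
0ᵣ = 0∞ ,fin (0ℚ , ℚₚ.<-irrefl refl)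

infixl 6 _+ᵣ_

private
  ∌⇒> : ∀ a {p r} → ¬ (a ∋ p) → a ∋ r → r < p
  ∌⇒> a ¬ap ar = ℚₚ.≰⇒> (λ p≤r → ¬ap (∋-down a p≤r ar))

_+ᵣ_ : ℝ≥0 → ℝ≥0 → ℝ≥0
(a ,fin (p , ¬ap)) +ᵣ (b ,fin (q , ¬bq)) = (a +∞ b) ,fin
  (p + q , λ (r , s , ar , bs , p+q≤r+s) →
     ℚₚ.<-irrefl refl (ℚₚ.<-≤-trans (ℚₚ.+-mono-< (∌⇒> a ¬ap ar) (∌⇒> b ¬bq bs)) p+q≤r+s))

record MeasurableSpace : Set₂ where
  field
    setoid : Setoid 1ℓ 1ℓ
  open Setoid setoid public using (Carrier; _≈_; isEquivalence)
    renaming (refl to ≈-refl; sym to ≈-sym; trans to ≈-trans)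
  field
    Measurable   : Pred Carrier 0ℓ → Set₁
    extensional  : ∀ {A} → Measurable A → ∀ {x y} → x ≈ y → A x → A y
    measurable-≐ : ∀ {A B} → A ≐ B → Measurable A → Measurable B
    whole        : Measurable U
    complement   : ∀ {A} → Measurable A → Measurable (∁ A)
    union        : ∀ {A : ℕ → Pred Carrier 0ℓ} → (∀ n → Measurable (A n)) → Measurable (⋃ ℕ A)

open MeasurableSpace public using (Carrier)

record MeasurableSet (X : MeasurableSpace) : Set₁ where
  constructor _,meas_
  field
    set        : Pred (Carrier X) 0ℓ
    measurable : MeasurableSpace.Measurable X set

open MeasurableSet public

infix 4 _∈ₘ_

_∈ₘ_ : ∀ {X} → Carrier X → MeasurableSet X → Set
x ∈ₘ A = set A x

wholeₘ : ∀ {X} → MeasurableSet X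
wholeₘ {X} = U ,meas MeasurableSpace.whole X

emptyₘ : ∀ {X} → MeasurableSet X
emptyₘ {X} = ∁ U ,meas MeasurableSpace.complement X (MeasurableSpace.whole X)

unionₘ : ∀ {X} → (ℕ → MeasurableSet X) → MeasurableSet X
unionₘ {X} A = ⋃ ℕ (λ n → set (A n)) ,meas MeasurableSpace.union X (λ n → measurable (A n))

record Hom (X Y : MeasurableSpace) : Set₁ where
  private
    module X = MeasurableSpace X
    module Y = MeasurableSpace Y
  field
    fun      : X.Carrier → Y.Carrier
    fun-cong : ∀ {x y} → x X.≈ y → fun x Y.≈ fun y
    preimage : ∀ {A} → Y.Measurable A → X.Measurable (fun ⊢ A)

open Hom public

preimageₘ : ∀ {X Y} → Hom X Y → MeasurableSet Y → MeasurableSet X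
preimageₘ f A = (fun f ⊢ set A) ,meas preimage f (measurable A)

idₘ : ∀ {X} → Hom X X
idₘ = record { fun = λ x → x ; fun-cong = λ e → e ; preimage = λ m → m }

infixr 9 _∘ₘ_

_∘ₘ_ : ∀ {X Y Z} → Hom Y Z → Hom X Y → Hom X Z
g ∘ₘ f = record
  { fun      = λ x → fun g (fun f x)
  ; fun-cong = λ e → fun-cong g (fun-cong f e)
  ; preimage = λ m → preimage f (preimage g m)
  }

data Generated {A : Set₁} (𝒮 : Pred A 0ℓ → Set₁) : Pred A 0ℓ → Set₁ where
  generator  : ∀ {P} → 𝒮 P → Generated 𝒮 P
  gen-≐      : ∀ {P Q} → P ≐ Q → Generated 𝒮 P → Generated 𝒮 Q
  gen-whole  : Generated 𝒮 U
  gen-∁      : ∀ {P} → Generated 𝒮 P → Generated 𝒮 (∁ P)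
  gen-⋃      : ∀ {P : ℕ → Pred A 0ℓ} → (∀ n → Generated 𝒮 (P n)) → Generated 𝒮 (⋃ ℕ P)

Generated-mono : ∀ {A : Set₁} {𝒮 𝒯 : Pred A 0ℓ → Set₁} → (∀ {P} → 𝒮 P → 𝒯 P) →
                 ∀ {P} → Generated 𝒮 P → Generated 𝒯 P
Generated-mono h (generator s) = generator (h s)
Generated-mono h (gen-≐ e g)   = gen-≐ e (Generated-mono h g)
Generated-mono h gen-whole     = gen-whole
Generated-mono h (gen-∁ g)     = gen-∁ (Generated-mono h g)
Generated-mono h (gen-⋃ g)     = gen-⋃ (λ n → Generated-mono h (g n))

module _ (S : Setoid 1ℓ 1ℓ) (𝒮 : Pred (Setoid.Carrier S) 0ℓ → Set₁) where
  open Setoid S using (_≈_) renaming (sym to ≈-sym)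

  Generated-extensional : (∀ {P} → 𝒮 P → ∀ {x y} → x ≈ y → P x → P y) →
                          ∀ {P} → Generated 𝒮 P → ∀ {x y} → x ≈ y → P x → P y
  Generated-extensional ext (generator s)     e p       = ext s e p
  Generated-extensional ext (gen-≐ (f , g) d) e p       = f (Generated-extensional ext d e (g p))
  Generated-extensional ext gen-whole         e p       = tt
  Generated-extensional ext (gen-∁ d)         e ¬p p    =
    ¬p (Generated-extensional ext d (≈-sym e) p)
  Generated-extensional ext (gen-⋃ d)         e (n , p) =
    n , Generated-extensional ext (d n) e p

  generatedSpace : (∀ {P} → 𝒮 P → ∀ {x y} → x ≈ y → P x → P y) → MeasurableSpace
  generatedSpace ext = record
    { setoid       = S
    ; Measurable   = Generated 𝒮
    ; extensional  = Generated-extensional ext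
    ; measurable-≐ = gen-≐
    ; whole        = gen-whole
    ; complement   = gen-∁
    ; union        = gen-⋃
    }

Generated-preimage : (X : MeasurableSpace) {B : Set₁} {𝒮 : Pred B 0ℓ → Set₁} (f : Carrier X → B) →
                     (∀ {P} → 𝒮 P → MeasurableSpace.Measurable X (f ⊢ P)) →
                     ∀ {P} → Generated 𝒮 P → MeasurableSpace.Measurable X (f ⊢ P)
Generated-preimage X f h (generator s)       = h s
Generated-preimage X f h (gen-≐ (i , j) d)   =
  MeasurableSpace.measurable-≐ X ((λ p → i p) , (λ p → j p)) (Generated-preimage X f h d)
Generated-preimage X f h gen-whole           = MeasurableSpace.whole X
Generated-preimage X f h (gen-∁ d)           =
  MeasurableSpace.complement X (Generated-preimage X f h d)
Generated-preimage X f h (gen-⋃ d)           =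
  MeasurableSpace.union X (λ n → Generated-preimage X f h (d n))

discrete : Set → MeasurableSpace
discrete I = record
  { setoid       = ≡.setoid (Lift 1ℓ I)
  ; Measurable   = λ _ → Lift 1ℓ ⊤
  ; extensional  = λ { _ refl a → a }
  ; measurable-≐ = λ _ m → m
  ; whole        = lift tt
  ; complement   = λ m → m
  ; union        = λ _ → lift tt
  }

data Rectangle (X Y : MeasurableSpace) : Pred (Carrier X × Carrier Y) 0ℓ → Set₁ where
  rectangle : (A : MeasurableSet X) (B : MeasurableSet Y) →
              Rectangle X Y (λ p → proj₁ p ∈ₘ A × proj₂ p ∈ₘ B)

infixr 2 _⊗_

_⊗_ : MeasurableSpace → MeasurableSpace → MeasurableSpace
X ⊗ Y = generatedSpace (×-setoid X.setoid Y.setoid) (Rectangle X Y)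
  λ { (rectangle A B) (e , e′) (a , b) →
        X.extensional (measurable A) e a , Y.extensional (measurable B) e′ b }
  where
  module X = MeasurableSpace X
  module Y = MeasurableSpace Y

infixr 2 _⊗id _id⊗_

_⊗id : ∀ {X Y Z} → Hom X Y → Hom (X ⊗ Z) (Y ⊗ Z)
_⊗id {X} {Y} {Z} f = record
  { fun      = λ (x , z) → fun f x , z
  ; fun-cong = λ (e , e′) → fun-cong f e , e′
  ; preimage = Generated-preimage (X ⊗ Z) _
      λ { (rectangle A B) → generator (rectangle (preimageₘ f A) B) }
  }

_id⊗_ : ∀ X {Y Z} → Hom Y Z → Hom (X ⊗ Y) (X ⊗ Z)
_id⊗_ X {Y} {Z} f = record
  { fun      = λ (x , y) → x , fun f y
  ; fun-cong = λ (e , e′) → e , fun-cong f e′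
  ; preimage = Generated-preimage (X ⊗ Y) _
      λ { (rectangle A B) → generator (rectangle A (preimageₘ f B)) }
  }

record SubMeasure (X : MeasurableSpace) : Set₁ where
  infix 8 _⟨_⟩
  field
    _⟨_⟩             : MeasurableSet X → [0,∞]
    respects-≐       : ∀ {A B} → set A ≐ set B → _⟨_⟩ A ≈∞ _⟨_⟩ B
    empty-null       : _⟨_⟩ emptyₘ ≈∞ 0∞
    σ-additive       : ∀ (A : ℕ → MeasurableSet X) →
                       (∀ {i j} → i ≢ j → ∀ {x} → x ∈ₘ A i → x ∈ₘ A j → ⊥) →
                       _⟨_⟩ (unionₘ A) ≈∞ ∑ (λ n → _⟨_⟩ (A n))
    mass≤1           : _⟨_⟩ wholeₘ ≤∞ 1∞

open SubMeasure public using (_⟨_⟩)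

infix 4 _≈ₘ_

_≈ₘ_ : ∀ {X} → SubMeasure X → SubMeasure X → Set₁
μ ≈ₘ ν = ∀ A → μ ⟨ A ⟩ ≈∞ ν ⟨ A ⟩

-- A nonnegative simple function Σᵢ cᵢ·1_{Aᵢ}; the Aᵢ need not be disjoint.
Simple : MeasurableSpace → Set₁
Simple X = List ((Σ[ c ∈ ℚ ] 0ℚ ≤ c) × MeasurableSet X)

simpleSum : ∀ {X} → (MeasurableSet X → [0,∞]) → Simple X → [0,∞]
simpleSum φ []                  = 0∞
simpleSum φ (((c , _) , A) ∷ s) = c ·∞ φ A +∞ simpleSum φ s

evaluate : ∀ {X} → Simple X → Carrier X → [0,∞]
evaluate s x = simpleSum (λ A → indicator (x ∈ₘ A)) s

-- v = ∫ f dμ: v is the supremum of the integrals of the simple functions below f.  For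
-- measurable f this is the Lebesgue integral; it is applied to measurable f only.
IsIntegral : ∀ {X} → SubMeasure X → (Carrier X → [0,∞]) → [0,∞] → Set₁
IsIntegral μ f v =
  (∀ s → (∀ x → evaluate s x ≤∞ f x) → simpleSum (μ ⟨_⟩) s ≤∞ v) ×
  (∀ u → (∀ s → (∀ x → evaluate s x ≤∞ f x) → simpleSum (μ ⟨_⟩) s ≤∞ u) → v ≤∞ u)

private
  ≈∞-refl : ∀ a → a ≈∞ a
  ≈∞-refl a = (λ _ h → h) , (λ _ h → h)

  ≈∞-trans : ∀ a b c → a ≈∞ b → b ≈∞ c → a ≈∞ c
  ≈∞-trans a b c (f , g) (h , k) = (λ q p → h q (f q p)) , (λ q p → g q (k q p))

  ≐-refl : ∀ {X : Set₁} (A : Pred X 0ℓ) → A ≐ A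
  ≐-refl A = (λ a → a) , (λ a → a)

  0+0 : ∀ {q} {r s} → r < 0ℚ → s < 0ℚ → q ≤ r + s → q < 0ℚ
  0+0 r<0 s<0 q≤ = ℚₚ.≤-<-trans q≤ (ℚₚ.+-mono-< r<0 s<0)

  b≤a+b : ∀ a b → b ≤∞ a +∞ b
  b≤a+b a b q bq = let q′ , q<q′ , bq′ = ∋-open b bq in
    q - q′ , q′ , ∋-negative a (q-m<0 q<q′) , bq′ ,
    ℚₚ.≤-reflexive (trans (split q q′) (ℚₚ.+-comm q′ (q - q′)))

  a≤a+b : ∀ a b → a ≤∞ a +∞ b
  a≤a+b a b q aq = let q′ , q<q′ , aq′ = ∋-open a aq in
    q′ , q - q′ , aq′ , ∋-negative b (q-m<0 q<q′) , ℚₚ.≤-reflexive (split q q′)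

  ≤1 : ∀ {q r} → r < 0ℚ ⊎ r < 1ℚ → q ≤ r → q < 0ℚ ⊎ q < 1ℚ
  ≤1 (inj₁ h) q≤r = inj₁ (ℚₚ.≤-<-trans q≤r h)
  ≤1 (inj₂ h) q≤r = inj₂ (ℚₚ.≤-<-trans q≤r h)

  drop-neg : ∀ {q r s} → s < 0ℚ → q ≤ r + s → q ≤ r
  drop-neg {q} {r} {s} s<0 q≤ =
    ℚₚ.≤-trans q≤ (subst (r + s ≤_) (ℚₚ.+-identityʳ r) (ℚₚ.<⇒≤ (ℚₚ.+-monoʳ-< r s<0)))

  -- At most one of the disjoint P i contributes to a partial sum.
  partial-indicator : (P : ℕ → Set) → (∀ {i j} → i ≢ j → P i → P j → ⊥) → ∀ n q →
    ∑< n (λ i → indicator (P i)) ∋ q → q < 0ℚ ⊎ ((∃[ i ] (i ℕ.< n × P i)) × 1∞ ∋ q)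
  partial-indicator P disj zero    q h = inj₁ h
  partial-indicator P disj (suc n) q (r , s , hr , hs , q≤)
    with partial-indicator P disj n r hr | hs
  ... | inj₁ r<0 | inj₁ s<0 = inj₁ (0+0 r<0 s<0 q≤)
  ... | inj₁ r<0 | inj₂ (p , s<1) =
    inj₂ ((n , ℕₚ.≤-refl , p) , ≤1 s<1 (drop-neg r<0 (subst (q ≤_) (ℚₚ.+-comm r s) q≤)))
  ... | inj₂ ((i , i<n , p) , r<1) | inj₁ s<0 =
    inj₂ ((i , ℕₚ.m<n⇒m<1+n i<n , p) , ≤1 r<1 (drop-neg s<0 q≤))
  ... | inj₂ ((i , i<n , p) , _) | inj₂ (p′ , _) = ⊥-elim (disj (ℕₚ.<⇒≢ i<n) p p′)

dirac : ∀ {X} → Carrier X → SubMeasure X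
dirac {X} x = record
  { _⟨_⟩       = λ A → indicator (x ∈ₘ A)
  ; respects-≐ = λ (f , g) →
      (λ { _ (inj₁ h) → inj₁ h ; _ (inj₂ (a , h)) → inj₂ (f a , h) }) ,
      (λ { _ (inj₁ h) → inj₁ h ; _ (inj₂ (b , h)) → inj₂ (g b , h) })
  ; empty-null = (λ { _ (inj₁ h) → h ; _ (inj₂ (a , _)) → ⊥-elim (a tt) }) , (λ _ → inj₁)
  ; σ-additive = λ A disj →
      (λ { q (inj₁ h) → 0 , h
         ; q (inj₂ ((n , a) , h)) → suc n ,
             b≤a+b (∑< n (λ i → indicator (x ∈ₘ A i))) (indicator (x ∈ₘ A n)) q (inj₂ (a , h)) }) ,
      (λ q (n , h) → case-partial A (partial-indicator (λ i → x ∈ₘ A i) (λ ne → disj ne) n q h))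
  ; mass≤1     = λ { q (inj₁ h) → inj₁ h ; q (inj₂ (_ , h)) → h }
  }
  where
  case-partial : ∀ A {n q} → q < 0ℚ ⊎ ((∃[ i ] (i ℕ.< n × x ∈ₘ A i)) × 1∞ ∋ q) →
                 indicator (x ∈ₘ unionₘ {X} A) ∋ q
  case-partial A (inj₁ h)                 = inj₁ h
  case-partial A (inj₂ ((i , _ , a) , h)) = inj₂ ((i , a) , h)

pushforward : ∀ {X Y} → Hom X Y → SubMeasure X → SubMeasure Y
pushforward f μ = record
  { _⟨_⟩       = λ A → μ ⟨ preimageₘ f A ⟩
  ; respects-≐ = λ (i , j) → SubMeasure.respects-≐ μ ((λ a → i a) , (λ a → j a))
  ; empty-null = ≈∞-trans (μ ⟨ preimageₘ f emptyₘ ⟩) (μ ⟨ emptyₘ ⟩) 0∞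
                   (SubMeasure.respects-≐ μ (≐-refl (∁ U)))
                   (SubMeasure.empty-null μ)
  ; σ-additive = λ A disj → ≈∞-trans (μ ⟨ preimageₘ f (unionₘ A) ⟩)
                   (μ ⟨ unionₘ (λ n → preimageₘ f (A n)) ⟩)
                   (∑ (λ n → μ ⟨ preimageₘ f (A n) ⟩))
                   (SubMeasure.respects-≐ μ (≐-refl (⋃ ℕ (λ n → fun f ⊢ set (A n)))))
                   (SubMeasure.σ-additive μ (λ n → preimageₘ f (A n)) (λ ne → disj ne))
  ; mass≤1     = λ q h → SubMeasure.mass≤1 μ q (proj₁ (SubMeasure.respects-≐ μ (≐-refl U)) q h)
  }

data Evaluation (X : MeasurableSpace) : Pred (SubMeasure X) 0ℓ → Set₁ where
  evaluation : (A : MeasurableSet X) (q : ℚ) → Evaluation X (λ μ → μ ⟨ A ⟩ ∋ q)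

-- 𝒢≤ X: the sets { μ | q < μ(A) } generate the coarsest σ-algebra making all the
-- evaluations μ ↦ μ(A) measurable.
𝒢 : MeasurableSpace → MeasurableSpace
𝒢 X = generatedSpace
  (record
    { Carrier       = SubMeasure X
    ; _≈_           = _≈ₘ_
    ; isEquivalence = record
        { refl  = λ {μ} A → ≈∞-refl (μ ⟨ A ⟩)
        ; sym   = λ e A → proj₂ (e A) , proj₁ (e A)
        ; trans = λ {μ} {ν} {ξ} e e′ A → ≈∞-trans (μ ⟨ A ⟩) (ν ⟨ A ⟩) (ξ ⟨ A ⟩) (e A) (e′ A)
        }
    })
  (Evaluation X)
  (λ { (evaluation A q) e h → proj₁ (e A) q h })

-- Families of open sets are indexed by types in Set; for second countable spaces, the only
-- ones used below, every union of open sets and every open cover reduces to a countable one.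
record TopologicalSpace : Set₂ where
  field
    setoid : Setoid 1ℓ 1ℓ
  open Setoid setoid public using (_≈_) renaming (Carrier to Point)
  field
    Open        : Pred Point 0ℓ → Set₁
    extensional : ∀ {A} → Open A → ∀ {x y} → x ≈ y → A x → A y
    open-≐      : ∀ {A B} → A ≐ B → Open A → Open B
    open-whole  : Open U
    open-∩      : ∀ {A B} → Open A → Open B → Open (A ∩ B)
    open-⋃      : ∀ {I : Set} {A : I → Pred Point 0ℓ} → (∀ i → Open (A i)) → Open (⋃ I A)

  Compact : Pred Point 0ℓ → Set₁
  Compact K = ∀ {I : Set} (A : I → Pred Point 0ℓ) → (∀ i → Open (A i)) → K ⊆ ⋃ I A →
              ∃[ is ] (∀ {x} → K x → Any (λ i → A i x) is)

  Hausdorff : Set₁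
  Hausdorff = ∀ x y → ¬ (x ≈ y) →
              ∃[ A ] ∃[ B ] (Open A × Open B × A x × B y × (∀ {z} → A z → B z → ⊥))

  LocallyCompact : Set₁
  LocallyCompact = ∀ x → ∃[ A ] ∃[ K ] (Open A × Compact K × A x × A ⊆ K)

  SecondCountable : Set₁
  SecondCountable = Σ[ base ∈ (ℕ → Pred Point 0ℓ) ]
    ((∀ n → Open (base n)) ×
     (∀ {A x} → Open A → A x → ∃[ n ] (base n x × base n ⊆ A)))

  -- The nonnegative elements of C₀.  By linearity of the integral, a condition on the action
  -- of a kernel on C₀ only has to be stated for these.
  record C₀⁺ : Set₁ where
    field
      at             : Point → ℝ≥0
      lower-open     : ∀ q → Open (λ x → value (at x) ∋ q)
      upper-open     : ∀ q → Open (λ x → ∃[ r ] (r < q × ¬ (value (at x) ∋ r)))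
      vanishes-at-∞  : ∀ ε → 0ℚ < ε →
                       ∃[ K ] (Compact K × (∀ x → ¬ K x → value (at x) ≤∞ ofℚ ε))

  borel : MeasurableSpace
  borel = generatedSpace setoid Open extensional

  -- One-point compactification (∂ is isolated if the space is already compact).
  Open∂ : Pred (Maybe Point) 0ℓ → Set₁
  Open∂ A = Open (λ x → A (just x)) × (A nothing → Compact (λ x → ¬ A (just x)))

record FellerDynkinProcess (n : ℕ) : Set₂ where
  field
    topology        : TopologicalSpace
  open TopologicalSpace topology using (Hausdorff; LocallyCompact; SecondCountable; C₀⁺; borel)
  open C₀⁺
  space : MeasurableSpace
  space = borel
  field
    hausdorff       : Hausdorff
    locallyCompact  : LocallyCompact
    secondCountable : SecondCountable
    γ               : ℝ≥0 → Hom space (𝒢 space)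
    γ-cong          : ∀ {s t} → s ≈ᵣ t → ∀ x → fun (γ s) x ≈ₘ fun (γ t) x
    γ-zero          : ∀ x → fun (γ 0ᵣ) x ≈ₘ dirac x
    chapmanKolmogorov : ∀ s t x C →
      IsIntegral (fun (γ s) x) (λ z → fun (γ t) z ⟨ C ⟩) (fun (γ (s +ᵣ t)) x ⟨ C ⟩)
    -- The set of atomic propositions is Fin n, and Subset n is 2^(Fin n).
    obs             : Hom space (discrete (Subset n))
    feller          : ∀ t (f : C₀⁺) → Σ[ g ∈ C₀⁺ ] ∀ x →
      IsIntegral (fun (γ t) x) (λ z → value (at f z)) (value (at g x))
    stronglyContinuous : ∀ (f : C₀⁺) ε → 0ℚ < ε → ∃[ δ ] (0ℚ < δ ×
      (∀ t → value t ≤∞ ofℚ δ → ∀ x v → IsIntegral (fun (γ t) x) (λ z → value (at f z)) v →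
        v ≤∞ value (at f x) +∞ ofℚ ε × value (at f x) ≤∞ v +∞ ofℚ ε))

-- X ∪ {∂}, with ∂ = nothing an adjoined measurable point.
_∂ : MeasurableSpace → MeasurableSpace
X ∂ = record
  { setoid       = Maybeₚ.setoid X.setoid
  ; Measurable   = λ A → X.Measurable (λ x → A (just x))
  ; extensional  = λ { m (Maybeₚ.just e) a → X.extensional m e a ; m Maybeₚ.nothing a → a }
  ; measurable-≐ = λ (f , g) → X.measurable-≐ ((λ a → f a) , (λ a → g a))
  ; whole        = X.whole
  ; complement   = X.complement
  ; union        = X.union
  }
  where module X = MeasurableSpace X

alive : ∀ {X} → MeasurableSet (X ∂) → MeasurableSet X
alive (A ,meas m) = (λ x → A (just x)) ,meas m

module _ {n : ℕ} (𝒳 : FellerDynkinProcess n) where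
  open FellerDynkinProcess 𝒳
  open TopologicalSpace topology using (Point; Open∂)
  private
    module X  = MeasurableSpace space
    module X∂ = MeasurableSpace (space ∂)

  record Trajectory : Set₁ where
    field
      at              : ℝ≥0 → Maybe Point
      at-cong         : ∀ {s t} → s ≈ᵣ t → at s X∂.≈ at t
      absorbed        : ∀ {s t} → s ≤ᵣ t → at s ≡ nothing → at t ≡ nothing
      rightContinuous : ∀ t {A} → Open∂ A → A (at t) → ∃[ ε ] (0ℚ < ε ×
                        (∀ s → t ≤ᵣ s → value s ≤∞ value t +∞ ofℚ ε → A (at s)))
      leftLimit       : ∀ t → 0ᵣ <ᵣ t → Σ[ z ∈ Maybe Point ] (∀ {A} → Open∂ A → A z →
                        ∃[ ε ] (0ℚ < ε ×
                        (∀ s → s <ᵣ t → value t ≤∞ value s +∞ ofℚ ε → A (at s))))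

  open Trajectory

  data Cylinder (Times : Pred ℝ≥0 0ℓ) : Pred Trajectory 0ℓ → Set₁ where
    cylinder : ∀ t → Times t → (C : MeasurableSet (space ∂)) → Cylinder Times (λ ω → at ω t ∈ₘ C)

  -- The σ-algebra on trajectories generated by the evaluations at the given times.
  evaluationSpace : Pred ℝ≥0 0ℓ → MeasurableSpace
  evaluationSpace Times = generatedSpace
    (record
      { Carrier       = Trajectory
      ; _≈_           = λ ω ω′ → ∀ t → at ω t X∂.≈ at ω′ t
      ; isEquivalence = record
          { refl  = λ _ → X∂.≈-refl
          ; sym   = λ e t → X∂.≈-sym (e t)
          ; trans = λ e e′ t → X∂.≈-trans (e t) (e′ t)
          }
      })
    (Cylinder Times)
    (λ { (cylinder t _ C) e h → X∂.extensional {set C} (measurable C) (e t) h })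

  trajectories : MeasurableSpace
  trajectories = evaluationSpace U

  forgetTime : ∀ {Times} → MeasurableSet (evaluationSpace Times) → MeasurableSet trajectories
  forgetTime F = set F ,meas
    Generated-mono (λ { (cylinder t _ C) → cylinder t tt C }) (measurable F)

  at∈ : ℝ≥0 → MeasurableSet (space ∂) → MeasurableSet trajectories
  at∈ t C = (λ ω → at ω t ∈ₘ C) ,meas generator (cylinder t tt C)

  -- The transition probability from z into C at time t, the missing mass being sent to ∂.
  γ∂ : ℝ≥0 → Maybe Point → MeasurableSet (space ∂) → [0,∞]
  γ∂ t (just z) C = fun (γ t) z ⟨ alive C ⟩ +∞ ⟦ nothing ∈ₘ C ⟧· (1- (fun (γ t) z ⟨ wholeₘ ⟩))
  γ∂ t nothing  C = indicator (nothing ∈ₘ C)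

data Samp : Set₁
lastCount : Samp → ℕ

data Samp where
  base : ℝ≥0 → ℕ → Samp
  snoc : (w : Samp) → 0 ℕ.< lastCount w → (t : ℝ≥0) → ¬ (t ≈ᵣ 0ᵣ) → ℕ → Samp

lastCount (base t k) = k
lastCount (snoc _ _ _ _ k) = k

infix 4 _≈ˢ_

_≈ˢ_ : Samp → Samp → Set
base s j ≈ˢ base t k = s ≈ᵣ t × j ≡ k
snoc v _ s _ j ≈ˢ snoc w _ t _ k = v ≈ˢ w × s ≈ᵣ t × j ≡ k
base _ _ ≈ˢ snoc _ _ _ _ _ = ⊥
snoc _ _ _ _ _ ≈ˢ base _ _ = ⊥

count : Samp → ℕ
count (base t k) = k
count (snoc w _ _ _ k) = count w ℕ.+ k

εˢ : Samp
εˢ = base 0ᵣ 0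

private
  sum≉0 : ∀ {s t} → ¬ (s ≈ᵣ 0ᵣ) → ¬ (s +ᵣ t ≈ᵣ 0ᵣ)
  sum≉0 {s} {t} s≉0 (s+t≤0 , _) =
    s≉0 ((λ q sq → s+t≤0 q (a≤a+b (value s) (value t) q sq)) , (λ q → ∋-negative (value s)))

-- w · base t k, given whether t is zero.
append : Samp → (t : ℝ≥0) → ℕ → Dec (t ≈ᵣ 0ᵣ) → Samp
append (base s j) t k (yes _) = base s (j ℕ.+ k)
append (base s zero) t k (no _) = base (s +ᵣ t) k
append (base s (suc j)) t k (no t≉0) = snoc (base s (suc j)) (ℕ.s≤s ℕ.z≤n) t t≉0 k
append (snoc w p s s≉0 j) t k (yes _) = snoc w p s s≉0 (j ℕ.+ k)
append (snoc w p s s≉0 zero) t k (no _) = snoc w p (s +ᵣ t) (sum≉0 {s} {t} s≉0) k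
append (snoc w p s s≉0 (suc j))    t k (no t≉0) =
  snoc (snoc w p s s≉0 (suc j)) (ℕ.s≤s ℕ.z≤n) t t≉0 k

lastCount-append : ∀ w t k d → 0 ℕ.< k → 0 ℕ.< lastCount (append w t k d)
lastCount-append (base s j) t k (yes _) k>0 = ℕₚ.<-≤-trans k>0 (ℕₚ.m≤n+m k j)
lastCount-append (base s zero) t k (no _) k>0 = k>0
lastCount-append (base s (suc j)) t k (no _) k>0 = k>0
lastCount-append (snoc w p s s≉0 j) t k (yes _) k>0 = ℕₚ.<-≤-trans k>0 (ℕₚ.m≤n+m k j)
lastCount-append (snoc w p s s≉0 zero) t k (no _) k>0 = k>0
lastCount-append (snoc w p s s≉0 (suc j)) t k (no _) k>0 = k>0

count-append : ∀ w t k d → count (append w t k d) ≡ count w ℕ.+ k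
count-append (base s j) t k (yes _) = refl
count-append (base s zero) t k (no _) = refl
count-append (base s (suc j)) t k (no _) = refl
count-append (snoc w p s s≉0 j) t k (yes _) = sym (ℕₚ.+-assoc (count w) j k)
count-append (snoc w p s s≉0 zero) t k (no _) = cong (ℕ._+ k) (sym (ℕₚ.+-identityʳ (count w)))
count-append (snoc w p s s≉0 (suc j)) t k (no _) = refl

Obs : ℕ → ℕ → MeasurableSpace
Obs n k = discrete (Vec (Subset n) k)

-- Only count w matters, so N is indexed by it.
N : ∀ n → ℕ → MeasurableSpace → MeasurableSpace
N n k X = 𝒢 (Obs n k ⊗ X)

mapN : ∀ {n k X Y} → Hom X Y → Carrier (N n k X) → Carrier (N n k Y)
mapN {n} {k} f = pushforward (Obs n k id⊗ f)

recast : ∀ {n j k X} → j ≡ k → Carrier (N n j X) → Carrier (N n k X)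
recast {n} {j} {k} e = pushforward (_⊗id {Obs n j} {Obs n k} record
  { fun      = λ (lift b) → lift (Vec.cast e b)
  ; fun-cong = cong _
  ; preimage = λ _ → lift tt
  })

η : ∀ {n X} → Carrier X → Carrier (N n 0 X)
η x = dirac (lift [] , x)

-- { (c , z) | (b , c , z) ∈ S }
section : ∀ {n j k X} → Vec (Subset n) j →
          MeasurableSet (Obs n (j ℕ.+ k) ⊗ X) → MeasurableSet (Obs n k ⊗ X)
section {n} {j} {k} b = preimageₘ (_⊗id {Obs n k} {Obs n (j ℕ.+ k)} record
  { fun      = λ (lift c) → lift (b ++ c)
  ; fun-cong = cong _
  ; preimage = λ _ → lift tt
  })

-- ν = μ(Φ), where μ(Φ)(S) = ∫ ρ { (c , z) | (b , c , z) ∈ S } Φ(db , dρ).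
IsMultiplication : ∀ {n j k X} → Carrier (N n j (N n k X)) → Carrier (N n (j ℕ.+ k) X) → Set₁
IsMultiplication Φ ν =
  ∀ S → IsIntegral Φ (λ (b , ρ) → ρ ⟨ section (lower b) S ⟩) (ν ⟨ S ⟩)

module Classical (em : ExcludedMiddle 1ℓ) where

  em₀ : ExcludedMiddle 0ℓ
  em₀ = map′ lower lift em

  infixr 7 _∩ₘ_

  _∩ₘ_ : ∀ {X} → MeasurableSet X → MeasurableSet X → MeasurableSet X
  _∩ₘ_ {X} A B = (set A ∩ set B) ,meas
    X.measurable-≐
      ( (λ h → decidable-stable em₀ (λ ¬a → h (0 , ¬a)) ,
               decidable-stable em₀ (λ ¬b → h (1 , ¬b)))
      , (λ { (a , b) (zero , ¬a) → ¬a a ; (a , b) (suc _ , ¬b) → ¬b b }))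
      (X.complement (X.union {λ { zero → ∁ (set A) ; (suc _) → ∁ (set B) }}
        λ { zero → X.complement (measurable A) ; (suc _) → X.complement (measurable B) }))
    where module X = MeasurableSpace X

  ⟨_,_⟩ₘ : ∀ {X Y Z} → Hom X Y → Hom X Z → Hom X (Y ⊗ Z)
  ⟨_,_⟩ₘ {X} f g = record
    { fun      = λ x → fun f x , fun g x
    ; fun-cong = λ e → fun-cong f e , fun-cong g e
    ; preimage = Generated-preimage X _
        λ { (rectangle A B) → measurable (preimageₘ f A ∩ₘ preimageₘ g B) }
    }

  module _ {n : ℕ} (𝒳 : FellerDynkinProcess n) where
    open FellerDynkinProcess 𝒳
    open Trajectory

    -- The law of the Markov process with transition kernels γ∂ started at x: a probability
    -- measure with initial law δ_x and the Markov property for the natural filtration,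
    --   P (F ∩ {ω(s+t) ∈ C}) = ∫_F γ∂_t(ω(s))(C) P(dω)   for F ∈ σ(ω(u) | u ≤ s).
    record IsPathLaw (x : Carrier space) (P : SubMeasure (trajectories 𝒳)) : Set₁ where
      field
        probability : P ⟨ wholeₘ ⟩ ≈∞ 1∞
        initial     : ∀ C → P ⟨ at∈ 𝒳 0ᵣ C ⟩ ≈∞ indicator (just x ∈ₘ C)
        markov      : ∀ s t (F : MeasurableSet (evaluationSpace 𝒳 (_≤ᵣ s))) C →
                      IsIntegral P (λ ω → ⟦ ω ∈ₘ F ⟧· γ∂ 𝒳 t (at ω s) C)
                        (P ⟨ forgetTime 𝒳 F ∩ₘ at∈ 𝒳 (s +ᵣ t) C ⟩)

    PathLaws : Set₁
    PathLaws = ∀ x → Σ[ P ∈ SubMeasure (trajectories 𝒳) ] IsPathLaw x P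

    module _ (P : PathLaws) where
      open MeasurableSpace space using (_≈_)

      TimeClosed : Rel (Carrier space) 1ℓ → MeasurableSet (trajectories 𝒳) → Set₁
      TimeClosed R V = ∀ ω ω′ → ω ∈ₘ V →
                       (∀ t → Maybeₚ.Pointwise R (at ω t) (at ω′ t)) → ω′ ∈ₘ V

      record IsBisimulation (R : Rel (Carrier space) 1ℓ) : Set₁ where
        field
          ≈⇒R           : ∀ {x y} → x ≈ y → R x y
          isEquivalence : IsEquivalence R
          sameObs       : ∀ {x y} → R x y → fun obs x ≡ fun obs y
          samePathLaw   : ∀ {x y} → R x y → ∀ V → TimeClosed R V →
                          proj₁ (P x) ⟨ V ⟩ ≈∞ proj₁ (P y) ⟨ V ⟩

      Bisimilar : Carrier space → Carrier space → Set₂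
      Bisimilar x y = Σ[ R ∈ Rel (Carrier space) 1ℓ ] (IsBisimulation R × R x y)

  infixl 7 _·_

  _·_ : Samp → Samp → Samp
  lastCount-· : ∀ w v → 0 ℕ.< lastCount v → 0 ℕ.< lastCount (w · v)

  w · base t k = append w t k em₀
  w · snoc v p t t≉0 k = snoc (w · v) (lastCount-· w v p) t t≉0 k

  lastCount-· w (base t k) k>0 = lastCount-append w t k em₀ k>0
  lastCount-· w (snoc v p t t≉0 k) k>0 = k>0

  count-· : ∀ w v → count (w · v) ≡ count w ℕ.+ count v
  count-· w (base t k) = count-append w t k em₀
  count-· w (snoc v p t t≉0 k) =
    trans (cong (ℕ._+ k) (count-· w v)) (ℕₚ.+-assoc (count w) (count v) k)

  record GradedCoalgebra (n : ℕ) (X : MeasurableSpace) : Set₁ where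
    field
      structure : (w : Samp) → Hom X (N n (count w) X)
      respects  : ∀ {v w} → v ≈ˢ w → (e : count v ≡ count w) → ∀ x →
                  recast e (fun (structure v) x) ≈ₘ fun (structure w) x
      unit      : ∀ x → fun (structure εˢ) x ≈ₘ η x
      multiplication : ∀ v w x →
        IsMultiplication (mapN (structure w) (fun (structure v) x))
                         (recast (count-· v w) (fun (structure (v · w)) x))

  open GradedCoalgebra public

  IsHomomorphism : ∀ {n X Y} → GradedCoalgebra n X → GradedCoalgebra n Y → Hom X Y → Set₁
  IsHomomorphism c d h =
    ∀ w x → mapN h (fun (structure c w) x) ≈ₘ fun (structure d w) (fun h x)

  BehaviourallyEquivalent : ∀ {n X Y} → GradedCoalgebra n X → GradedCoalgebra n Y →
                            Carrier X → Carrier Y → Set₂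
  BehaviourallyEquivalent {n} {X} {Y} c d x y =
    Σ[ Z ∈ MeasurableSpace ] Σ[ e ∈ GradedCoalgebra n Z ]
    Σ[ g ∈ Hom X Z ] Σ[ h ∈ Hom Y Z ]
      (IsHomomorphism c e g × IsHomomorphism d e h × MeasurableSpace._≈_ Z (fun g x) (fun h y))

  module _ {n : ℕ} (𝒳 : FellerDynkinProcess n) where
    open FellerDynkinProcess 𝒳

    record-obs : ∀ k → Hom space (Obs n k ⊗ space)
    record-obs k = ⟨ repeat ∘ₘ obs , idₘ ⟩ₘ
      where
      repeat : Hom (discrete (Subset n)) (Obs n k)
      repeat = record
        { fun      = λ (lift b) → lift (replicate k b)
        ; fun-cong = cong _
        ; preimage = λ _ → lift tt
        }

    -- The clauses determine all the structure maps up to equality of measures.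
    record Corresponding (c : GradedCoalgebra n space) : Set₁ where
      field
        single : ∀ t k x →
          fun (structure c (base t k)) x ≈ₘ pushforward (record-obs k) (fun (γ t) x)
        step   : ∀ w p t t≉0 k x →
          IsMultiplication (mapN (structure c (base t k)) (fun (structure c w) x))
                           (fun (structure c (snoc w p t t≉0 k)) x)

{-# OPTIONS --safe #-}
-- The bisimulation R is a congruence: if C is an R-closed measurable set of states, then the
-- trajectories in C at time t form a time-R-closed set of P^x-probability γ_t(x)(C), so
-- γ_t(x)(C) = γ_t(y)(C) whenever x R y.  Hence the process descends to the quotient X/R, with
-- the R-closed measurable sets as its σ-algebra, and the projection is a homomorphism between
-- the corresponding graded coalgebras which identifies x and y.
--
-- That a process gives a graded coalgebra at all needs the Giry monad, hence the Lebesgue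
-- integral: it is approximated by functions with finitely many rational values, represented as
-- decision trees whose inner nodes are measurable sets.
module Submission where

open import Defs
open import Axiom.ExcludedMiddle using (ExcludedMiddle)
open import Algebra.Bundles using (CommutativeMonoid)
import Algebra.Properties.CommutativeSemigroup as CommutativeSemigroupₚ
open import Data.Bool.Base using (Bool; true; false)
open import Data.Empty using (⊥; ⊥-elim)
open import Data.Fin.Subset using (Subset)
import Data.Integer.Base as ℤ
open import Data.List.Base as List using (List; []; _∷_; cartesianProductWith; upTo)
open import Data.List.Membership.Propositional using (_∈_)
open import Data.List.Membership.Propositional.Properties
  using (∈-cartesianProductWith⁺; ∈-cartesianProductWith⁻; ∈-upTo⁺; ∈-upTo⁻)
open import Data.List.Relation.Unary.Any using (here; there)
open import Data.Maybe.Base using (just; nothing)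
import Data.Maybe.Relation.Binary.Pointwise as Maybeₚ
open import Data.Nat.Base as ℕ using (ℕ; zero; suc)
import Data.Nat.Properties as ℕₚ
open import Data.Product using (Σ-syntax; ∃-syntax; _×_; _,_; proj₁; proj₂)
open import Data.Rational.Base as ℚ using (ℚ; 0ℚ; 1ℚ; _+_; _-_; _*_; -_; _≤_; _<_)
import Data.Rational.Properties as ℚₚ
open import Data.Sum.Base using (_⊎_; inj₁; inj₂)
open import Data.Unit.Base using (tt)
open import Data.Vec.Base as Vec using (Vec; []; _∷_; _++_; replicate)
import Data.Vec.Properties as Vecₚ
open import Function.Base using (_$_)
open import Level using (0ℓ; lift; lower)
open import Relation.Binary.Bundles using (Poset)
open import Relation.Binary.Core using (Rel)
open import Relation.Binary.Definitions using (tri<; tri≈; tri>)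
open import Relation.Binary.PropositionalEquality as ≡
  using (_≡_; _≢_; refl; sym; trans; cong; subst)
import Relation.Binary.Reasoning.PartialOrder as PartialOrderReasoning
import Relation.Binary.Reasoning.Setoid as SetoidReasoning
open import Relation.Binary.Structures using (IsEquivalence)
open import Relation.Nullary using (¬_; yes; no)
open import Relation.Unary using (Pred; _≐_; ∁; U; ⋃; _∩_; _⊢_; _⊆_)

-- The definitions give the integral only as the relation `IsIntegral`, so a value must be
-- constructed, and shown measurable in a parameter, before kernels compose. In a decision tree the
-- branches partition the space by construction: two trees are added by grafting one onto the leaves
-- of the other, without refining lists of overlapping sets.
--
-- The graded multiplication speaks of measures on spaces of measures. Computations use the Kleisli
-- composition `_⊙_` instead, whose associativity, up to recasting of counts, carries the
-- multiplication law. Concatenation fuses adjacent letters in two cases only, when no time passes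
-- between recordings or nothing is recorded between runs; `γ-zero` and Chapman-Kolmogorov give the
-- corresponding identities.
--
-- The quotient keeps the carrier and takes `R` as equality, so the projection is the identity on
-- points and pushing a measure forward restricts it to `R`-closed sets. No topology is put on the
-- quotient; hence the coalgebra is built for an `ObservedProcess`, which covers both sides.

-- Cuts

-- _≤∞_ and _≈∞_ as records, so that unification can recover the two sides.
infix 4 _⊑_ _≋_

record _⊑_ (a b : [0,∞]) : Set where
  constructor below
  field ⊑⇒≤∞ : a ≤∞ b

open _⊑_ public

record _≋_ (a b : [0,∞]) : Set where
  constructor _and_
  field
    ≋⇒⊑ : a ⊑ b
    ≋⇒⊒ : b ⊑ a

open _≋_ public

variable
  a a′ b b′ c d : [0,∞]

≤∞⇒⊑ : ∀ a b → a ≤∞ b → a ⊑ b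
≤∞⇒⊑ _ _ = below

≈∞⇒≋ : a ≈∞ b → a ≋ b
≈∞⇒≋ (f , g) = below f and below g

≋⇒≈∞ : a ≋ b → a ≈∞ b
≋⇒≈∞ (below f and below g) = f , g

⊑-refl : ∀ a → a ⊑ a
⊑-refl a = below λ _ h → h

⊑-trans : a ⊑ b → b ⊑ c → a ⊑ c
⊑-trans (below f) (below g) = below λ q h → g q (f q h)

≋-refl : ∀ a → a ≋ a
≋-refl a = ⊑-refl a and ⊑-refl a

≋-sym : a ≋ b → b ≋ a
≋-sym (f and g) = g and f

≋-trans : a ≋ b → b ≋ c → a ≋ c
≋-trans (f and g) (h and k) = ⊑-trans f h and ⊑-trans k g

≋-isEquivalence : IsEquivalence _≋_
≋-isEquivalence = record { refl = λ {a} → ≋-refl a ; sym = ≋-sym ; trans = ≋-trans }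

⊑-poset : Poset 1ℓ 0ℓ 0ℓ
⊑-poset = record
  { Carrier = [0,∞] ; _≈_ = _≋_ ; _≤_ = _⊑_
  ; isPartialOrder = record
      { isPreorder = record
          { isEquivalence = ≋-isEquivalence
          ; reflexive     = ≋⇒⊑
          ; trans         = ⊑-trans
          }
      ; antisym = _and_
      }
  }

module ⊑-Reasoning = PartialOrderReasoning ⊑-poset

0∞-least : ∀ a → 0∞ ⊑ a
0∞-least a = below λ _ → ∋-negative a

q≡m+[q-m] : ∀ q m → q ≡ m + (q - m)
q≡m+[q-m] q m = sym (trans (ℚₚ.+-comm m (q - m)) (trans (ℚₚ.+-assoc q (- m) m)
  (trans (cong (q +_) (ℚₚ.+-inverseˡ m)) (ℚₚ.+-identityʳ q))))

q≡[q-m]+m : ∀ q m → q ≡ (q - m) + m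
q≡[q-m]+m q m = trans (q≡m+[q-m] q m) (ℚₚ.+-comm m (q - m))

p<q⇒p-q<0 : ∀ {p q} → p < q → p - q < 0ℚ
p<q⇒p-q<0 {p} {q} p<q = subst (p - q <_) (ℚₚ.+-inverseʳ q) (ℚₚ.+-monoˡ-< (- q) p<q)

x≡[x+y]-y : ∀ x y → x ≡ (x + y) - y
x≡[x+y]-y x y = sym (trans (ℚₚ.+-assoc x y (- y))
  (trans (cong (x +_) (ℚₚ.+-inverseʳ y)) (ℚₚ.+-identityʳ x)))

<+⇒-< : ∀ {q} x y → q < x + y → q - y < x
<+⇒-< {q} x y q< = subst (q - y <_) (sym (x≡[x+y]-y x y)) (ℚₚ.+-monoˡ-< (- y) q<)

-<⇒<+ : ∀ {q} x y → q - y < x → q < x + y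
-<⇒<+ {q} x y h = subst (_< x + y) (sym (q≡[q-m]+m q y)) (ℚₚ.+-monoˡ-< y h)

<+-split : ∀ {q} x y → q < x + y → ∃[ r ] ∃[ s ] (r < x × s < y × q ≤ r + s)
<+-split {q} x y q< =
  let r , q-y<r , r<x = ℚₚ.<-dense (<+⇒-< x y q<) in
  r , q - r , r<x ,
  <+⇒-< y r (subst (q <_) (ℚₚ.+-comm r y) (-<⇒<+ r y q-y<r)) ,
  ℚₚ.≤-reflexive (q≡m+[q-m] q r)

drop-negativeʳ : ∀ {q} r {s} → s < 0ℚ → q ≤ r + s → q ≤ r
drop-negativeʳ {q} r {s} s<0 q≤ =
  ℚₚ.≤-trans q≤ (subst (r + s ≤_) (ℚₚ.+-identityʳ r) (ℚₚ.<⇒≤ (ℚₚ.+-monoʳ-< r s<0)))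

drop-negativeˡ : ∀ {q} r {s} → s < 0ℚ → q ≤ s + r → q ≤ r
drop-negativeˡ {q} r {s} s<0 q≤ = drop-negativeʳ r s<0 (subst (q ≤_) (ℚₚ.+-comm s r) q≤)

-- Nonnegative rationals

ℚ⁺ : Set
ℚ⁺ = Σ[ c ∈ ℚ ] 0ℚ ≤ c

0⁺ 1⁺ : ℚ⁺
0⁺ = 0ℚ , ℚₚ.≤-refl
1⁺ = 1ℚ , ℚₚ.nonNegative⁻¹ 1ℚ

*-monoʳ⁺ : ∀ ((c , _) : ℚ⁺) {p q} → p ≤ q → c * p ≤ c * q
*-monoʳ⁺ (c , c≥0) p≤q = ℚₚ.*-monoˡ-≤-nonNeg c {{ℚ.nonNegative c≥0}} p≤q

*-monoˡ⁺ : ∀ ((c , _) : ℚ⁺) {p q} → p ≤ q → p * c ≤ q * c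
*-monoˡ⁺ (c , c≥0) p≤q = ℚₚ.*-monoʳ-≤-nonNeg c {{ℚ.nonNegative c≥0}} p≤q

_+⁺_ _*⁺_ : ℚ⁺ → ℚ⁺ → ℚ⁺
(c , c≥0) +⁺ (d , d≥0) = c + d , ℚₚ.+-mono-≤ c≥0 d≥0
(c , c≥0) *⁺ (d , d≥0) = c * d , subst (_≤ c * d) (ℚₚ.*-zeroʳ c) (*-monoʳ⁺ (c , c≥0) d≥0)

*-nonPositive : ∀ ((c , _) : ℚ⁺) {r} → r ≤ 0ℚ → c * r ≤ 0ℚ
*-nonPositive c⁺@(c , _) {r} r≤0 = subst (c * r ≤_) (ℚₚ.*-zeroʳ c) (*-monoʳ⁺ c⁺ r≤0)

factor≥0 : ∀ ((c , _) : ℚ⁺) {q r} → ¬ (q < 0ℚ) → q < c * r → 0ℚ ≤ r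
factor≥0 c q≮0 q<cr = ℚₚ.≮⇒≥ λ r<0 → q≮0 (ℚₚ.<-≤-trans q<cr (*-nonPositive c (ℚₚ.<⇒≤ r<0)))

-- For `c = 0` the bound itself makes `q` negative; for `c > 0` the witness is a rational between
-- `q` and `c * x`, divided by `c`. It recovers the strict room that membership in a multiple of a
-- cut demands.
*-dense : ∀ ((c , _) : ℚ⁺) {q} x → q < c * x → q < 0ℚ ⊎ ∃[ y ] (y < x × q < c * y)
*-dense (c , c≥0) {q} x q<cx with 0ℚ ℚₚ.<? c
... | no ¬c>0 = inj₁ (subst (q <_)
        (trans (cong (_* x) (ℚₚ.≤-antisym (ℚₚ.≮⇒≥ ¬c>0) c≥0)) (ℚₚ.*-zeroˡ x)) q<cx)
... | yes c>0 =
  let m , q<m , m<cx = ℚₚ.<-dense q<cx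
      instance
        c≢0 : ℚ.NonZero c
        c≢0 = ℚₚ.pos⇒nonZero c {{ℚ.positive c>0}}
      c[m/c]≡m : c * (ℚ.1/ c * m) ≡ m
      c[m/c]≡m = trans (sym (ℚₚ.*-assoc c (ℚ.1/ c) m))
                (trans (cong (_* m) (ℚₚ.*-inverseʳ c)) (ℚₚ.*-identityˡ m))
  in inj₂ (ℚ.1/ c * m ,
           ℚₚ.*-cancelˡ-<-nonNeg c {{ℚ.nonNegative c≥0}} (subst (_< c * x) (sym c[m/c]≡m) m<cx) ,
           subst (q <_) (sym c[m/c]≡m) q<m)

-- Opaque copies of the operations: _+∞_ and _·∞_ unfold to records of cuts, which prevents
-- unification from recovering their arguments.
opaque

  infixl 6 _⊕_
  infixr 7 _·⁺_

  _⊕_ : [0,∞] → [0,∞] → [0,∞]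
  _⊕_ = _+∞_

  _·⁺_ : ℚ⁺ → [0,∞] → [0,∞]
  (c , _) ·⁺ a = c ·∞ a

  ⨆ : (ℕ → [0,∞]) → [0,∞]
  ⨆ a = record
    { _∋_        = λ q → ∃[ n ] (a n ∋ q)
    ; ∋-negative = λ q<0 → 0 , ∋-negative (a 0) q<0
    ; ∋-down     = λ p≤q (n , h) → n , ∋-down (a n) p≤q h
    ; ∋-open     = λ (n , h) → let r , q<r , h′ = ∋-open (a n) h in r , q<r , n , h′
    }

Increasing : (ℕ → [0,∞]) → Set
Increasing a = ∀ n → a n ⊑ a (suc n)

-- A copy of `∑<` built from the opaque sum; `∑≋⨆` links the two.
partialSum : ℕ → (ℕ → [0,∞]) → [0,∞]
partialSum zero    a = 0∞
partialSum (suc n) a = partialSum n a ⊕ a n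

-- Arithmetic and suprema of cuts

opaque
  unfolding _⊕_ _·⁺_ ⨆

  ⊕-mono : a ⊑ a′ → b ⊑ b′ → a ⊕ b ⊑ a′ ⊕ b′
  ⊕-mono (below f) (below g) = below λ { q (r , s , ar , bs , q≤) → r , s , f r ar , g s bs , q≤ }

  ⊕-cong : a ≋ a′ → b ≋ b′ → a ⊕ b ≋ a′ ⊕ b′
  ⊕-cong (f and g) (h and k) = ⊕-mono f h and ⊕-mono g k

  ⊕-congˡ : ∀ c → a ≋ b → c ⊕ a ≋ c ⊕ b
  ⊕-congˡ c = ⊕-cong (≋-refl c)

  ⊕-congʳ : ∀ c → a ≋ b → a ⊕ c ≋ b ⊕ c
  ⊕-congʳ c a≋b = ⊕-cong a≋b (≋-refl c)

  ⊕-comm⊑ : ∀ a b → a ⊕ b ⊑ b ⊕ a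
  ⊕-comm⊑ a b = below λ { q (r , s , ar , bs , q≤) →
    s , r , bs , ar , subst (q ≤_) (ℚₚ.+-comm r s) q≤ }

  ⊕-comm : ∀ a b → a ⊕ b ≋ b ⊕ a
  ⊕-comm a b = ⊕-comm⊑ a b and ⊕-comm⊑ b a

  ⊕-assoc⊑ : ∀ a b c → (a ⊕ b) ⊕ c ⊑ a ⊕ (b ⊕ c)
  ⊕-assoc⊑ a b c = below λ { q (r , s , (r₁ , r₂ , ar₁ , br₂ , r≤) , cs , q≤) →
    r₁ , r₂ + s , ar₁ , (r₂ , s , br₂ , cs , ℚₚ.≤-refl) ,
    ℚₚ.≤-trans q≤ (ℚₚ.≤-trans (ℚₚ.+-monoˡ-≤ s r≤) (ℚₚ.≤-reflexive (ℚₚ.+-assoc r₁ r₂ s))) }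

  ⊕-assoc : ∀ a b c → (a ⊕ b) ⊕ c ≋ a ⊕ (b ⊕ c)
  ⊕-assoc a b c = ⊕-assoc⊑ a b c and (begin
    a ⊕ (b ⊕ c)   ≈⟨ ⊕-comm a (b ⊕ c) ⟩
    (b ⊕ c) ⊕ a   ≈⟨ ⊕-congʳ a (⊕-comm b c) ⟩
    (c ⊕ b) ⊕ a   ≤⟨ ⊕-assoc⊑ c b a ⟩
    c ⊕ (b ⊕ a)   ≈⟨ ⊕-comm c (b ⊕ a) ⟩
    (b ⊕ a) ⊕ c   ≈⟨ ⊕-congʳ c (⊕-comm b a) ⟩
    (a ⊕ b) ⊕ c   ∎)
    where open ⊑-Reasoning

  ⊕-identityʳ : ∀ a → a ⊕ 0∞ ≋ a
  ⊕-identityʳ a =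
    below (λ { q (r , s , ar , s<0 , q≤) → ∋-down a (drop-negativeʳ r s<0 q≤) ar }) and
    below (λ q aq → let r , q<r , ar = ∋-open a aq in
      r , q - r , ar , p<q⇒p-q<0 q<r , ℚₚ.≤-reflexive (q≡m+[q-m] q r))

⊕-0-commutativeMonoid : CommutativeMonoid 1ℓ 0ℓ
⊕-0-commutativeMonoid = record
  { Carrier = [0,∞] ; _≈_ = _≋_ ; _∙_ = _⊕_ ; ε = 0∞
  ; isCommutativeMonoid = record
      { isMonoid = record
          { isSemigroup = record
              { isMagma = record
                  { isEquivalence = ≋-isEquivalence
                  ; ∙-cong        = ⊕-cong
                  }
              ; assoc = ⊕-assoc
              }
          ; identity = (λ a → ≋-trans (⊕-comm 0∞ a) (⊕-identityʳ a)) , ⊕-identityʳ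
          }
      ; comm = ⊕-comm
      }
  }

open CommutativeMonoid ⊕-0-commutativeMonoid public using ()
  renaming (identityˡ to ⊕-identityˡ)
open CommutativeSemigroupₚ (CommutativeMonoid.commutativeSemigroup ⊕-0-commutativeMonoid) public
  using () renaming (interchange to ⊕-interchange)

opaque
  unfolding _⊕_ _·⁺_ ⨆

  a⊑a+b : ∀ a b → a ⊑ a ⊕ b
  a⊑a+b a b = ⊑-trans (≋⇒⊒ (⊕-identityʳ a)) (⊕-mono (⊑-refl a) (0∞-least b))

  b⊑a+b : ∀ a b → b ⊑ a ⊕ b
  b⊑a+b a b = ⊑-trans (≋⇒⊒ (⊕-identityˡ b)) (⊕-mono (0∞-least a) (⊑-refl b))

  ·⁺-mono : ∀ c → a ⊑ b → c ·⁺ a ⊑ c ·⁺ b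
  ·⁺-mono c (below f) = below λ
    { q (inj₁ q<0) → inj₁ q<0 ; q (inj₂ (r , ar , q<)) → inj₂ (r , f r ar , q<) }

  ·⁺-cong : ∀ c → a ≋ b → c ·⁺ a ≋ c ·⁺ b
  ·⁺-cong c (f and g) = ·⁺-mono c f and ·⁺-mono c g

  ·⁺-monoˡ : ∀ c d a → proj₁ c ≤ proj₁ d → c ·⁺ a ⊑ d ·⁺ a
  ·⁺-monoˡ c⁺@(c , _) (d , _) a c≤d = below go
    where
    go : ∀ q → c ·∞ a ∋ q → d ·∞ a ∋ q
    go q (inj₁ q<0) = inj₁ q<0
    go q (inj₂ (r , ar , q<cr)) with ℚₚ.≤-total 0ℚ r
    ... | inj₁ r≥0 = inj₂ (r , ar , ℚₚ.<-≤-trans q<cr (*-monoˡ⁺ (r , r≥0) c≤d))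
    ... | inj₂ r≤0 = inj₁ (ℚₚ.<-≤-trans q<cr (*-nonPositive c⁺ r≤0))

  ·⁺-distribˡ-⊕ : ∀ c a b → c ·⁺ (a ⊕ b) ≋ c ·⁺ a ⊕ c ·⁺ b
  ·⁺-distribˡ-⊕ c⁺@(c , _) a b = below to and below from
    where
    to : ∀ q → c ·∞ (a ⊕ b) ∋ q → c ·∞ a ⊕ c ·∞ b ∋ q
    to q (inj₁ q<0) = ∋-negative (c ·∞ a ⊕ c ·∞ b) q<0
    to q (inj₂ (r , (r₁ , r₂ , ar₁ , br₂ , r≤) , q<cr)) =
      let s₁ , s₂ , s₁< , s₂< , q≤ = <+-split (c * r₁) (c * r₂)
            (ℚₚ.<-≤-trans q<cr (subst (c * r ≤_) (ℚₚ.*-distribˡ-+ c r₁ r₂) (*-monoʳ⁺ c⁺ r≤)))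
      in s₁ , s₂ , inj₂ (r₁ , ar₁ , s₁<) , inj₂ (r₂ , br₂ , s₂<) , q≤
    from : ∀ q → c ·∞ a ⊕ c ·∞ b ∋ q → c ·∞ (a ⊕ b) ∋ q
    from q (s₁ , s₂ , inj₁ s₁<0 , h , q≤) =
      ⊑⇒≤∞ (·⁺-mono c⁺ (b⊑a+b a b)) q (∋-down (c ·∞ b) (drop-negativeˡ s₂ s₁<0 q≤) h)
    from q (s₁ , s₂ , h , inj₁ s₂<0 , q≤) =
      ⊑⇒≤∞ (·⁺-mono c⁺ (a⊑a+b a b)) q (∋-down (c ·∞ a) (drop-negativeʳ s₁ s₂<0 q≤) h)
    from q (s₁ , s₂ , inj₂ (r₁ , ar₁ , s₁<) , inj₂ (r₂ , br₂ , s₂<) , q≤) =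
      inj₂ (r₁ + r₂ , (r₁ , r₂ , ar₁ , br₂ , ℚₚ.≤-refl) ,
            subst (q <_) (sym (ℚₚ.*-distribˡ-+ c r₁ r₂)) (ℚₚ.≤-<-trans q≤ (ℚₚ.+-mono-< s₁< s₂<)))

  ·⁺-distribʳ-+⁺ : ∀ c d a → (c +⁺ d) ·⁺ a ≋ c ·⁺ a ⊕ d ·⁺ a
  ·⁺-distribʳ-+⁺ c⁺@(c , c≥0) d⁺@(d , d≥0) a = below to and below from
    where
    to : ∀ q → (c + d) ·∞ a ∋ q → c ·∞ a ⊕ d ·∞ a ∋ q
    to q (inj₁ q<0) = ∋-negative (c ·∞ a ⊕ d ·∞ a) q<0
    to q (inj₂ (r , ar , q<)) =
      let s₁ , s₂ , s₁< , s₂< , q≤ =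
            <+-split (c * r) (d * r) (subst (q <_) (ℚₚ.*-distribʳ-+ r c d) q<)
      in s₁ , s₂ , inj₂ (r , ar , s₁<) , inj₂ (r , ar , s₂<) , q≤
    c≤c+d : c ≤ c + d
    c≤c+d = subst (_≤ c + d) (ℚₚ.+-identityʳ c) (ℚₚ.+-monoʳ-≤ c d≥0)
    d≤c+d : d ≤ c + d
    d≤c+d = subst (_≤ c + d) (ℚₚ.+-identityˡ d) (ℚₚ.+-monoˡ-≤ d c≥0)
    both : ∀ q {s₁ s₂} r → a ∋ r → s₁ < c * r → s₂ < d * r → q ≤ s₁ + s₂ → (c + d) ·∞ a ∋ q
    both q r ar s₁< s₂< q≤ = inj₂ (r , ar ,
      subst (q <_) (sym (ℚₚ.*-distribʳ-+ r c d)) (ℚₚ.≤-<-trans q≤ (ℚₚ.+-mono-< s₁< s₂<)))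
    from : ∀ q → c ·∞ a ⊕ d ·∞ a ∋ q → (c + d) ·∞ a ∋ q
    from q (s₁ , s₂ , inj₁ s₁<0 , h , q≤) =
      ⊑⇒≤∞ (·⁺-monoˡ d⁺ (c⁺ +⁺ d⁺) a d≤c+d) q (∋-down (d ·∞ a) (drop-negativeˡ s₂ s₁<0 q≤) h)
    from q (s₁ , s₂ , h , inj₁ s₂<0 , q≤) =
      ⊑⇒≤∞ (·⁺-monoˡ c⁺ (c⁺ +⁺ d⁺) a c≤c+d) q (∋-down (c ·∞ a) (drop-negativeʳ s₁ s₂<0 q≤) h)
    from q (s₁ , s₂ , inj₂ (r₁ , ar₁ , s₁<) , inj₂ (r₂ , ar₂ , s₂<) , q≤)
      -- The two summands may use different rationals of `a`; the larger one serves for both.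
      with ℚₚ.≤-total r₁ r₂
    ... | inj₁ r₁≤r₂ = both q r₂ ar₂ (ℚₚ.<-≤-trans s₁< (*-monoʳ⁺ c⁺ r₁≤r₂)) s₂< q≤
    ... | inj₂ r₂≤r₁ = both q r₁ ar₁ s₁< (ℚₚ.<-≤-trans s₂< (*-monoʳ⁺ d⁺ r₂≤r₁)) q≤

  ·⁺-assoc : ∀ c d a → (c *⁺ d) ·⁺ a ≋ c ·⁺ (d ·⁺ a)
  ·⁺-assoc c⁺@(c , _) (d , _) a = below to and below from
    where
    to : ∀ q → (c * d) ·∞ a ∋ q → c ·∞ (d ·∞ a) ∋ q
    to q (inj₁ q<0) = inj₁ q<0
    -- The product `d * r` itself need not lie in `d ·∞ a`, where membership is strict, so a smaller
    -- rational is needed.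
    to q (inj₂ (r , ar , q<)) with *-dense c⁺ (d * r) (subst (q <_) (ℚₚ.*-assoc c d r) q<)
    ... | inj₁ q<0 = inj₁ q<0
    ... | inj₂ (y , y<dr , q<cy) = inj₂ (y , inj₂ (r , ar , y<dr) , q<cy)
    from : ∀ q → c ·∞ (d ·∞ a) ∋ q → (c * d) ·∞ a ∋ q
    from q (inj₁ q<0) = inj₁ q<0
    from q (inj₂ (y , inj₁ y<0 , q<cy)) = inj₁ (ℚₚ.<-≤-trans q<cy (*-nonPositive c⁺ (ℚₚ.<⇒≤ y<0)))
    from q (inj₂ (y , inj₂ (r , ar , y<dr) , q<cy)) = inj₂ (r , ar ,
      subst (q <_) (sym (ℚₚ.*-assoc c d r)) (ℚₚ.<-≤-trans q<cy (*-monoʳ⁺ c⁺ (ℚₚ.<⇒≤ y<dr))))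

  ·⁺-zeroʳ : ∀ c → c ·⁺ 0∞ ≋ 0∞
  ·⁺-zeroʳ c =
    below (λ { q (inj₁ q<0) → q<0
             ; q (inj₂ (r , r<0 , q<)) → ℚₚ.<-≤-trans q< (*-nonPositive c (ℚₚ.<⇒≤ r<0)) }) and
    0∞-least _

  ·⁺-zeroˡ : ∀ a → 0⁺ ·⁺ a ≋ 0∞
  ·⁺-zeroˡ a =
    below (λ { q (inj₁ q<0) → q<0
             ; q (inj₂ (r , _ , q<)) → subst (q <_) (ℚₚ.*-zeroˡ r) q< }) and
    0∞-least _

  ·⁺-identityˡ : ∀ a → 1⁺ ·⁺ a ≋ a
  ·⁺-identityˡ a =
    below (λ { q (inj₁ q<0) → ∋-negative a q<0
             ; q (inj₂ (r , ar , q<)) →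
                 ∋-down a (ℚₚ.<⇒≤ (subst (q <_) (ℚₚ.*-identityˡ r) q<)) ar }) and
    below (λ q aq → let r , q<r , ar = ∋-open a aq in
             inj₂ (r , ar , subst (q <_) (sym (ℚₚ.*-identityˡ r)) q<r))

  ·⁺-1∞ : ∀ c → c ·⁺ 1∞ ≋ ofℚ (proj₁ c)
  ·⁺-1∞ c⁺@(c , _) = below to and below from
    where
    to : ∀ q → c ·∞ 1∞ ∋ q → ofℚ c ∋ q
    to q (inj₁ q<0) = inj₁ q<0
    to q (inj₂ (r , inj₁ r<0 , q<)) = inj₁ (ℚₚ.<-≤-trans q< (*-nonPositive c⁺ (ℚₚ.<⇒≤ r<0)))
    to q (inj₂ (r , inj₂ r<1 , q<)) =
      inj₂ (ℚₚ.<-≤-trans q< (subst (c * r ≤_) (ℚₚ.*-identityʳ c) (*-monoʳ⁺ c⁺ (ℚₚ.<⇒≤ r<1))))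
    from : ∀ q → ofℚ c ∋ q → c ·∞ 1∞ ∋ q
    from q (inj₁ q<0) = inj₁ q<0
    from q (inj₂ q<c) with *-dense c⁺ 1ℚ (subst (q <_) (sym (ℚₚ.*-identityʳ c)) q<c)
    ... | inj₁ q<0 = inj₁ q<0
    ... | inj₂ (y , y<1 , q<cy) = inj₂ (y , inj₂ y<1 , q<cy)

  ofℚ-mono : ∀ {p q} → p ≤ q → ofℚ p ⊑ ofℚ q
  ofℚ-mono p≤q = below λ { r (inj₁ r<0) → inj₁ r<0 ; r (inj₂ r<p) → inj₂ (ℚₚ.<-≤-trans r<p p≤q) }

  ⟦⟧·-true : ∀ {P : Set} a → P → ⟦ P ⟧· a ≋ a
  ⟦⟧·-true a p =
    below (λ { q (inj₁ q<0) → ∋-negative a q<0 ; q (inj₂ (_ , h)) → h }) and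
    below (λ q h → inj₂ (p , h))

  ⟦⟧·-false : ∀ {P : Set} a → ¬ P → ⟦ P ⟧· a ≋ 0∞
  ⟦⟧·-false a ¬p =
    below (λ { q (inj₁ q<0) → q<0 ; q (inj₂ (p , _)) → ⊥-elim (¬p p) }) and 0∞-least _

  indicator-cong : ∀ {P Q : Set} → (P → Q) → (Q → P) → indicator P ≋ indicator Q
  indicator-cong f g =
    below (λ { q (inj₁ h) → inj₁ h ; q (inj₂ (p , h)) → inj₂ (f p , h) }) and
    below (λ { q (inj₁ h) → inj₁ h ; q (inj₂ (p , h)) → inj₂ (g p , h) })

  ofℚ0⊑ : ∀ a → ofℚ 0ℚ ⊑ a
  ofℚ0⊑ a = below λ { q (inj₁ q<0) → ∋-negative a q<0 ; q (inj₂ q<0) → ∋-negative a q<0 }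

  ⨆-upper : ∀ a n → a n ⊑ ⨆ a
  ⨆-upper a n = below λ _ h → n , h

  ⨆-least : ∀ {a} → (∀ n → a n ⊑ b) → ⨆ a ⊑ b
  ⨆-least h = below λ { q (n , aq) → ⊑⇒≤∞ (h n) q aq }

  ⨆-mono : ∀ {a b} → (∀ n → a n ⊑ b n) → ⨆ a ⊑ ⨆ b
  ⨆-mono h = below λ { q (n , aq) → n , ⊑⇒≤∞ (h n) q aq }

  ⨆-cong : ∀ {a b} → (∀ n → a n ≋ b n) → ⨆ a ≋ ⨆ b
  ⨆-cong h = ⨆-mono (λ n → ≋⇒⊑ (h n)) and ⨆-mono (λ n → ≋⇒⊒ (h n))

  ⨆-const : ∀ a → ⨆ (λ _ → a) ≋ a
  ⨆-const a = ⨆-least (λ _ → ⊑-refl a) and ⨆-upper (λ _ → a) 0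

  increasing-≤ : ∀ {a} → Increasing a → ∀ {m n} → m ℕ.≤ n → a m ⊑ a n
  increasing-≤ {a} inc m≤n = go (ℕₚ.≤⇒≤′ m≤n)
    where
    go : ∀ {m n} → m ℕ.≤′ n → a m ⊑ a n
    go (ℕ.≤′-reflexive refl) = ⊑-refl (a _)
    go (ℕ.≤′-step m≤n)       = ⊑-trans (go m≤n) (inc _)

  -- The two summands may be reached at different indices; as both sequences increase, the maximum
  -- of the indices serves for both.
  ⨆-⊕ : ∀ {a b} → Increasing a → Increasing b → ⨆ (λ n → a n ⊕ b n) ≋ ⨆ a ⊕ ⨆ b
  ⨆-⊕ {a} {b} inc-a inc-b = ⨆-least (λ n → ⊕-mono (⨆-upper a n) (⨆-upper b n)) and below from
    where
    from : ∀ q → ⨆ a ⊕ ⨆ b ∋ q → ⨆ (λ n → a n ⊕ b n) ∋ q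
    from q (r , s , (m , ar) , (n , bs) , q≤) = m ℕ.⊔ n , r , s ,
      ⊑⇒≤∞ (increasing-≤ inc-a (ℕₚ.m≤m⊔n m n)) r ar ,
      ⊑⇒≤∞ (increasing-≤ inc-b (ℕₚ.m≤n⊔m m n)) s bs , q≤

  ⨆-·⁺ : ∀ c a → ⨆ (λ n → c ·⁺ a n) ≋ c ·⁺ ⨆ a
  ⨆-·⁺ c a = ⨆-least (λ n → ·⁺-mono c (⨆-upper a n)) and below
    λ { q (inj₁ q<0) → 0 , inj₁ q<0 ; q (inj₂ (r , (n , ar) , q<)) → n , inj₂ (r , ar , q<) }

  +∞≋⊕ : ∀ a b → a +∞ b ≋ a ⊕ b
  +∞≋⊕ a b = ≋-refl (a +∞ b)

  ·∞≋·⁺ : ∀ c a → proj₁ c ·∞ a ≋ c ·⁺ a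
  ·∞≋·⁺ c a = ≋-refl (proj₁ c ·∞ a)

  ∑≋⨆ : ∀ a → ∑ a ≋ ⨆ (λ n → partialSum n a)
  ∑≋⨆ a = below (λ { q (n , h) → n , ⊑⇒≤∞ (≋⇒⊑ (∑<≋partialSum n)) q h }) and
          below (λ { q (n , h) → n , ⊑⇒≤∞ (≋⇒⊒ (∑<≋partialSum n)) q h })
    where
    ∑<≋partialSum : ∀ n → ∑< n a ≋ partialSum n a
    ∑<≋partialSum zero    = ≋-refl 0∞
    ∑<≋partialSum (suc n) = ⊕-congʳ (a n) (∑<≋partialSum n)

  -- Fixing the second rational as `q - r` leaves a single rational to range over, so that the
  -- superlevel set of a sum of functions becomes a countable union.
  ∋-⊕ : ∀ a b {q} → a ⊕ b ∋ q → ∃[ r ] (a ∋ r × b ∋ q - r)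
  ∋-⊕ a b {q} (r , s , ar , bs , q≤) = r , ar , ∋-down b
    (subst (q - r ≤_) (trans (cong (_- r) (ℚₚ.+-comm r s)) (sym (x≡[x+y]-y s r)))
      (ℚₚ.+-monoˡ-≤ (- r) q≤)) bs

  ⊕-∋ : ∀ a b {q} r → a ∋ r → b ∋ q - r → a ⊕ b ∋ q
  ⊕-∋ a b {q} r ar bs = r , q - r , ar , bs , ℚₚ.≤-reflexive (q≡m+[q-m] q r)

  ·⁺-∋ : ∀ ((c , c≥0) : ℚ⁺) a {q} → (q < 0ℚ ⊎ ∃[ r ] (a ∋ r × q < c * r)) → (c , c≥0) ·⁺ a ∋ q
  ·⁺-∋ _ _ h = h

  ∋-·⁺ : ∀ ((c , c≥0) : ℚ⁺) a {q} → (c , c≥0) ·⁺ a ∋ q → q < 0ℚ ⊎ ∃[ r ] (a ∋ r × q < c * r)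
  ∋-·⁺ _ _ h = h

  ∋-⨆ : ∀ a {q} → ⨆ a ∋ q → ∃[ n ] (a n ∋ q)
  ∋-⨆ a h = h

  ⨆-∋ : ∀ a {q} n → a n ∋ q → ⨆ a ∋ q
  ⨆-∋ a n h = n , h

partialSum-increasing : ∀ a → Increasing (λ n → partialSum n a)
partialSum-increasing a n = a⊑a+b (partialSum n a) (a n)

module WithExcludedMiddle (em : ExcludedMiddle 1ℓ) where

  open Classical em

  -- Measures

  infixr 7 _∖ₘ_

  ∁ₘ : ∀ {X} → MeasurableSet X → MeasurableSet X
  ∁ₘ {X} A = ∁ (set A) ,meas MeasurableSpace.complement X (measurable A)

  _∖ₘ_ : ∀ {X} → MeasurableSet X → MeasurableSet X → MeasurableSet X
  A ∖ₘ B = A ∩ₘ ∁ₘ B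

  module _ {X : MeasurableSpace} where
    private module X = MeasurableSpace X

    _∪ₘ_ : MeasurableSet X → MeasurableSet X → MeasurableSet X
    A ∪ₘ B = (λ x → x ∈ₘ A ⊎ x ∈ₘ B) ,meas X.measurable-≐
      ( (λ { (zero , a) → inj₁ a ; (suc _ , b) → inj₂ b })
      , (λ { (inj₁ a) → 0 , a ; (inj₂ b) → 1 , b }))
      (X.union {λ { zero → set A ; (suc _) → set B }}
        λ { zero → measurable A ; (suc _) → measurable B })

    always : Set → MeasurableSet X
    always P = (λ _ → P) ,meas go
      where
      go : X.Measurable (λ _ → P)
      go with em₀ {P}
      ... | yes p = X.measurable-≐ ((λ _ → p) , (λ _ → tt)) X.whole
      ... | no ¬p = X.measurable-≐ ((λ h → ⊥-elim (h tt)) , (λ p → ⊥-elim (¬p p)))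
                      (X.complement X.whole)

  measure-cong : ∀ {X} (μ : SubMeasure X) {A B} → set A ≐ set B → μ ⟨ A ⟩ ≋ μ ⟨ B ⟩
  measure-cong μ A≐B = ≈∞⇒≋ (SubMeasure.respects-≐ μ A≐B)

  module _ {X : MeasurableSpace} (μ : SubMeasure X) where

    measure-null : ∀ A → (∀ {x} → ¬ x ∈ₘ A) → μ ⟨ A ⟩ ≋ 0∞
    measure-null A A≡∅ = ≋-trans
      (measure-cong μ {A} {emptyₘ} ((λ a → ⊥-elim (A≡∅ a)) , (λ h → ⊥-elim (h tt))))
      (≈∞⇒≋ (SubMeasure.empty-null μ))

    -- Finite additivity from countable additivity: the two pieces are followed by empty sets, so
    -- the partial sums are constant from index 2 on.
    measure-split : ∀ E A → μ ⟨ E ⟩ ≋ μ ⟨ E ∩ₘ A ⟩ ⊕ μ ⟨ E ∖ₘ A ⟩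
    measure-split E A = begin-equality
      μ ⟨ E ⟩                               ≈⟨ measure-cong μ {E} {unionₘ part} (E⊆ , ⊆E) ⟩
      μ ⟨ unionₘ part ⟩                     ≈⟨ ≈∞⇒≋ (SubMeasure.σ-additive μ part disjoint) ⟩
      ∑ (λ n → μ ⟨ part n ⟩)                ≈⟨ ∑≋⨆ _ ⟩
      ⨆ (λ n → partialSum n (λ n → μ ⟨ part n ⟩))
        ≈⟨ ⨆-least partial and ⊑-trans (≋⇒⊒ two) (⨆-upper _ 2) ⟩
      μ ⟨ E ∩ₘ A ⟩ ⊕ μ ⟨ E ∖ₘ A ⟩           ∎
      where
      open ⊑-Reasoning
      part : ℕ → MeasurableSet X
      part 0 = E ∩ₘ A
      part 1 = E ∖ₘ A
      part (suc (suc _)) = emptyₘ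
      E⊆ : set E ⊆ ⋃ ℕ (λ n → set (part n))
      E⊆ {x} e with em₀ {x ∈ₘ A}
      ... | yes a = 0 , e , a
      ... | no ¬a = 1 , e , ¬a
      ⊆E : ⋃ ℕ (λ n → set (part n)) ⊆ set E
      ⊆E (0 , e , _) = e
      ⊆E (1 , e , _) = e
      ⊆E (suc (suc _) , h) = ⊥-elim (h tt)
      disjoint : ∀ {i j} → i ≢ j → ∀ {x} → x ∈ₘ part i → x ∈ₘ part j → ⊥
      disjoint {0} {0} i≢j _ _ = i≢j refl
      disjoint {0} {1} _ (_ , a) (_ , ¬a) = ¬a a
      disjoint {1} {0} _ (_ , ¬a) (_ , a) = ¬a a
      disjoint {1} {1} i≢j _ _ = i≢j refl
      disjoint {_} {suc (suc _)} _ _ h = h tt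
      disjoint {suc (suc _)} {_} _ h _ = h tt
      two : partialSum 2 (λ n → μ ⟨ part n ⟩) ≋ μ ⟨ E ∩ₘ A ⟩ ⊕ μ ⟨ E ∖ₘ A ⟩
      two = ⊕-congʳ (μ ⟨ E ∖ₘ A ⟩) (⊕-identityˡ (μ ⟨ E ∩ₘ A ⟩))
      partial : ∀ n → partialSum n (λ n → μ ⟨ part n ⟩) ⊑ μ ⟨ E ∩ₘ A ⟩ ⊕ μ ⟨ E ∖ₘ A ⟩
      partial 0 = 0∞-least _
      partial 1 = ⊑-trans (≋⇒⊑ (⊕-identityˡ (μ ⟨ E ∩ₘ A ⟩))) (a⊑a+b _ _)
      partial 2 = ≋⇒⊑ two
      partial (suc (suc (suc n))) = begin
        partialSum (2 ℕ.+ n) (λ n → μ ⟨ part n ⟩) ⊕ μ ⟨ emptyₘ ⟩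
          ≈⟨ ⊕-congˡ (partialSum (2 ℕ.+ n) _) (≈∞⇒≋ (SubMeasure.empty-null μ)) ⟩
        partialSum (2 ℕ.+ n) (λ n → μ ⟨ part n ⟩) ⊕ 0∞
          ≈⟨ ⊕-identityʳ _ ⟩
        partialSum (2 ℕ.+ n) (λ n → μ ⟨ part n ⟩)
          ≤⟨ partial (suc (suc n)) ⟩
        μ ⟨ E ∩ₘ A ⟩ ⊕ μ ⟨ E ∖ₘ A ⟩ ∎

    measure-mono : ∀ A B → set A ⊆ set B → μ ⟨ A ⟩ ⊑ μ ⟨ B ⟩
    measure-mono A B A⊆B = begin
      μ ⟨ A ⟩                        ≈⟨ measure-cong μ {A} {B ∩ₘ A} ((λ a → A⊆B a , a) , proj₂) ⟩
      μ ⟨ B ∩ₘ A ⟩                   ≤⟨ a⊑a+b _ _ ⟩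
      μ ⟨ B ∩ₘ A ⟩ ⊕ μ ⟨ B ∖ₘ A ⟩    ≈⟨ measure-split B A ⟨
      μ ⟨ B ⟩                        ∎
      where open ⊑-Reasoning

    -- The differences `D` of consecutive sets are disjoint with the same union, and their sums
    -- telescope.
    measure-continuous : ∀ (A : ℕ → MeasurableSet X) → (∀ n → set (A n) ⊆ set (A (suc n))) →
                         μ ⟨ unionₘ A ⟩ ⊑ ⨆ (λ n → μ ⟨ A n ⟩)
    measure-continuous A A⊆ = begin
      μ ⟨ unionₘ A ⟩
        ≈⟨ measure-cong μ {unionₘ A} {unionₘ D}
             ((λ (n , a) → A⊆⋃D n a) , (λ (n , h) → n , D⊆A n h)) ⟩
      μ ⟨ unionₘ D ⟩          ≈⟨ ≈∞⇒≋ (SubMeasure.σ-additive μ D disjoint) ⟩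
      ∑ (λ n → μ ⟨ D n ⟩)     ≈⟨ ∑≋⨆ _ ⟩
      ⨆ (λ n → partialSum n (λ n → μ ⟨ D n ⟩))
        -- The telescoping bound `partial n` is about `suc n` terms, so one more term is added
        -- first.
        ≤⟨ ⨆-least (λ n → ⊑-trans (a⊑a+b _ _)
             (⊑-trans (partial n) (⨆-upper (λ n → μ ⟨ A n ⟩) n))) ⟩
      ⨆ (λ n → μ ⟨ A n ⟩)     ∎
      where
      open ⊑-Reasoning
      D : ℕ → MeasurableSet X
      D zero    = A zero
      D (suc n) = A (suc n) ∖ₘ A n
      D⊆A : ∀ n → set (D n) ⊆ set (A n)
      D⊆A zero    h = h
      D⊆A (suc n) h = proj₁ h
      A⊆⋃D : ∀ n {x} → x ∈ₘ A n → ∃[ m ] (x ∈ₘ D m)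
      A⊆⋃D zero a = zero , a
      A⊆⋃D (suc n) {x} a with em₀ {x ∈ₘ A n}
      ... | yes a′ = A⊆⋃D n a′
      ... | no ¬a′ = suc n , a , ¬a′
      A-mono : ∀ {m n} → m ℕ.≤′ n → set (A m) ⊆ set (A n)
      A-mono (ℕ.≤′-reflexive refl) a = a
      A-mono (ℕ.≤′-step m≤n)       a = A⊆ _ (A-mono m≤n a)
      D-earlier : ∀ {i j x} → i ℕ.< j → x ∈ₘ D i → x ∈ₘ D j → ⊥
      D-earlier {i} {suc j} (ℕ.s≤s i≤j) h (_ , ¬a) = ¬a (A-mono (ℕₚ.≤⇒≤′ i≤j) (D⊆A i h))
      disjoint : ∀ {i j} → i ≢ j → ∀ {x} → x ∈ₘ D i → x ∈ₘ D j → ⊥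
      disjoint {i} {j} i≢j h h′ with ℕₚ.<-cmp i j
      ... | tri< i<j _ _ = D-earlier i<j h h′
      ... | tri≈ _ i≡j _ = i≢j i≡j
      ... | tri> _ _ j<i = D-earlier j<i h′ h
      partial : ∀ n → partialSum (suc n) (λ n → μ ⟨ D n ⟩) ⊑ μ ⟨ A n ⟩
      partial zero    = ≋⇒⊑ (⊕-identityˡ (μ ⟨ A zero ⟩))
      partial (suc n) = begin
        partialSum (suc n) (λ n → μ ⟨ D n ⟩) ⊕ μ ⟨ D (suc n) ⟩
          ≤⟨ ⊕-mono (partial n) (⊑-refl _) ⟩
        μ ⟨ A n ⟩ ⊕ μ ⟨ A (suc n) ∖ₘ A n ⟩
          ≈⟨ ⊕-congʳ _ (measure-cong μ {A n} {A (suc n) ∩ₘ A n} ((λ a → A⊆ n a , a) , proj₂)) ⟩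
        μ ⟨ A (suc n) ∩ₘ A n ⟩ ⊕ μ ⟨ A (suc n) ∖ₘ A n ⟩
          ≈⟨ measure-split (A (suc n)) (A n) ⟨
        μ ⟨ A (suc n) ⟩ ∎

  -- Step functions

  -- split A l r is l on A and r elsewhere.
  data Step (X : MeasurableSpace) : Set₁ where
    const : ℚ⁺ → Step X
    split : MeasurableSet X → Step X → Step X → Step X

  module _ {X : MeasurableSpace} where

    private
      module X = MeasurableSpace X

    height : Step X → Carrier X → ℚ
    height (const (c , _)) x = c
    height (split A l r)   x with em₀ {x ∈ₘ A}
    ... | yes _ = height l x
    ... | no  _ = height r x

    ev : Step X → Carrier X → [0,∞]
    ev s x = ofℚ (height s x)

    Nondecreasing : (ℕ → Step X) → Set₁
    Nondecreasing t = ∀ n x → height (t n) x ≤ height (t (suc n)) x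

    height-∈ : ∀ A l r {x} → x ∈ₘ A → height (split A l r) x ≡ height l x
    height-∈ A l r {x} a with em₀ {x ∈ₘ A}
    ... | yes _ = refl
    ... | no ¬a = ⊥-elim (¬a a)

    height-∉ : ∀ A l r {x} → ¬ x ∈ₘ A → height (split A l r) x ≡ height r x
    height-∉ A l r {x} ¬a with em₀ {x ∈ₘ A}
    ... | yes a = ⊥-elim (¬a a)
    ... | no  _ = refl

    -- The set argument collects the conditions met along a branch, so the leaves contribute on
    -- pairwise disjoint pieces of it. For `φ = μ ⟨_⟩` this is the integral over `E`.
    sum : (MeasurableSet X → [0,∞]) → MeasurableSet X → Step X → [0,∞]
    sum φ E (const c)     = c ·⁺ φ E
    sum φ E (split A l r) = sum φ (E ∩ₘ A) l ⊕ sum φ (E ∖ₘ A) r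

    above-measurable : ∀ c t → X.Measurable (λ x → c < height t x)
    above-measurable c (const (d , _)) = measurable (always {X} (c < d))
    above-measurable c (split A l r)   =
      X.measurable-≐ (to , from) (measurable ((A ∩ₘ Hˡ) ∪ₘ (∁ₘ A ∩ₘ Hʳ)))
      where
      Hˡ Hʳ : MeasurableSet X
      Hˡ = _ ,meas above-measurable c l
      Hʳ = _ ,meas above-measurable c r
      to : ∀ {x} → x ∈ₘ ((A ∩ₘ Hˡ) ∪ₘ (∁ₘ A ∩ₘ Hʳ)) → c < height (split A l r) x
      to (inj₁ (a , h))  = subst (c <_) (sym (height-∈ A l r a)) h
      to (inj₂ (¬a , h)) = subst (c <_) (sym (height-∉ A l r ¬a)) h
      from : ∀ {x} → c < height (split A l r) x → x ∈ₘ ((A ∩ₘ Hˡ) ∪ₘ (∁ₘ A ∩ₘ Hʳ))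
      from {x} h with em₀ {x ∈ₘ A}
      ... | yes a = inj₁ (a , h)
      ... | no ¬a = inj₂ (¬a , h)

    above : ℚ → Step X → MeasurableSet X
    above c t = (λ x → c < height t x) ,meas above-measurable c t

    infixl 6 _⊞_

    shift : ℚ⁺ → Step X → Step X
    shift c (const d)     = const (c +⁺ d)
    shift c (split A l r) = split A (shift c l) (shift c r)

    -- Grafting a shifted copy of `t` onto every leaf produces the common refinement of the two
    -- partitions.
    _⊞_ : Step X → Step X → Step X
    const c     ⊞ t = shift c t
    split A l r ⊞ t = split A (l ⊞ t) (r ⊞ t)

    scale : ℚ⁺ → Step X → Step X
    scale c (const d)     = const (c *⁺ d)
    scale c (split A l r) = split A (scale c l) (scale c r)

    module _ (μ : SubMeasure X) where

      sum-≐ : ∀ {E E′} t → set E ≐ set E′ → sum (μ ⟨_⟩) E t ≋ sum (μ ⟨_⟩) E′ t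
      sum-≐ {E} {E′} (const c) e = ·⁺-cong c (measure-cong μ {E} {E′} e)
      sum-≐ (split A l r) (f , g) = ⊕-cong
        (sum-≐ l ((λ (e , a) → f e , a) , (λ (e , a) → g e , a)))
        (sum-≐ r ((λ (e , a) → f e , a) , (λ (e , a) → g e , a)))

      sum-split : ∀ E B t → sum (μ ⟨_⟩) E t ≋ sum (μ ⟨_⟩) (E ∩ₘ B) t ⊕ sum (μ ⟨_⟩) (E ∖ₘ B) t
      sum-split E B (const c) = begin-equality
        c ·⁺ μ ⟨ E ⟩                                ≈⟨ ·⁺-cong c (measure-split μ E B) ⟩
        c ·⁺ (μ ⟨ E ∩ₘ B ⟩ ⊕ μ ⟨ E ∖ₘ B ⟩)          ≈⟨ ·⁺-distribˡ-⊕ c _ _ ⟩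
        c ·⁺ μ ⟨ E ∩ₘ B ⟩ ⊕ c ·⁺ μ ⟨ E ∖ₘ B ⟩       ∎
        where open ⊑-Reasoning
      sum-split E B (split A l r) = begin-equality
        sum φ (E ∩ₘ A) l ⊕ sum φ (E ∖ₘ A) r
          ≈⟨ ⊕-cong (sum-split (E ∩ₘ A) B l) (sum-split (E ∖ₘ A) B r) ⟩
        (sum φ ((E ∩ₘ A) ∩ₘ B) l ⊕ sum φ ((E ∩ₘ A) ∖ₘ B) l) ⊕
        (sum φ ((E ∖ₘ A) ∩ₘ B) r ⊕ sum φ ((E ∖ₘ A) ∖ₘ B) r)
          ≈⟨ ⊕-interchange _ _ _ _ ⟩
        (sum φ ((E ∩ₘ A) ∩ₘ B) l ⊕ sum φ ((E ∖ₘ A) ∩ₘ B) r) ⊕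
        (sum φ ((E ∩ₘ A) ∖ₘ B) l ⊕ sum φ ((E ∖ₘ A) ∖ₘ B) r)
          ≈⟨ ⊕-cong (⊕-cong (sum-≐ l swap) (sum-≐ r swap)) (⊕-cong (sum-≐ l swap) (sum-≐ r swap)) ⟩
        (sum φ ((E ∩ₘ B) ∩ₘ A) l ⊕ sum φ ((E ∩ₘ B) ∖ₘ A) r) ⊕
        (sum φ ((E ∖ₘ B) ∩ₘ A) l ⊕ sum φ ((E ∖ₘ B) ∖ₘ A) r) ∎
        where
        open ⊑-Reasoning
        φ = μ ⟨_⟩
        swap : ∀ {P Q R : Pred (Carrier X) 0ℓ} → (P ∩ Q) ∩ R ≐ (P ∩ R) ∩ Q
        swap = (λ { ((p , q) , r) → (p , r) , q }) , (λ { ((p , q) , r) → (p , r) , q })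

      markov-inequality : ∀ c E t → c ·⁺ μ ⟨ E ∩ₘ above (proj₁ c) t ⟩ ⊑ sum (μ ⟨_⟩) E t
      markov-inequality c E (const d) with proj₁ c ℚₚ.<? proj₁ d
      ... | yes c<d = ⊑-trans (·⁺-monoˡ c d _ (ℚₚ.<⇒≤ c<d))
            (·⁺-mono d (measure-mono μ (E ∩ₘ above (proj₁ c) (const d)) E proj₁))
      ... | no  c≮d = ⊑-trans
            (≋⇒⊑ (≋-trans
              (·⁺-cong c (measure-null μ (E ∩ₘ above (proj₁ c) (const d)) (λ (_ , c<d) → c≮d c<d)))
              (·⁺-zeroʳ c)))
            (0∞-least _)
      markov-inequality c E (split A l r) = begin
        c ·⁺ μ ⟨ E ∩ₘ H ⟩
          ≈⟨ ·⁺-cong c (measure-split μ (E ∩ₘ H) A) ⟩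
        c ·⁺ (μ ⟨ (E ∩ₘ H) ∩ₘ A ⟩ ⊕ μ ⟨ (E ∩ₘ H) ∖ₘ A ⟩)
          ≈⟨ ·⁺-distribˡ-⊕ c _ _ ⟩
        c ·⁺ μ ⟨ (E ∩ₘ H) ∩ₘ A ⟩ ⊕ c ·⁺ μ ⟨ (E ∩ₘ H) ∖ₘ A ⟩
          ≤⟨ ⊕-mono
               (·⁺-mono c (measure-mono μ ((E ∩ₘ H) ∩ₘ A) ((E ∩ₘ A) ∩ₘ above (proj₁ c) l) inˡ))
               (·⁺-mono c (measure-mono μ ((E ∩ₘ H) ∖ₘ A) ((E ∖ₘ A) ∩ₘ above (proj₁ c) r) inʳ)) ⟩
        c ·⁺ μ ⟨ (E ∩ₘ A) ∩ₘ above (proj₁ c) l ⟩ ⊕ c ·⁺ μ ⟨ (E ∖ₘ A) ∩ₘ above (proj₁ c) r ⟩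
          ≤⟨ ⊕-mono (markov-inequality c (E ∩ₘ A) l) (markov-inequality c (E ∖ₘ A) r) ⟩
        sum (μ ⟨_⟩) (E ∩ₘ A) l ⊕ sum (μ ⟨_⟩) (E ∖ₘ A) r ∎
        where
        open ⊑-Reasoning
        H = above (proj₁ c) (split A l r)
        inˡ : set ((E ∩ₘ H) ∩ₘ A) ⊆ set ((E ∩ₘ A) ∩ₘ above (proj₁ c) l)
        inˡ ((e , h) , a) = (e , a) , subst (proj₁ c <_) (height-∈ A l r a) h
        inʳ : set ((E ∩ₘ H) ∖ₘ A) ⊆ set ((E ∖ₘ A) ∩ₘ above (proj₁ c) r)
        inʳ ((e , h) , ¬a) = (e , ¬a) , subst (proj₁ c <_) (height-∉ A l r ¬a) h

      -- Splitting E along s reduces to a constant c on E.  If q < c μ(E) then q < c′ μ(E) for some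
      -- c′ < c, and the sets E ∩ { t n > c′ } exhaust E.
      sum-limit-on : (t : ℕ → Step X) → Nondecreasing t →
                     (∀ E → Increasing (λ n → sum (μ ⟨_⟩) E (t n))) →
                     ∀ E s → (∀ x → x ∈ₘ E → ev s x ⊑ ⨆ (λ n → ev (t n) x)) →
                     sum (μ ⟨_⟩) E s ⊑ ⨆ (λ n → sum (μ ⟨_⟩) E (t n))
      sum-limit-on t t-inc sum-inc E (split A l r) s⊑t = begin
        sum φ (E ∩ₘ A) l ⊕ sum φ (E ∖ₘ A) r
          ≤⟨ ⊕-mono
               (sum-limit-on t t-inc sum-inc (E ∩ₘ A) l λ x (e , a) →
                 subst (λ c → ofℚ c ⊑ ⨆ (λ n → ev (t n) x)) (height-∈ A l r a) (s⊑t x e))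
               (sum-limit-on t t-inc sum-inc (E ∖ₘ A) r λ x (e , ¬a) →
                 subst (λ c → ofℚ c ⊑ ⨆ (λ n → ev (t n) x)) (height-∉ A l r ¬a) (s⊑t x e)) ⟩
        ⨆ (λ n → sum φ (E ∩ₘ A) (t n)) ⊕ ⨆ (λ n → sum φ (E ∖ₘ A) (t n))
          ≈⟨ ⨆-⊕ (sum-inc (E ∩ₘ A)) (sum-inc (E ∖ₘ A)) ⟨
        ⨆ (λ n → sum φ (E ∩ₘ A) (t n) ⊕ sum φ (E ∖ₘ A) (t n))
          ≈⟨ ⨆-cong (λ n → sum-split E A (t n)) ⟨
        ⨆ (λ n → sum φ E (t n)) ∎
        where
        open ⊑-Reasoning
        φ = μ ⟨_⟩
      sum-limit-on t t-inc sum-inc E (const c⁺@(c , _)) s⊑t = below go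
        where
        R = ⨆ (λ n → sum (μ ⟨_⟩) E (t n))
        go : ∀ q → c⁺ ·⁺ μ ⟨ E ⟩ ∋ q → R ∋ q
        go q h with q ℚₚ.<? 0ℚ | ∋-·⁺ c⁺ (μ ⟨ E ⟩) h
        ... | yes q<0 | _        = ∋-negative R q<0
        ... | no _    | inj₁ q<0 = ∋-negative R q<0
        ... | no q≮0  | inj₂ (r , μEr , q<cr)
          with *-dense (r , factor≥0 c⁺ q≮0 q<cr) c (subst (q <_) (ℚₚ.*-comm c r) q<cr)
        ...   | inj₁ q<0                = ∋-negative R q<0
        ...   | inj₂ (c′ , c′<c , q<rc′) = conclude (∋-⨆ _ (⊑⇒≤∞ E⊑ r μEr))
          where
          c′≥0 : 0ℚ ≤ c′
          c′≥0 = factor≥0 (r , factor≥0 c⁺ q≮0 q<cr) q≮0 q<rc′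
          part : ℕ → MeasurableSet X
          part n = E ∩ₘ above c′ (t n)
          part-inc : ∀ n → set (part n) ⊆ set (part (suc n))
          part-inc n (e , h) = e , ℚₚ.<-≤-trans h (t-inc n _)
          covered : set E ⊆ set (unionₘ part)
          covered {x} e with ∋-⨆ _ (⊑⇒≤∞ (s⊑t x e) c′ (inj₂ c′<c))
          ... | n , inj₁ c′<0 = ⊥-elim (ℚₚ.<-irrefl refl (ℚₚ.<-≤-trans c′<0 c′≥0))
          ... | n , inj₂ c′<t = n , e , c′<t
          E⊑ : μ ⟨ E ⟩ ⊑ ⨆ (λ n → μ ⟨ part n ⟩)
          E⊑ = ⊑-trans (measure-mono μ E (unionₘ part) covered) (measure-continuous μ part part-inc)
          c′⁺ : ℚ⁺
          c′⁺ = c′ , c′≥0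
          conclude : ∃[ n ] (μ ⟨ part n ⟩ ∋ r) → R ∋ q
          conclude (n , h) = ⨆-∋ (λ n → sum (μ ⟨_⟩) E (t n)) n
            (⊑⇒≤∞ (markov-inequality c′⁺ E (t n)) q
              (·⁺-∋ c′⁺ _ (inj₂ (r , h , subst (q <_) (ℚₚ.*-comm r c′) q<rc′))))

      -- The constant sequence at `t` is an instance of `sum-limit-on`, which takes the growth of
      -- the sums as a hypothesis precisely so that monotonicity can be derived from it; `sum-limit`
      -- then discharges that hypothesis.
      sum-mono : ∀ E s t → (∀ x → x ∈ₘ E → height s x ≤ height t x) →
                 sum (μ ⟨_⟩) E s ⊑ sum (μ ⟨_⟩) E t
      sum-mono E s t s≤t = ⊑-trans
        (sum-limit-on (λ _ → t) (λ _ _ → ℚₚ.≤-refl) (λ _ _ → ⊑-refl _) E s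
          (λ x e → ⊑-trans (ofℚ-mono (s≤t x e)) (⨆-upper (λ _ → ev t x) 0)))
        (≋⇒⊑ (⨆-const _))

      sum-limit : (t : ℕ → Step X) → Nondecreasing t →
                  ∀ s → (∀ x → ev s x ⊑ ⨆ (λ n → ev (t n) x)) →
                  sum (μ ⟨_⟩) wholeₘ s ⊑ ⨆ (λ n → sum (μ ⟨_⟩) wholeₘ (t n))
      sum-limit t t-inc s s⊑t = sum-limit-on t t-inc
        (λ E n → sum-mono E (t n) (t (suc n)) (λ x _ → t-inc n x)) wholeₘ s (λ x _ → s⊑t x)

      sum-shift : ∀ c E t → sum (μ ⟨_⟩) E (shift c t) ≋ c ·⁺ μ ⟨ E ⟩ ⊕ sum (μ ⟨_⟩) E t
      sum-shift c E (const d) = ·⁺-distribʳ-+⁺ c d (μ ⟨ E ⟩)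
      sum-shift c E (split A l r) = begin-equality
        sum φ (E ∩ₘ A) (shift c l) ⊕ sum φ (E ∖ₘ A) (shift c r)
          ≈⟨ ⊕-cong (sum-shift c (E ∩ₘ A) l) (sum-shift c (E ∖ₘ A) r) ⟩
        (c ·⁺ φ (E ∩ₘ A) ⊕ sum φ (E ∩ₘ A) l) ⊕ (c ·⁺ φ (E ∖ₘ A) ⊕ sum φ (E ∖ₘ A) r)
          ≈⟨ ⊕-interchange _ _ _ _ ⟩
        (c ·⁺ φ (E ∩ₘ A) ⊕ c ·⁺ φ (E ∖ₘ A)) ⊕ sum φ E (split A l r)
          ≈⟨ ⊕-congʳ _ (sum-split E A (const c)) ⟨
        c ·⁺ φ E ⊕ sum φ E (split A l r) ∎
        where
        open ⊑-Reasoning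
        φ = μ ⟨_⟩

      sum-⊞ : ∀ E s t → sum (μ ⟨_⟩) E (s ⊞ t) ≋ sum (μ ⟨_⟩) E s ⊕ sum (μ ⟨_⟩) E t
      sum-⊞ E (const c) t = sum-shift c E t
      sum-⊞ E (split A l r) t = begin-equality
        sum φ (E ∩ₘ A) (l ⊞ t) ⊕ sum φ (E ∖ₘ A) (r ⊞ t)
          ≈⟨ ⊕-cong (sum-⊞ (E ∩ₘ A) l t) (sum-⊞ (E ∖ₘ A) r t) ⟩
        (sum φ (E ∩ₘ A) l ⊕ sum φ (E ∩ₘ A) t) ⊕ (sum φ (E ∖ₘ A) r ⊕ sum φ (E ∖ₘ A) t)
          ≈⟨ ⊕-interchange _ _ _ _ ⟩
        sum φ E (split A l r) ⊕ (sum φ (E ∩ₘ A) t ⊕ sum φ (E ∖ₘ A) t)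
          ≈⟨ ⊕-congˡ _ (sum-split E A t) ⟨
        sum φ E (split A l r) ⊕ sum φ E t ∎
        where
        open ⊑-Reasoning
        φ = μ ⟨_⟩

      sum-scale : ∀ c E t → sum (μ ⟨_⟩) E (scale c t) ≋ c ·⁺ sum (μ ⟨_⟩) E t
      sum-scale c E (const d) = ·⁺-assoc c d (μ ⟨ E ⟩)
      sum-scale c E (split A l r) = ≋-trans
        (⊕-cong (sum-scale c (E ∩ₘ A) l) (sum-scale c (E ∖ₘ A) r))
        (≋-sym (·⁺-distribˡ-⊕ c _ _))

    sum-dirac-∉ : ∀ {x} E s → ¬ x ∈ₘ E → sum (dirac {X} x ⟨_⟩) E s ≋ 0∞
    sum-dirac-∉ E (const c)     x∉E = ≋-trans (·⁺-cong c (⟦⟧·-false 1∞ x∉E)) (·⁺-zeroʳ c)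
    sum-dirac-∉ E (split A l r) x∉E = ≋-trans
      (⊕-cong (sum-dirac-∉ (E ∩ₘ A) l (λ h → x∉E (proj₁ h)))
              (sum-dirac-∉ (E ∖ₘ A) r (λ h → x∉E (proj₁ h))))
      (⊕-identityʳ 0∞)

    sum-dirac-∈ : ∀ {x} E s → x ∈ₘ E → sum (dirac {X} x ⟨_⟩) E s ≋ ev s x
    sum-dirac-∈ E (const c) x∈E = ≋-trans (·⁺-cong c (⟦⟧·-true 1∞ x∈E)) (·⁺-1∞ c)
    sum-dirac-∈ {x} E (split A l r) x∈E with em₀ {x ∈ₘ A}
    ... | yes a = ≋-trans
            (⊕-cong (sum-dirac-∈ (E ∩ₘ A) l (x∈E , a)) (sum-dirac-∉ (E ∖ₘ A) r (λ h → proj₂ h a)))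
            (⊕-identityʳ _)
    ... | no ¬a = ≋-trans
            (⊕-cong (sum-dirac-∉ (E ∩ₘ A) l (λ h → ¬a (proj₂ h)))
                    (sum-dirac-∈ (E ∖ₘ A) r (x∈E , ¬a)))
            (⊕-identityˡ _)

    -- Evaluation at a point is summation against a Dirac measure, so that laws of sums, valid for
    -- all measures, specialise to pointwise laws.
    sum-dirac : ∀ x s → sum (dirac {X} x ⟨_⟩) wholeₘ s ≋ ev s x
    sum-dirac x s = sum-dirac-∈ wholeₘ s tt

    -- Translation between simple functions and step functions

    fromSimple : Simple X → Step X
    fromSimple []            = const 0⁺
    fromSimple ((c , A) ∷ s) = split A (const c) (const 0⁺) ⊞ fromSimple s

    toSimple : MeasurableSet X → Step X → Simple X
    toSimple E (const c)     = (c , E) ∷ []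
    toSimple E (split A l r) = toSimple (E ∩ₘ A) l List.++ toSimple (E ∖ₘ A) r

    simpleSum-fromSimple : ∀ (μ : SubMeasure X) s →
                           simpleSum (μ ⟨_⟩) s ≋ sum (μ ⟨_⟩) wholeₘ (fromSimple s)
    simpleSum-fromSimple μ []            = ≋-sym (·⁺-zeroˡ _)
    simpleSum-fromSimple μ ((c , A) ∷ s) = begin-equality
      simpleSum (μ ⟨_⟩) ((c , A) ∷ s)       ≈⟨ +∞≋⊕ _ _ ⟩
      proj₁ c ·∞ μ ⟨ A ⟩ ⊕ simpleSum (μ ⟨_⟩) s   ≈⟨ ⊕-cong (·∞≋·⁺ c _) (simpleSum-fromSimple μ s) ⟩
      c ·⁺ μ ⟨ A ⟩ ⊕ S
        ≈⟨ ⊕-congʳ S (·⁺-cong c (measure-cong μ {A} {wholeₘ ∩ₘ A} ((λ a → tt , a) , proj₂))) ⟩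
      c ·⁺ μ ⟨ wholeₘ ∩ₘ A ⟩ ⊕ S
        ≈⟨ ⊕-congʳ S (⊕-identityʳ _) ⟨
      (c ·⁺ μ ⟨ wholeₘ ∩ₘ A ⟩ ⊕ 0∞) ⊕ S
        ≈⟨ ⊕-congʳ S (⊕-congˡ _ (·⁺-zeroˡ (μ ⟨ wholeₘ ∖ₘ A ⟩))) ⟨
      (c ·⁺ μ ⟨ wholeₘ ∩ₘ A ⟩ ⊕ 0⁺ ·⁺ μ ⟨ wholeₘ ∖ₘ A ⟩) ⊕ S
        ≈⟨ sum-⊞ μ wholeₘ (split A (const c) (const 0⁺)) (fromSimple s) ⟨
      sum (μ ⟨_⟩) wholeₘ (fromSimple ((c , A) ∷ s)) ∎
      where
      open ⊑-Reasoning
      S = sum (μ ⟨_⟩) wholeₘ (fromSimple s)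

    simpleSum-++ : ∀ φ (s t : Simple X) → simpleSum φ (s List.++ t) ≋ simpleSum φ s ⊕ simpleSum φ t
    simpleSum-++ φ []            t = ≋-sym (⊕-identityˡ _)
    simpleSum-++ φ ((c , A) ∷ s) t = begin-equality
      simpleSum φ (((c , A) ∷ s) List.++ t)  ≈⟨ +∞≋⊕ _ _ ⟩
      proj₁ c ·∞ φ A ⊕ simpleSum φ (s List.++ t) ≈⟨ ⊕-congˡ _ (simpleSum-++ φ s t) ⟩
      proj₁ c ·∞ φ A ⊕ (simpleSum φ s ⊕ simpleSum φ t) ≈⟨ ⊕-assoc _ _ _ ⟨
      proj₁ c ·∞ φ A ⊕ simpleSum φ s ⊕ simpleSum φ t   ≈⟨ ⊕-congʳ _ (+∞≋⊕ (proj₁ c ·∞ φ A) _) ⟨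
      simpleSum φ ((c , A) ∷ s) ⊕ simpleSum φ t ∎
      where open ⊑-Reasoning

    simpleSum-toSimple : ∀ φ E s → simpleSum φ (toSimple E s) ≋ sum φ E s
    simpleSum-toSimple φ E (const c) =
      ≋-trans (+∞≋⊕ (proj₁ c ·∞ φ E) 0∞) (≋-trans (⊕-identityʳ _) (·∞≋·⁺ c _))
    simpleSum-toSimple φ E (split A l r) = ≋-trans
      (simpleSum-++ φ (toSimple (E ∩ₘ A) l) (toSimple (E ∖ₘ A) r))
      (⊕-cong (simpleSum-toSimple φ (E ∩ₘ A) l) (simpleSum-toSimple φ (E ∖ₘ A) r))

    -- `evaluate s x` is definitionally the simple sum against `dirac x`.
    evaluate-fromSimple : ∀ s x → evaluate s x ≋ ev (fromSimple s) x
    evaluate-fromSimple s x =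
      ≋-trans (simpleSum-fromSimple (dirac {X} x) s) (sum-dirac x (fromSimple s))

    evaluate-toSimple : ∀ s x → evaluate (toSimple wholeₘ s) x ≋ ev s x
    evaluate-toSimple s x = ≋-trans (simpleSum-toSimple (dirac {X} x ⟨_⟩) wholeₘ s) (sum-dirac x s)

  -- The Lebesgue integral

  IsMeasurable : ∀ X → (Carrier X → [0,∞]) → Set₁
  IsMeasurable X f = ∀ q → MeasurableSpace.Measurable X (λ x → f x ∋ q)

  record MeasurableFunction (X : MeasurableSpace) : Set₁ where
    constructor _,mf_
    field
      apply            : Carrier X → [0,∞]
      apply-measurable : IsMeasurable X apply

  open MeasurableFunction public

  _⊔⁺_ : ℚ⁺ → ℚ⁺ → ℚ⁺
  (c , c≥0) ⊔⁺ (d , _) = c ℚ.⊔ d , ℚₚ.≤-trans c≥0 (ℚₚ.p≤p⊔q c d)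

  fraction : ℕ → ℕ → ℚ⁺
  fraction i d = ℤ.+ i ℚ./ suc d , ℚₚ.nonNegative⁻¹ (ℤ.+ i ℚ./ suc d)
    {{ℚₚ.normalize-nonNeg i (suc d)}}

  -- Finite nested grids that exhaust the nonnegative rationals; together with 0 they supply the
  -- heights of the approximations below.
  fractions : ℕ → List ℚ⁺
  fractions n = cartesianProductWith fraction (upTo n) (upTo n)

  fractions-mono : ∀ {n c} → c ∈ fractions n → c ∈ fractions (suc n)
  fractions-mono {n} c∈ with ∈-cartesianProductWith⁻ fraction (upTo n) (upTo n) c∈
  ... | i , d , i∈ , d∈ , refl = ∈-cartesianProductWith⁺ fraction (∈-upTo-suc i∈) (∈-upTo-suc d∈)
    where
    ∈-upTo-suc : ∀ {i} → i ∈ upTo n → i ∈ upTo (suc n)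
    ∈-upTo-suc i∈ = ∈-upTo⁺ (ℕₚ.m<n⇒m<1+n (∈-upTo⁻ i∈))

  fractions-complete : ∀ r → 0ℚ ≤ r → ∃[ n ] ∃[ c ] (c ∈ fractions n × proj₁ c ≡ r)
  -- Here `d` is the denominator minus one, as in `fraction`; the outer `suc` is there because
  -- `upTo` excludes its bound.
  fractions-complete r@(ℚ.mkℚ (ℤ.+ i) d _) _ = suc (i ℕ.⊔ d) , fraction i d ,
    ∈-cartesianProductWith⁺ fraction
      (∈-upTo⁺ (ℕ.s≤s (ℕₚ.m≤m⊔n i d))) (∈-upTo⁺ (ℕ.s≤s (ℕₚ.m≤n⊔m i d))) ,
    ℚₚ.↥p/↧p≡p r
  fractions-complete (ℚ.mkℚ ℤ.-[1+ _ ] _ _) r≥0 with ℚ.nonNegative r≥0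
  ... | ()

  module _ {X : MeasurableSpace} where

    private
      module X = MeasurableSpace X

    superlevel : MeasurableFunction X → ℚ → MeasurableSet X
    superlevel f q = (λ x → apply f x ∋ q) ,meas apply-measurable f q

    -- The maximum of c and those of the given values q at which f exceeds q.
    staircase : MeasurableFunction X → ℚ⁺ → List ℚ⁺ → Step X
    staircase f c []       = const c
    staircase f c (q ∷ qs) =
      split (superlevel f (proj₁ q)) (staircase f (c ⊔⁺ q) qs) (staircase f c qs)

    staircase-base : ∀ f c qs x → proj₁ c ≤ height (staircase f c qs) x
    staircase-base f c []       x = ℚₚ.≤-refl
    staircase-base f c (q ∷ qs) x with em₀ {x ∈ₘ superlevel f (proj₁ q)}
    ... | yes _ = ℚₚ.≤-trans (ℚₚ.p≤p⊔q (proj₁ c) (proj₁ q)) (staircase-base f (c ⊔⁺ q) qs x)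
    ... | no  _ = staircase-base f c qs x

    staircase-lower : ∀ f c qs x {q} → q ∈ qs → apply f x ∋ proj₁ q →
                      proj₁ q ≤ height (staircase f c qs) x
    staircase-lower f c (q ∷ qs) x (here refl) fq with em₀ {x ∈ₘ superlevel f (proj₁ q)}
    ... | yes _  = ℚₚ.≤-trans (ℚₚ.p≤q⊔p (proj₁ c) (proj₁ q)) (staircase-base f (c ⊔⁺ q) qs x)
    ... | no ¬fq = ⊥-elim (¬fq fq)
    staircase-lower f c (q ∷ qs) x (there q∈) fq with em₀ {x ∈ₘ superlevel f (proj₁ q)}
    ... | yes _ = staircase-lower f (c ⊔⁺ q) qs x q∈ fq
    ... | no  _ = staircase-lower f c qs x q∈ fq

    staircase-upper : ∀ f c qs x {b} → proj₁ c ≤ b →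
                      (∀ {q} → q ∈ qs → apply f x ∋ proj₁ q → proj₁ q ≤ b) →
                      height (staircase f c qs) x ≤ b
    staircase-upper f c []       x c≤b qs≤b = c≤b
    staircase-upper f c (q ∷ qs) x c≤b qs≤b with em₀ {x ∈ₘ superlevel f (proj₁ q)}
    ... | yes fq = staircase-upper f (c ⊔⁺ q) qs x (ℚₚ.⊔-lub c≤b (qs≤b (here refl) fq))
                     (λ q∈ → qs≤b (there q∈))
    ... | no  _  = staircase-upper f c qs x c≤b (λ q∈ → qs≤b (there q∈))

    -- Invariant of the traversal: the running maximum stays below `f x`, because `q` enters it only
    -- where the cut `f x` contains `q`.
    staircase-below : ∀ f c qs x → ofℚ (proj₁ c) ⊑ apply f x → ev (staircase f c qs) x ⊑ apply f x
    staircase-below f c []       x c⊑f = c⊑f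
    staircase-below f c (q ∷ qs) x c⊑f with em₀ {x ∈ₘ superlevel f (proj₁ q)}
    ... | no  _  = staircase-below f c qs x c⊑f
    ... | yes fq = staircase-below f (c ⊔⁺ q) qs x (below λ
      { r (inj₁ r<0) → ∋-negative (apply f x) r<0
      ; r (inj₂ r<c⊔q) → go r r<c⊔q (ℚₚ.⊔-sel (proj₁ c) (proj₁ q)) })
      where
      c⊔q : ℚ
      c⊔q = proj₁ c ℚ.⊔ proj₁ q
      go : ∀ r → r < c⊔q → c⊔q ≡ proj₁ c ⊎ c⊔q ≡ proj₁ q → apply f x ∋ r
      go r r< (inj₁ e) = ⊑⇒≤∞ c⊑f r (inj₂ (subst (r <_) e r<))
      go r r< (inj₂ e) = ∋-down (apply f x) (ℚₚ.<⇒≤ (subst (r <_) e r<)) fq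

    approximation : MeasurableFunction X → ℕ → Step X
    approximation f n = staircase f 0⁺ (fractions n)

    approximation-nondecreasing : ∀ f → Nondecreasing (approximation f)
    approximation-nondecreasing f n x = staircase-upper f 0⁺ (fractions n) x
      (staircase-base f 0⁺ (fractions (suc n)) x)
      (λ q∈ → staircase-lower f 0⁺ (fractions (suc n)) x (fractions-mono {n} q∈))

    -- Both staircases use the same grid, and `g` exceeds every grid value that `f` exceeds.
    approximation-mono : ∀ f g n x → apply f x ⊑ apply g x →
                         height (approximation f n) x ≤ height (approximation g n) x
    approximation-mono f g n x f⊑g = staircase-upper f 0⁺ (fractions n) x
      (staircase-base g 0⁺ (fractions n) x)
      (λ q∈ fq → staircase-lower g 0⁺ (fractions n) x q∈ (⊑⇒≤∞ f⊑g _ fq))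

    -- For `q ≥ 0` in the cut of `f x`, openness gives a larger `r` in the cut, and a staircase over
    -- a grid containing `r` reaches at least height `r`.
    ⨆-approximation : ∀ f x → ⨆ (λ n → ev (approximation f n) x) ≋ apply f x
    ⨆-approximation f x =
      ⨆-least (λ n → staircase-below f 0⁺ (fractions n) x (ofℚ0⊑ _)) and below from
      where
      from : ∀ q → apply f x ∋ q → ⨆ (λ n → ev (approximation f n) x) ∋ q
      from q fq with q ℚₚ.<? 0ℚ | ∋-open (apply f x) fq
      ... | yes q<0 | _ = ∋-negative (⨆ (λ n → ev (approximation f n) x)) q<0
      ... | no q≮0 | r , q<r , fr with fractions-complete r (ℚₚ.≤-trans (ℚₚ.≮⇒≥ q≮0) (ℚₚ.<⇒≤ q<r))
      ...   | n , c , c∈ , refl = ⨆-∋ (λ n → ev (approximation f n) x) n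
                (inj₂ (ℚₚ.<-≤-trans q<r (staircase-lower f 0⁺ (fractions n) x c∈ fr)))

    -- The grid is finite, so a single `fs k` exceeds at `x` all the grid values that `f` exceeds
    -- there.
    approximation-limit : ∀ f (fs : ℕ → MeasurableFunction X) x →
                          Increasing (λ k → apply (fs k) x) →
                          apply f x ⊑ ⨆ (λ k → apply (fs k) x) → ∀ n →
                          ev (approximation f n) x ⊑ ⨆ (λ k → ev (approximation (fs k) n) x)
    approximation-limit f fs x inc f⊑ n =
      let k , h = exceeding (fractions n) in
      ⊑-trans (ofℚ-mono (staircase-upper f 0⁺ (fractions n) x
        (staircase-base (fs k) 0⁺ (fractions n) x)
        (λ q∈ fq → staircase-lower (fs k) 0⁺ (fractions n) x q∈ (h q∈ fq))))
        (⨆-upper (λ k → ev (approximation (fs k) n) x) k)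
      where
      exceeding : ∀ qs → ∃[ k ] (∀ {q} → q ∈ qs → apply f x ∋ proj₁ q → apply (fs k) x ∋ proj₁ q)
      exceeding [] = 0 , λ ()
      exceeding (q ∷ qs) with exceeding qs | em₀ {apply f x ∋ proj₁ q}
      ... | k , h | no ¬fq = k , λ { (here refl) fq → ⊥-elim (¬fq fq) ; (there q∈) fq → h q∈ fq }
      ... | k , h | yes fq with ∋-⨆ _ (⊑⇒≤∞ f⊑ (proj₁ q) fq)
      ...   | k′ , fsq = k ℕ.⊔ k′ , λ
        { (here refl) _ → ⊑⇒≤∞ (increasing-≤ inc (ℕₚ.m≤n⊔m k k′)) _ fsq
        ; (there q∈) fq → ⊑⇒≤∞ (increasing-≤ inc (ℕₚ.m≤m⊔n k k′)) _ (h q∈ fq) }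

    opaque

      -- A canonical approximating sequence makes the integral a function; `∫-isIntegral` identifies
      -- its value with the one described by `IsIntegral`.
      ∫ : SubMeasure X → MeasurableFunction X → [0,∞]
      ∫ μ f = ⨆ (λ n → sum (μ ⟨_⟩) wholeₘ (approximation f n))

    module _ (μ : SubMeasure X) where

      opaque
        unfolding ∫

        ∫≋⨆ : ∀ f → ∫ μ f ≋ ⨆ (λ n → sum (μ ⟨_⟩) wholeₘ (approximation f n))
        ∫≋⨆ f = ≋-refl _

      -- By `sum-limit` in both directions, each term of either sequence is dominated by the limit
      -- of the other. Linearity follows by choosing sequences on which it is evident.
      ∫-unique : ∀ f (t : ℕ → Step X) →
                 Nondecreasing t →
                 (∀ x → ⨆ (λ n → ev (t n) x) ≋ apply f x) →
                 ∫ μ f ≋ ⨆ (λ n → sum (μ ⟨_⟩) wholeₘ (t n))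
      ∫-unique f t t-inc t↑f = ≋-trans (∫≋⨆ f)
        (⨆-least (λ n → sum-limit μ t t-inc (approximation f n) (λ x →
           ⊑-trans (⊑-trans (⨆-upper _ n) (≋⇒⊑ (⨆-approximation f x))) (≋⇒⊒ (t↑f x))))
         and
         ⨆-least (λ n → sum-limit μ (approximation f) (approximation-nondecreasing f) (t n) (λ x →
           ⊑-trans (⊑-trans (⨆-upper _ n) (≋⇒⊑ (t↑f x))) (≋⇒⊒ (⨆-approximation f x)))))

      ∫-mono : ∀ f g → (∀ x → apply f x ⊑ apply g x) → ∫ μ f ⊑ ∫ μ g
      ∫-mono f g f⊑g = begin
        ∫ μ f                                                  ≈⟨ ∫≋⨆ f ⟩
        ⨆ (λ n → sum (μ ⟨_⟩) wholeₘ (approximation f n))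
          ≤⟨ ⨆-mono (λ n → sum-mono μ wholeₘ (approximation f n) (approximation g n)
               (λ x _ → approximation-mono f g n x (f⊑g x))) ⟩
        ⨆ (λ n → sum (μ ⟨_⟩) wholeₘ (approximation g n))       ≈⟨ ∫≋⨆ g ⟨
        ∫ μ g                                                  ∎
        where open ⊑-Reasoning

      ∫-cong : ∀ f g → (∀ x → apply f x ≋ apply g x) → ∫ μ f ≋ ∫ μ g
      ∫-cong f g f≋g = ∫-mono f g (λ x → ≋⇒⊑ (f≋g x)) and ∫-mono g f (λ x → ≋⇒⊒ (f≋g x))

      -- For a fixed grid index `n`, the approximations of the `fs k` are nondecreasing in `k` and
      -- their limit dominates `approximation f n`; `sum-limit` applies to them directly.
      monotone-convergence : ∀ f (fs : ℕ → MeasurableFunction X) →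
                             (∀ x → Increasing (λ k → apply (fs k) x)) →
                             (∀ x → apply f x ≋ ⨆ (λ k → apply (fs k) x)) →
                             ∫ μ f ≋ ⨆ (λ k → ∫ μ (fs k))
      monotone-convergence f fs inc f≋⨆ = upper and
        ⨆-least (λ k → ∫-mono (fs k) f (λ x → ⊑-trans (⨆-upper _ k) (≋⇒⊒ (f≋⨆ x))))
        where
        open ⊑-Reasoning
        approximation⊑ : ∀ n → sum (μ ⟨_⟩) wholeₘ (approximation f n) ⊑ ⨆ (λ k → ∫ μ (fs k))
        approximation⊑ n = begin
          sum (μ ⟨_⟩) wholeₘ (approximation f n)
            ≤⟨ sum-limit μ (λ k → approximation (fs k) n)
                 (λ k x → approximation-mono (fs k) (fs (suc k)) n x (inc x k))
                 (approximation f n)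
                 (λ x → approximation-limit f fs x (inc x) (≋⇒⊑ (f≋⨆ x)) n) ⟩
          ⨆ (λ k → sum (μ ⟨_⟩) wholeₘ (approximation (fs k) n))
            ≤⟨ ⨆-mono (λ k → ⊑-trans (⨆-upper _ n) (≋⇒⊒ (∫≋⨆ (fs k)))) ⟩
          ⨆ (λ k → ∫ μ (fs k)) ∎
        upper : ∫ μ f ⊑ ⨆ (λ k → ∫ μ (fs k))
        upper = ⊑-trans (≋⇒⊑ (∫≋⨆ f)) (⨆-least approximation⊑)

    nondecreasing⇒ev-increasing : ∀ (t : ℕ → Step X) → Nondecreasing t →
                                    ∀ x → Increasing (λ n → ev (t n) x)
    nondecreasing⇒ev-increasing t t-inc x n = ofℚ-mono (t-inc n x)

    height-shift : ∀ c (t : Step X) x → height (shift c t) x ≡ proj₁ c + height t x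
    height-shift c (const _)     x = refl
    height-shift c (split A l r) x with em₀ {x ∈ₘ A}
    ... | yes _ = height-shift c l x
    ... | no  _ = height-shift c r x

    height-⊞ : ∀ (s t : Step X) x → height (s ⊞ t) x ≡ height s x + height t x
    height-⊞ (const c)     t x = height-shift c t x
    height-⊞ (split A l r) t x with em₀ {x ∈ₘ A}
    ... | yes _ = height-⊞ l t x
    ... | no  _ = height-⊞ r t x

    height-scale : ∀ c (t : Step X) x → height (scale c t) x ≡ proj₁ c * height t x
    height-scale c (const _)     x = refl
    height-scale c (split A l r) x with em₀ {x ∈ₘ A}
    ... | yes _ = height-scale c l x
    ... | no  _ = height-scale c r x

    ev-⊞ : ∀ (s t : Step X) x → ev (s ⊞ t) x ≋ ev s x ⊕ ev t x
    ev-⊞ s t x = begin-equality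
      ev (s ⊞ t) x                                       ≈⟨ sum-dirac x (s ⊞ t) ⟨
      sum (dirac {X} x ⟨_⟩) wholeₘ (s ⊞ t)               ≈⟨ sum-⊞ (dirac {X} x) wholeₘ s t ⟩
      sum (dirac {X} x ⟨_⟩) wholeₘ s ⊕ sum (dirac {X} x ⟨_⟩) wholeₘ t
        ≈⟨ ⊕-cong (sum-dirac x s) (sum-dirac x t) ⟩
      ev s x ⊕ ev t x                                    ∎
      where open ⊑-Reasoning

    ev-scale : ∀ c (t : Step X) x → ev (scale c t) x ≋ c ·⁺ ev t x
    ev-scale c t x = ≋-trans (≋-sym (sum-dirac x (scale c t)))
      (≋-trans (sum-scale (dirac {X} x) c wholeₘ t) (·⁺-cong c (sum-dirac x t)))

    module _ (μ : SubMeasure X) where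

      sum-approximation-increasing : ∀ f → Increasing (λ n → sum (μ ⟨_⟩) wholeₘ (approximation f n))
      sum-approximation-increasing f n =
        sum-mono μ wholeₘ (approximation f n) (approximation f (suc n))
          (λ x _ → approximation-nondecreasing f n x)

      -- Stated for any measurable `h` with the right values, so that each use can bring its own
      -- proof of measurability.
      ∫-⊕ : ∀ f g h → (∀ x → apply h x ≋ apply f x ⊕ apply g x) → ∫ μ h ≋ ∫ μ f ⊕ ∫ μ g
      ∫-⊕ f g h h≋f⊕g = begin-equality
        ∫ μ h
          ≈⟨ ∫-unique μ h (λ n → fₙ n ⊞ gₙ n) inc lim ⟩
        ⨆ (λ n → sum (μ ⟨_⟩) wholeₘ (fₙ n ⊞ gₙ n))
          ≈⟨ ⨆-cong (λ n → sum-⊞ μ wholeₘ (fₙ n) (gₙ n)) ⟩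
        ⨆ (λ n → sum (μ ⟨_⟩) wholeₘ (fₙ n) ⊕ sum (μ ⟨_⟩) wholeₘ (gₙ n))
          ≈⟨ ⨆-⊕ (sum-approximation-increasing f) (sum-approximation-increasing g) ⟩
        ⨆ (λ n → sum (μ ⟨_⟩) wholeₘ (fₙ n)) ⊕ ⨆ (λ n → sum (μ ⟨_⟩) wholeₘ (gₙ n))
          ≈⟨ ⊕-cong (∫≋⨆ μ f) (∫≋⨆ μ g) ⟨
        ∫ μ f ⊕ ∫ μ g ∎
        where
        open ⊑-Reasoning
        fₙ gₙ : ℕ → Step X
        fₙ = approximation f
        gₙ = approximation g
        inc : Nondecreasing (λ n → fₙ n ⊞ gₙ n)
        inc n x = ≡.subst₂ _≤_
          (sym (height-⊞ (fₙ n) (gₙ n) x)) (sym (height-⊞ (fₙ (suc n)) (gₙ (suc n)) x)) $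
          ℚₚ.+-mono-≤ (approximation-nondecreasing f n x) (approximation-nondecreasing g n x)
        lim : ∀ x → ⨆ (λ n → ev (fₙ n ⊞ gₙ n) x) ≋ apply h x
        lim x = begin-equality
          ⨆ (λ n → ev (fₙ n ⊞ gₙ n) x)                  ≈⟨ ⨆-cong (λ n → ev-⊞ (fₙ n) (gₙ n) x) ⟩
          ⨆ (λ n → ev (fₙ n) x ⊕ ev (gₙ n) x)
            ≈⟨ ⨆-⊕ (nondecreasing⇒ev-increasing fₙ (approximation-nondecreasing f) x)
                   (nondecreasing⇒ev-increasing gₙ (approximation-nondecreasing g) x) ⟩
          ⨆ (λ n → ev (fₙ n) x) ⊕ ⨆ (λ n → ev (gₙ n) x)
            ≈⟨ ⊕-cong (⨆-approximation f x) (⨆-approximation g x) ⟩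
          apply f x ⊕ apply g x                          ≈⟨ h≋f⊕g x ⟨
          apply h x ∎

      ∫-·⁺ : ∀ c f h → (∀ x → apply h x ≋ c ·⁺ apply f x) → ∫ μ h ≋ c ·⁺ ∫ μ f
      ∫-·⁺ c f h h≋cf = begin-equality
        ∫ μ h ≈⟨ ∫-unique μ h (λ n → scale c (approximation f n)) inc lim ⟩
        ⨆ (λ n → sum (μ ⟨_⟩) wholeₘ (scale c (approximation f n)))
          ≈⟨ ⨆-cong (λ n → sum-scale μ c wholeₘ (approximation f n)) ⟩
        ⨆ (λ n → c ·⁺ sum (μ ⟨_⟩) wholeₘ (approximation f n)) ≈⟨ ⨆-·⁺ c _ ⟩
        c ·⁺ ⨆ (λ n → sum (μ ⟨_⟩) wholeₘ (approximation f n)) ≈⟨ ·⁺-cong c (∫≋⨆ μ f) ⟨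
        c ·⁺ ∫ μ f ∎
        where
        open ⊑-Reasoning
        inc : Nondecreasing (λ n → scale c (approximation f n))
        inc n x = ≡.subst₂ _≤_
          (sym (height-scale c (approximation f n) x))
          (sym (height-scale c (approximation f (suc n)) x)) $
          *-monoʳ⁺ c (approximation-nondecreasing f n x)
        lim : ∀ x → ⨆ (λ n → ev (scale c (approximation f n)) x) ≋ apply h x
        lim x = ≋-trans (⨆-cong (λ n → ev-scale c (approximation f n) x))
               (≋-trans (⨆-·⁺ c _) (≋-trans (·⁺-cong c (⨆-approximation f x)) (≋-sym (h≋cf x))))

      ∫-step : ∀ f s → (∀ x → apply f x ≋ ev s x) → ∫ μ f ≋ sum (μ ⟨_⟩) wholeₘ s
      ∫-step f s f≋s = ≋-trans
        (∫-unique μ f (λ _ → s) (λ _ _ → ℚₚ.≤-refl) (λ x → ≋-trans (⨆-const _) (≋-sym (f≋s x))))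
        (⨆-const _)

      -- A simple function below `f`, read as a step function, is dominated by the limit of the
      -- approximations. Conversely each approximation, read as a simple function, is itself a test
      -- function below `f`, so every upper bound `u` dominates its sum.
      ∫-isIntegral : ∀ f → IsIntegral μ (apply f) (∫ μ f)
      ∫-isIntegral f =
        (λ s s≤f → ⊑⇒≤∞ (begin
           simpleSum (μ ⟨_⟩) s                        ≈⟨ simpleSum-fromSimple μ s ⟩
           sum (μ ⟨_⟩) wholeₘ (fromSimple s)
             ≤⟨ sum-limit μ (approximation f) (approximation-nondecreasing f) (fromSimple s)
                  (λ x → ⊑-trans (⊑-trans (≋⇒⊒ (evaluate-fromSimple s x)) (below (s≤f x)))
                                 (≋⇒⊒ (⨆-approximation f x))) ⟩
           ⨆ (λ n → sum (μ ⟨_⟩) wholeₘ (approximation f n)) ≈⟨ ∫≋⨆ μ f ⟨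
           ∫ μ f ∎)) ,
        (λ u bound → ⊑⇒≤∞ (⊑-trans (≋⇒⊑ (∫≋⨆ μ f)) (⨆-least (λ n → ⊑-trans
           (≋⇒⊒ (simpleSum-toSimple (μ ⟨_⟩) wholeₘ (approximation f n)))
           (≤∞⇒⊑ _ u (bound (toSimple wholeₘ (approximation f n)) (λ x → ⊑⇒≤∞ (
             ⊑-trans (≋⇒⊑ (evaluate-toSimple (approximation f n) x))
             (⊑-trans (⨆-upper _ n) (≋⇒⊑ (⨆-approximation f x)))))))))))
        where open ⊑-Reasoning

    IsIntegral-cong : ∀ (μ : SubMeasure X) f g v w →
                      (∀ x → f x ≋ g x) → v ≋ w → IsIntegral μ f v → IsIntegral μ g w
    IsIntegral-cong μ f g v w f≋g v≋w (≤v , v≤) =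
      (λ s s≤g q h → ⊑⇒≤∞ (≋⇒⊑ v≋w) q (≤v s (λ x r h → ⊑⇒≤∞ (≋⇒⊒ (f≋g x)) r (s≤g x r h)) q h)) ,
      (λ u bound q h → v≤ u (λ s s≤f → bound s (λ x r h → ⊑⇒≤∞ (≋⇒⊑ (f≋g x)) r (s≤f x r h))) q
        (⊑⇒≤∞ (≋⇒⊒ v≋w) q h))

    IsIntegral-unique : ∀ (μ : SubMeasure X) f v w → IsIntegral μ f v → IsIntegral μ f w → v ≋ w
    IsIntegral-unique μ f v w (≤v , v≤) (≤w , w≤) = below (v≤ w ≤w) and below (w≤ v ≤v)

    IsIntegral⇒≋∫ : ∀ (μ : SubMeasure X) f v g →
                    IsIntegral μ f v → (∀ x → f x ≋ apply g x) → v ≋ ∫ μ g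
    IsIntegral⇒≋∫ μ f v g I f≋g = IsIntegral-unique μ (apply g) v (∫ μ g)
      (IsIntegral-cong μ f (apply g) v v f≋g (≋-refl v) I) (∫-isIntegral μ g)

    ≋∫⇒IsIntegral : ∀ (μ : SubMeasure X) f v g →
                    (∀ x → f x ≋ apply g x) → v ≋ ∫ μ g → IsIntegral μ f v
    ≋∫⇒IsIntegral μ f v g f≋g v≋ =
      IsIntegral-cong μ (apply g) f (∫ μ g) v (λ x → ≋-sym (f≋g x)) (≋-sym v≋) (∫-isIntegral μ g)

    ∫-indicator : ∀ μ f A → (∀ x → apply f x ≋ indicator (x ∈ₘ A)) → ∫ μ f ≋ μ ⟨ A ⟩
    ∫-indicator μ f A f≋1 = begin-equality
      ∫ μ f ≈⟨ ∫-step μ f 1A f≋ev ⟩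
      1⁺ ·⁺ μ ⟨ wholeₘ ∩ₘ A ⟩ ⊕ 0⁺ ·⁺ μ ⟨ wholeₘ ∖ₘ A ⟩ ≈⟨ ⊕-cong (·⁺-identityˡ _) (·⁺-zeroˡ _) ⟩
      μ ⟨ wholeₘ ∩ₘ A ⟩ ⊕ 0∞ ≈⟨ ⊕-identityʳ _ ⟩
      μ ⟨ wholeₘ ∩ₘ A ⟩ ≈⟨ measure-cong μ {wholeₘ ∩ₘ A} {A} (proj₂ , (λ a → tt , a)) ⟩
      μ ⟨ A ⟩ ∎
      where
      open ⊑-Reasoning
      1A : Step X
      1A = split A (const 1⁺) (const 0⁺)
      f≋ev : ∀ x → apply f x ≋ ev 1A x
      f≋ev x = ≋-trans (f≋1 x) go
        where
        go : indicator (x ∈ₘ A) ≋ ev 1A x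
        go with em₀ {x ∈ₘ A}
        ... | yes a = ⟦⟧·-true 1∞ a
        ... | no ¬a = ≋-trans (⟦⟧·-false 1∞ ¬a) (0∞-least _ and ofℚ0⊑ 0∞)

    ∫-dirac : ∀ x f → ∫ (dirac {X} x) f ≋ apply f x
    ∫-dirac x f = ≋-trans (∫≋⨆ (dirac {X} x) f)
      (≋-trans (⨆-cong (λ n → sum-dirac x (approximation f n))) (⨆-approximation f x))

    sum-≈ : ∀ (μ ν : SubMeasure X) → μ ≈ₘ ν → ∀ E t → sum (μ ⟨_⟩) E t ≋ sum (ν ⟨_⟩) E t
    sum-≈ μ ν μ≈ν E (const c)     = ·⁺-cong c (≈∞⇒≋ (μ≈ν E))
    sum-≈ μ ν μ≈ν E (split A l r) = ⊕-cong (sum-≈ μ ν μ≈ν (E ∩ₘ A) l) (sum-≈ μ ν μ≈ν (E ∖ₘ A) r)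

    ∫-≈ : ∀ (μ ν : SubMeasure X) → μ ≈ₘ ν → ∀ f → ∫ μ f ≋ ∫ ν f
    ∫-≈ μ ν μ≈ν f = ≋-trans (∫≋⨆ μ f)
      (≋-trans (⨆-cong (λ n → sum-≈ μ ν μ≈ν wholeₘ (approximation f n))) (≋-sym (∫≋⨆ ν f)))

    ∫≤1 : ∀ μ f → (∀ x → apply f x ⊑ 1∞) → ∫ μ f ⊑ 1∞
    ∫≤1 μ f f≤1 = begin
      ∫ μ f ≈⟨ ∫≋⨆ μ f ⟩
      ⨆ (λ n → sum (μ ⟨_⟩) wholeₘ (approximation f n))
        ≤⟨ ⨆-least (λ n → ⊑-trans
             (sum-limit μ (λ _ → const 1⁺) (λ _ _ → ℚₚ.≤-refl) (approximation f n) (λ x →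
               ⊑-trans (⊑-trans (⨆-upper _ n) (≋⇒⊑ (⨆-approximation f x)))
                       (⊑-trans (f≤1 x) (⨆-upper (λ _ → 1∞) 0))))
             (≋⇒⊑ (⨆-const _))) ⟩
      1⁺ ·⁺ μ ⟨ wholeₘ ⟩ ≈⟨ ·⁺-identityˡ _ ⟩
      μ ⟨ wholeₘ ⟩ ≤⟨ below (SubMeasure.mass≤1 μ) ⟩
      1∞ ∎
      where open ⊑-Reasoning

  infixr 9 _∘ᶠ_

  _∘ᶠ_ : ∀ {X Y} → MeasurableFunction Y → Hom X Y → MeasurableFunction X
  f ∘ᶠ h = (λ x → apply f (fun h x)) ,mf (λ q → preimage h (apply-measurable f q))

  -- Change of variables already holds at each approximation: `f` and `f ∘ᶠ h` have trees of the
  -- same shape, whose branching sets correspond under preimage along `h`.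
  ∫-pushforward : ∀ {X Y} (h : Hom X Y) μ f → ∫ (pushforward h μ) f ≋ ∫ μ (f ∘ᶠ h)
  ∫-pushforward {X} {Y} h μ f = ≋-trans (∫≋⨆ (pushforward h μ) f)
    (≋-trans (⨆-cong (λ n → go wholeₘ wholeₘ 0⁺ (fractions n) ((λ a → a) , (λ a → a))))
      (≋-sym (∫≋⨆ μ (f ∘ᶠ h))))
    where
    go : ∀ E E′ c qs → fun h ⊢ set E ≐ set E′ →
         sum (pushforward h μ ⟨_⟩) E (staircase f c qs) ≋ sum (μ ⟨_⟩) E′ (staircase (f ∘ᶠ h) c qs)
    go E E′ c []       e = ·⁺-cong c (measure-cong μ {preimageₘ h E} {E′} e)
    go E E′ c (q ∷ qs) e@(i , j) = ⊕-cong
      (go (E ∩ₘ superlevel f (proj₁ q)) _ (c ⊔⁺ q) qs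
        ((λ (a , b) → i a , b) , (λ (a , b) → j a , b)))
      (go (E ∖ₘ superlevel f (proj₁ q)) _ c qs ((λ (a , b) → i a , b) , (λ (a , b) → j a , b)))

  -- Countable sets, encoded by the closure of σ-algebras under unions which they index

  Countable : Set → Set₂
  Countable I = ∀ X {A : I → Pred (Carrier X) 0ℓ} → (∀ i → MeasurableSpace.Measurable X (A i)) →
                MeasurableSpace.Measurable X (λ x → ∃[ i ] A i x)

  countable-ℕ : Countable ℕ
  countable-ℕ X = MeasurableSpace.union X

  countable-image : ∀ {I J : Set} (f : I → J) → (∀ j → ∃[ i ] f i ≡ j) → Countable I → Countable J
  countable-image f surj count-I X {A} A-meas = MeasurableSpace.measurable-≐ X
    ( (λ (i , a) → f i , a)
    , (λ (j , a) → let i , fi≡j = surj j in i , subst (λ j → A j _) (sym fi≡j) a))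
    (count-I X (λ i → A-meas (f i)))

  countable-× : ∀ {I J : Set} → Countable I → Countable J → Countable (I × J)
  countable-× count-I count-J X A-meas = MeasurableSpace.measurable-≐ X
    ((λ (i , j , a) → (i , j) , a) , (λ ((i , j) , a) → i , j , a))
    (count-I X (λ i → count-J X (λ j → A-meas (i , j))))

  countable-Bool : Countable Bool
  countable-Bool = countable-image (λ { zero → false ; (suc _) → true })
    (λ { false → 0 , refl ; true → 1 , refl }) countable-ℕ

  countable-Vec : ∀ {I : Set} n → Countable I → Countable (Vec I n)
  countable-Vec zero    count-I = countable-image {ℕ} (λ _ → []) (λ { [] → 0 , refl }) countable-ℕ
  countable-Vec (suc n) count-I =
    countable-image (λ (i , is) → i ∷ is) (λ { (i ∷ is) → (i , is) , refl })
      (countable-× count-I (countable-Vec n count-I))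

  countable-ℚ : Countable ℚ
  countable-ℚ = countable-image (λ (b , i , d) → numerator b i ℚ./ suc d) surj
    (countable-× countable-Bool (countable-× countable-ℕ countable-ℕ))
    where
    numerator : Bool → ℕ → ℤ.ℤ
    numerator true  i = ℤ.+ i
    numerator false i = ℤ.-[1+ i ]
    surj : ∀ q → ∃[ t ] (numerator (proj₁ t) (proj₁ (proj₂ t)) ℚ./ suc (proj₂ (proj₂ t)) ≡ q)
    surj q@(ℚ.mkℚ (ℤ.+ i) d _)     = (true , i , d) , ℚₚ.↥p/↧p≡p q
    surj q@(ℚ.mkℚ ℤ.-[1+ i ] d _) = (false , i , d) , ℚₚ.↥p/↧p≡p q

  -- Measurability of sums, multiples and suprema

  module _ {X : MeasurableSpace} where

    private
      module X = MeasurableSpace X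

    IsMeasurable-cong : ∀ {f g} → (∀ x → f x ≋ g x) → IsMeasurable X f → IsMeasurable X g
    IsMeasurable-cong f≋g mf q = X.measurable-≐
      ((λ {x} → ⊑⇒≤∞ (≋⇒⊑ (f≋g x)) q) , (λ {x} → ⊑⇒≤∞ (≋⇒⊒ (f≋g x)) q)) (mf q)

    const-measurable : ∀ a → IsMeasurable X (λ _ → a)
    const-measurable a q = measurable (always {X} (a ∋ q))

    ⊕-measurable : ∀ {f g} → IsMeasurable X f → IsMeasurable X g → IsMeasurable X (λ x → f x ⊕ g x)
    ⊕-measurable {f} {g} mf mg q = X.measurable-≐
      ((λ {x} (r , fr , gr) → ⊕-∋ (f x) (g x) r fr gr) , (λ {x} → ∋-⊕ (f x) (g x)))
      (countable-ℚ X (λ r → measurable {X} ((_ ,meas mf r) ∩ₘ (_ ,meas mg (q - r)))))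

    ·⁺-measurable : ∀ c {f} → IsMeasurable X f → IsMeasurable X (λ x → c ·⁺ f x)
    ·⁺-measurable c {f} mf q = X.measurable-≐
      ((λ {x} → ·⁺-∋ c (f x)) , (λ {x} → ∋-·⁺ c (f x)))
      (measurable {X} (always {X} (q < 0ℚ) ∪ₘ
        (_ ,meas countable-ℚ X (λ r →
          measurable {X} ((_ ,meas mf r) ∩ₘ always {X} (q < proj₁ c * r))))))

    ⨆-measurable : ∀ {f : Carrier X → ℕ → [0,∞]} → (∀ n → IsMeasurable X (λ x → f x n)) →
                   IsMeasurable X (λ x → ⨆ (f x))
    ⨆-measurable {f} mf q = X.measurable-≐
      ((λ {x} (n , h) → ⨆-∋ (f x) n h) , (λ {x} → ∋-⨆ (f x))) (X.union (λ n → mf n q))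

    partialSum-measurable : ∀ {f : Carrier X → ℕ → [0,∞]} → (∀ n → IsMeasurable X (λ x → f x n)) →
                            ∀ n → IsMeasurable X (λ x → partialSum n (f x))
    partialSum-measurable mf zero    = const-measurable 0∞
    partialSum-measurable mf (suc n) = ⊕-measurable (partialSum-measurable mf n) (mf n)

  -- The Giry monad

  module _ {X Y : MeasurableSpace} where

    kernel : (k : Carrier X → SubMeasure Y) →
             (∀ {x x′} → MeasurableSpace._≈_ X x x′ → k x ≈ₘ k x′) →
             (∀ A → IsMeasurable X (λ x → k x ⟨ A ⟩)) → Hom X (𝒢 Y)
    kernel k k-cong k-meas = record
      { fun      = k
      ; fun-cong = k-cong
      ; preimage = Generated-preimage X k λ { (evaluation A q) → k-meas A q }
      }

    kernelAt : Hom X (𝒢 Y) → MeasurableSet Y → MeasurableFunction X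
    kernelAt k A = (λ x → fun k x ⟨ A ⟩) ,mf λ q → preimage k (generator (evaluation A q))

    sum-measurable : ∀ (k : Hom X (𝒢 Y)) E t → IsMeasurable X (λ x → sum (fun k x ⟨_⟩) E t)
    sum-measurable k E (const c)     = ·⁺-measurable {X} c (apply-measurable (kernelAt k E))
    sum-measurable k E (split A l r) =
      ⊕-measurable {X} (sum-measurable k (E ∩ₘ A) l) (sum-measurable k (E ∖ₘ A) r)

    ∫-measurable : ∀ (k : Hom X (𝒢 Y)) f → IsMeasurable X (λ x → ∫ (fun k x) f)
    ∫-measurable k f = IsMeasurable-cong {X} (λ x → ≋-sym (∫≋⨆ (fun k x) f))
      (⨆-measurable {X} {λ x n → sum (fun k x ⟨_⟩) wholeₘ (approximation f n)}
        (λ n → sum-measurable k wholeₘ (approximation f n)))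

    ∫-kernel : Hom X (𝒢 Y) → MeasurableFunction Y → MeasurableFunction X
    ∫-kernel k f = (λ x → ∫ (fun k x) f) ,mf ∫-measurable k f

    opaque

      bind : SubMeasure X → Hom X (𝒢 Y) → SubMeasure Y
      bind μ k = record
        { _⟨_⟩       = λ A → ∫ μ (kernelAt k A)
        ; respects-≐ = λ {A} {B} A≐B → ≋⇒≈∞ (∫-cong μ (kernelAt k A) (kernelAt k B)
            (λ x → measure-cong (fun k x) {A} {B} A≐B))
        ; empty-null = ≋⇒≈∞ (null emptyₘ (λ x → ≈∞⇒≋ (SubMeasure.empty-null (fun k x))))
        ; σ-additive = λ A disjoint → ≋⇒≈∞ (additive A disjoint)
        ; mass≤1     = ⊑⇒≤∞ (∫≤1 μ (kernelAt k wholeₘ) (λ x → below (SubMeasure.mass≤1 (fun k x))))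
        }
        where
        ∫-zero : ∀ f → (∀ x → apply f x ≋ 0∞) → ∫ μ f ≋ 0∞
        ∫-zero f f≋0 = ≋-trans
          (∫-indicator μ f emptyₘ (λ x → ≋-trans (f≋0 x) (≋-sym (⟦⟧·-false 1∞ (λ h → h tt)))))
          (≈∞⇒≋ (SubMeasure.empty-null μ))
        null : ∀ A → (∀ x → fun k x ⟨ A ⟩ ≋ 0∞) → ∫ μ (kernelAt k A) ≋ 0∞
        null A = ∫-zero (kernelAt k A)
        additive : ∀ A → (∀ {i j} → i ≢ j → ∀ {x} → x ∈ₘ A i → x ∈ₘ A j → ⊥) →
                   ∫ μ (kernelAt k (unionₘ A)) ≋ ∑ (λ n → ∫ μ (kernelAt k (A n)))
        additive A disjoint = begin-equality
          ∫ μ (kernelAt k (unionₘ A))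
            ≈⟨ monotone-convergence μ (kernelAt k (unionₘ A)) partial
                 (λ x → partialSum-increasing (λ i → fun k x ⟨ A i ⟩))
                 (λ x → ≋-trans (≈∞⇒≋ (SubMeasure.σ-additive (fun k x) A disjoint)) (∑≋⨆ _)) ⟩
          ⨆ (λ n → ∫ μ (partial n))                                ≈⟨ ⨆-cong ∫-partial ⟩
          ⨆ (λ n → partialSum n (λ i → ∫ μ (kernelAt k (A i))))    ≈⟨ ∑≋⨆ _ ⟨
          ∑ (λ n → ∫ μ (kernelAt k (A n)))                         ∎
          where
          open ⊑-Reasoning
          partial : ℕ → MeasurableFunction X
          partial n = (λ x → partialSum n (λ i → fun k x ⟨ A i ⟩)) ,mf
                      partialSum-measurable {X} {λ x i → fun k x ⟨ A i ⟩}
                        (λ i → apply-measurable (kernelAt k (A i))) n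
          ∫-partial : ∀ n → ∫ μ (partial n) ≋ partialSum n (λ i → ∫ μ (kernelAt k (A i)))
          ∫-partial zero    = ∫-zero (partial zero) (λ _ → ≋-refl 0∞)
          ∫-partial (suc n) = ≋-trans
            (∫-⊕ μ (partial n) (kernelAt k (A n)) (partial (suc n)) (λ _ → ≋-refl _))
            (⊕-congʳ _ (∫-partial n))

      bind≋∫ : ∀ μ k A → bind μ k ⟨ A ⟩ ≋ ∫ μ (kernelAt k A)
      bind≋∫ μ k A = ≋-refl _

    ∫-sum : ∀ μ k E t →
            sum (bind μ k ⟨_⟩) E t ≋ ∫ μ ((λ x → sum (fun k x ⟨_⟩) E t) ,mf sum-measurable k E t)
    ∫-sum μ k E (const c)     = ≋-trans
      (·⁺-cong c (bind≋∫ μ k E))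
      (≋-sym (∫-·⁺ μ c (kernelAt k E) _ (λ _ → ≋-refl _)))
    ∫-sum μ k E (split A l r) = ≋-trans
      (⊕-cong (∫-sum μ k (E ∩ₘ A) l) (∫-sum μ k (E ∖ₘ A) r))
      (≋-sym (∫-⊕ μ (_ ,mf sum-measurable k (E ∩ₘ A) l) (_ ,mf sum-measurable k (E ∖ₘ A) r) _
        (λ _ → ≋-refl _)))

    -- For measures of sets this is the definition of `bind`; linearity extends it to step functions
    -- (`∫-sum`), monotone convergence to all `f`.
    ∫-bind : ∀ μ k f → ∫ (bind μ k) f ≋ ∫ μ (∫-kernel k f)
    ∫-bind μ k f = begin-equality
      ∫ (bind μ k) f                                                   ≈⟨ ∫≋⨆ (bind μ k) f ⟩
      ⨆ (λ n → sum (bind μ k ⟨_⟩) wholeₘ (approximation f n))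
        ≈⟨ ⨆-cong (λ n → ∫-sum μ k wholeₘ (approximation f n)) ⟩
      ⨆ (λ n → ∫ μ (sums n))
        ≈⟨ monotone-convergence μ (∫-kernel k f) sums
             (λ x → sum-approximation-increasing (fun k x) f) (λ x → ∫≋⨆ (fun k x) f) ⟨
      ∫ μ (∫-kernel k f)                                               ∎
      where
      open ⊑-Reasoning
      sums : ℕ → MeasurableFunction X
      sums n = (λ x → sum (fun k x ⟨_⟩) wholeₘ (approximation f n)) ,mf
               sum-measurable k wholeₘ (approximation f n)

  infixl 7 _>=>_

  _>=>_ : ∀ {X Y Z} → Hom X (𝒢 Y) → Hom Y (𝒢 Z) → Hom X (𝒢 Z)
  _>=>_ {X} k l = kernel (λ x → bind (fun k x) l)
    (λ {x} {x′} x≈x′ A → ≋⇒≈∞ (≋-trans (bind≋∫ (fun k x) l A)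
      (≋-trans (∫-≈ (fun k x) (fun k x′) (fun-cong k x≈x′) (kernelAt l A))
        (≋-sym (bind≋∫ (fun k x′) l A)))))
    (λ A → IsMeasurable-cong {X} (λ x → ≋-sym (bind≋∫ (fun k x) l A))
      (∫-measurable k (kernelAt l A)))

  pushforwardₕ : ∀ {Y Z} → Hom Y Z → Hom (𝒢 Y) (𝒢 Z)
  pushforwardₕ h = kernel (pushforward h) (λ e A → e (preimageₘ h A))
    (λ A q → generator (evaluation (preimageₘ h A) q))

  -- The set is the union over `i` of the rectangles with sides `{i}` and `A i`.
  discrete-⊗-measurable : ∀ {I : Set} {Y} {A : I → Pred (Carrier Y) 0ℓ} → Countable I →
                          (∀ i → MeasurableSpace.Measurable Y (A i)) →
                          MeasurableSpace.Measurable (discrete I ⊗ Y) (λ (i , y) → A (lower i) y)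
  discrete-⊗-measurable {I} {Y} {A} count A-meas = MeasurableSpace.measurable-≐ (discrete I ⊗ Y)
    ((λ { (i , refl , a) → a }) , (λ {(i , y)} a → lower i , refl , a))
    (count (discrete I ⊗ Y) {λ i (j , y) → lower j ≡ i × A i y} (λ i →
      generator (rectangle ((λ j → lower j ≡ i) ,meas lift tt) (A i ,meas A-meas i))))

  -- Kleisli composition for the graded monad

  module _ {n : ℕ} where

    countable-Obs : ∀ j → Countable (Vec (Subset n) j)
    countable-Obs j = countable-Vec j (countable-Vec n countable-Bool)

    prepend : ∀ {j k X} → Vec (Subset n) j → Hom (Obs n k ⊗ X) (Obs n (j ℕ.+ k) ⊗ X)
    prepend {j} {k} b = _⊗id {Obs n k} {Obs n (j ℕ.+ k)} record
      { fun      = λ (lift c) → lift (b ++ c)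
      ; fun-cong = cong _
      ; preimage = λ _ → lift tt
      }

    -- The earlier record `b` is carried along and prepended to what `l` records. Joint
    -- measurability reduces to that for each fixed `b`, since there are countably many records.
    strengthen : ∀ j {k Y Z} → Hom Y (N n k Z) → Hom (Obs n j ⊗ Y) (N n (j ℕ.+ k) Z)
    strengthen j l = kernel (λ (b , y) → pushforward (prepend (lower b)) (fun l y))
      (λ { (refl , y≈y′) S → fun-cong l y≈y′ (section _ S) })
      (λ S q → discrete-⊗-measurable (countable-Obs j)
        (λ b → preimage l (generator (evaluation (section b S) q))))

    infixl 7 _⊙_

    opaque

      -- Multiplication after `mapN l`, computed without passing through a measure on measures;
      -- `⊙-isMultiplication` proves the agreement.
      _⊙_ : ∀ {j k X Y Z} → Hom X (N n j Y) → Hom Y (N n k Z) → Hom X (N n (j ℕ.+ k) Z)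
      _⊙_ {j} a l = a >=> strengthen j l

      ⊙≋∫ : ∀ {j k X Y Z} (a : Hom X (N n j Y)) (l : Hom Y (N n k Z)) x S →
            fun (a ⊙ l) x ⟨ S ⟩ ≋ ∫ (fun a x) (kernelAt (strengthen j l) S)
      ⊙≋∫ {j} a l x S = bind≋∫ (fun a x) (strengthen j l) S

      ∫-⊙ : ∀ {j k X Y Z} (a : Hom X (N n j Y)) (l : Hom Y (N n k Z)) x f →
            ∫ (fun (a ⊙ l) x) f ≋ ∫ (fun a x) (∫-kernel (strengthen j l) f)
      ∫-⊙ {j} {k} {X} {Y} {Z} a l x f =
        ∫-bind {Obs n j ⊗ Y} {Obs n (j ℕ.+ k) ⊗ Z} (fun a x) (strengthen j l) f

    ⊙-isMultiplication : ∀ {j k X Y Z} (a : Hom X (N n j Y)) (l : Hom Y (N n k Z)) x ν →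
                         ν ≈ₘ fun (a ⊙ l) x →
                         IsMultiplication (mapN l (fun a x)) ν
    ⊙-isMultiplication {j} {k} {X} {Y} {Z} a l x ν ν≈ S =
      ≋∫⇒IsIntegral (mapN l (fun a x)) _ (ν ⟨ S ⟩) integrand (λ _ → ≋-refl _)
        (≋-trans (≈∞⇒≋ (ν≈ S)) (≋-trans (≋-trans (⊙≋∫ a l x S)
          (∫-cong (fun a x) (kernelAt (strengthen j l) S) (integrand ∘ᶠ (Obs n j id⊗ l))
            (λ _ → ≋-refl _)))
          (≋-sym (∫-pushforward (Obs n j id⊗ l) (fun a x) integrand))))
      where
      -- With the identity as kernel on `N n k Z`, `strengthen` sends `(b , ρ)` to `ρ` with `b`
      -- prepended; this supplies the measurability of the integrand in the multiplication.
      integrand : MeasurableFunction (Obs n j ⊗ N n k Z)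
      integrand = kernelAt (strengthen j idₘ) S

  -- The graded coalgebra of a process

  module ≈ₘ-Reasoning (X : MeasurableSpace) = SetoidReasoning (MeasurableSpace.setoid (𝒢 X))

  ≈ₘ-refl : ∀ {X} (μ : SubMeasure X) → μ ≈ₘ μ
  ≈ₘ-refl {X} μ = MeasurableSpace.≈-refl (𝒢 X) {μ}

  module _ {n : ℕ} where

    castₘ : ∀ {j k X} → j ≡ k → Hom (Obs n j ⊗ X) (Obs n k ⊗ X)
    castₘ {j} {k} e = _⊗id {Obs n j} {Obs n k} record
      { fun      = λ (lift b) → lift (Vec.cast e b)
      ; fun-cong = cong _
      ; preimage = λ _ → lift tt
      }

    -- Casting a vector does not depend on the proof of equal lengths, so every loop `e` acts as the
    -- identity. This allows the later lemmas to take arbitrary equations between counts.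
    recast-refl : ∀ {j X} (e : j ≡ j) (ν : Carrier (N n j X)) → recast e ν ≈ₘ ν
    recast-refl e ν S = SubMeasure.respects-≐ ν
      ( (λ {(lift b , x)} → subst (λ c → (lift c , x) ∈ₘ S) (Vecₚ.cast-is-id e b))
      , (λ {(lift b , x)} → subst (λ c → (lift c , x) ∈ₘ S) (sym (Vecₚ.cast-is-id e b))))

    recast-trans : ∀ {i j k X} (e₁ : i ≡ j) (e₂ : j ≡ k) (e : i ≡ k) (ν : Carrier (N n i X)) →
                   recast e₂ (recast e₁ ν) ≈ₘ recast e ν
    recast-trans e₁ e₂ e ν S = SubMeasure.respects-≐ ν
      ( (λ {(lift b , x)} → subst (λ c → (lift c , x) ∈ₘ S) (Vecₚ.cast-trans e₁ e₂ b))
      , (λ {(lift b , x)} → subst (λ c → (lift c , x) ∈ₘ S) (sym (Vecₚ.cast-trans e₁ e₂ b))))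

    recast-cong : ∀ {j k X} (e : j ≡ k) (μ ν : Carrier (N n j X)) →
                  μ ≈ₘ ν → recast e μ ≈ₘ recast e ν
    recast-cong e μ ν μ≈ν S = μ≈ν (preimageₘ (castₘ e) S)

    ⊙-cong : ∀ {j k X X′ Y Z} (a : Hom X (N n j Y)) (a′ : Hom X′ (N n j Y))
             (l l′ : Hom Y (N n k Z)) {x x′} →
             fun a x ≈ₘ fun a′ x′ → (∀ y → fun l y ≈ₘ fun l′ y) → fun (a ⊙ l) x ≈ₘ fun (a′ ⊙ l′) x′
    ⊙-cong {j} a a′ l l′ {x} {x′} a≈a′ l≈l′ S = ≋⇒≈∞ (begin-equality
      fun (a ⊙ l) x ⟨ S ⟩                           ≈⟨ ⊙≋∫ a l x S ⟩
      ∫ (fun a x) (kernelAt (strengthen j l) S)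
        ≈⟨ ∫-≈ (fun a x) (fun a′ x′) a≈a′ (kernelAt (strengthen j l) S) ⟩
      ∫ (fun a′ x′) (kernelAt (strengthen j l) S)
        ≈⟨ ∫-cong (fun a′ x′) (kernelAt (strengthen j l) S) (kernelAt (strengthen j l′) S)
             (λ (b , y) → ≈∞⇒≋ (l≈l′ y (section (lower b) S))) ⟩
      ∫ (fun a′ x′) (kernelAt (strengthen j l′) S)  ≈⟨ ⊙≋∫ a′ l′ x′ S ⟨
      fun (a′ ⊙ l′) x′ ⟨ S ⟩                        ∎)
      where open ⊑-Reasoning

    ⊙-recast : ∀ {j j′ k X X′ Y Z} (a : Hom X (N n j Y)) (a′ : Hom X′ (N n j′ Y))
               (l : Hom Y (N n k Z)) {x x′} (e : j ≡ j′) (e′ : j ℕ.+ k ≡ j′ ℕ.+ k) →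
               recast e (fun a x) ≈ₘ fun a′ x′ → recast e′ (fun (a ⊙ l) x) ≈ₘ fun (a′ ⊙ l) x′
    ⊙-recast {j} {k = k} {Y = Y} {Z = Z} a a′ l {x} {x′} refl e′ h = begin
      recast e′ (fun (a ⊙ l) x)   ≈⟨ recast-refl e′ (fun (a ⊙ l) x) ⟩
      fun (a ⊙ l) x               ≈⟨ ⊙-cong a a′ l l a≈a′ (λ y → ≈ₘ-refl (fun l y)) ⟩
      fun (a′ ⊙ l) x′             ∎
      where
      open ≈ₘ-Reasoning (Obs n (j ℕ.+ k) ⊗ Z)
      a≈a′ : fun a x ≈ₘ fun a′ x′
      a≈a′ = R.begin
        fun a x                 R.≈⟨ recast-refl refl (fun a x) ⟨
        recast refl (fun a x)   R.≈⟨ h ⟩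
        fun a′ x′               R.∎
        where module R = ≈ₘ-Reasoning (Obs n j ⊗ Y)

    -- Integrating against `a ⊙ b` is iterated integration (`∫-⊙`); the inner integrands then agree
    -- because concatenation of records is associative up to the cast.
    ⊙-assoc : ∀ {j k m X Y Z W} (a : Hom X (N n j Y)) (b : Hom Y (N n k Z)) (c : Hom Z (N n m W)) x
              (e : (j ℕ.+ k) ℕ.+ m ≡ j ℕ.+ (k ℕ.+ m)) →
              recast e (fun ((a ⊙ b) ⊙ c) x) ≈ₘ fun (a ⊙ (b ⊙ c)) x
    ⊙-assoc {j} {k} {m} {Z = Z} {W = W} a b c x e S = ≋⇒≈∞ (begin-equality
      fun ((a ⊙ b) ⊙ c) x ⟨ S′ ⟩                             ≈⟨ ⊙≋∫ (a ⊙ b) c x S′ ⟩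
      ∫ (fun (a ⊙ b) x) F                                   ≈⟨ ∫-⊙ a b x F ⟩
      ∫ (fun a x) (∫-kernel (strengthen j b) F)
        ≈⟨ ∫-cong (fun a x) (∫-kernel (strengthen j b) F) (kernelAt (strengthen j (b ⊙ c)) S)
             inner ⟩
      ∫ (fun a x) (kernelAt (strengthen j (b ⊙ c)) S)       ≈⟨ ⊙≋∫ a (b ⊙ c) x S ⟨
      fun (a ⊙ (b ⊙ c)) x ⟨ S ⟩                             ∎)
      where
      open ⊑-Reasoning
      S′ : MeasurableSet (Obs n ((j ℕ.+ k) ℕ.+ m) ⊗ W)
      S′ = preimageₘ (castₘ e) S
      F : MeasurableFunction (Obs n (j ℕ.+ k) ⊗ Z)
      F = kernelAt (strengthen (j ℕ.+ k) c) S′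
      inner : ∀ p → ∫ (fun (strengthen j b) p) F ≋ fun (strengthen j (b ⊙ c)) p ⟨ S ⟩
      inner (lift u , y) = begin-equality
        ∫ (pushforward (prepend u) (fun b y)) F   ≈⟨ ∫-pushforward (prepend u) (fun b y) F ⟩
        ∫ (fun b y) (F ∘ᶠ prepend u)
          ≈⟨ ∫-cong (fun b y) (F ∘ᶠ prepend u) (kernelAt (strengthen k c) (section u S))
               (λ (lift v , z) → measure-cong (fun c z)
                 {section (u ++ v) S′} {section v (section u S)}
                 ( (λ {(lift w , z′)} → subst (member z′) (Vecₚ.++-assoc-eqFree u v w))
                 , (λ {(lift w , z′)} → subst (member z′) (sym (Vecₚ.++-assoc-eqFree u v w))))) ⟩
        ∫ (fun b y) (kernelAt (strengthen k c) (section u S))   ≈⟨ ⊙≋∫ b c y (section u S) ⟨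
        fun (b ⊙ c) y ⟨ section u S ⟩             ∎
        where
        member : Carrier W → Vec (Subset n) (j ℕ.+ (k ℕ.+ m)) → Set
        member z′ t = (lift t , z′) ∈ₘ S

  count-cong : ∀ v w → v ≈ˢ w → count v ≡ count w
  count-cong (base _ _)       (base _ _)       (_ , j≡k)       = j≡k
  count-cong (snoc v _ _ _ _) (snoc w _ _ _ _) (v≈w , _ , j≡k) =
    ≡.cong₂ ℕ._+_ (count-cong v w v≈w) j≡k

  -- The structure shared by a Feller-Dynkin process and its quotient, from which the coalgebra is
  -- built once for both.
  record ObservedProcess (n : ℕ) : Set₂ where
    field
      space             : MeasurableSpace
      γ                 : ℝ≥0 → Hom space (𝒢 space)
      γ-cong            : ∀ {s t} → s ≈ᵣ t → ∀ x → fun (γ s) x ≈ₘ fun (γ t) x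
      γ-zero            : ∀ x → fun (γ 0ᵣ) x ≈ₘ dirac x
      chapmanKolmogorov : ∀ s t x C →
        IsIntegral (fun (γ s) x) (λ z → fun (γ t) z ⟨ C ⟩) (fun (γ (s +ᵣ t)) x ⟨ C ⟩)
      obs               : Hom space (discrete (Subset n))

    recordObs : ∀ k → Hom space (Obs n k ⊗ space)
    recordObs k = ⟨ repeat ∘ₘ obs , idₘ ⟩ₘ
      where
      repeat : Hom (discrete (Subset n)) (Obs n k)
      repeat = record
        { fun      = λ (lift b) → lift (replicate k b)
        ; fun-cong = cong _
        ; preimage = λ _ → lift tt
        }

    κ : ∀ t k → Hom space (N n k space)
    κ t k = pushforwardₕ (recordObs k) ∘ₘ γ t

    law : ∀ w → Hom space (N n (count w) space)
    law (base t k)       = κ t k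
    law (snoc w _ t _ k) = law w ⊙ κ t k

    law-respects : ∀ v w → v ≈ˢ w → (e : count v ≡ count w) → ∀ x →
                   recast e (fun (law v) x) ≈ₘ fun (law w) x
    law-respects (base s j) (base t .j) (s≈t , refl) e x = begin
      recast e (fun (κ s j) x)   ≈⟨ recast-refl e (fun (κ s j) x) ⟩
      fun (κ s j) x              ≈⟨ (λ S → γ-cong s≈t x (preimageₘ (recordObs j) S)) ⟩
      fun (κ t j) x              ∎
      where open ≈ₘ-Reasoning (Obs n j ⊗ space)
    law-respects (snoc v p s s≉0 j) (snoc w p′ t t≉0 .j) (v≈w , s≈t , refl) e x = begin
      recast e (fun (law v ⊙ κ s j) x)
        ≈⟨ ⊙-recast (law v) (law w) (κ s j) e′ e (law-respects v w v≈w e′ x) ⟩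
      fun (law w ⊙ κ s j) x
        ≈⟨ ⊙-cong (law w) (law w) (κ s j) (κ t j) (≈ₘ-refl (fun (law w) x))
             (λ y S → γ-cong s≈t y (preimageₘ (recordObs j) S)) ⟩
      fun (law w ⊙ κ t j) x ∎
      where
      open ≈ₘ-Reasoning (Obs n (count w ℕ.+ j) ⊗ space)
      e′ : count v ≡ count w
      e′ = count-cong v w v≈w

    law-unit : ∀ x → fun (law εˢ) x ≈ₘ η x
    law-unit x S = γ-zero x (preimageₘ (recordObs 0) S)

    -- In zero time the state stays put, so the second letter reads the same observation again: `j`
    -- copies followed by `k` copies.
    κ-zeroʳ : ∀ s j t k → t ≈ᵣ 0ᵣ → ∀ x → fun (κ s j ⊙ κ t k) x ≈ₘ fun (κ s (j ℕ.+ k)) x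
    κ-zeroʳ s j t k t≈0 x S = ≋⇒≈∞ (begin-equality
      fun (κ s j ⊙ κ t k) x ⟨ S ⟩                  ≈⟨ ⊙≋∫ (κ s j) (κ t k) x S ⟩
      ∫ (fun (κ s j) x) F                          ≈⟨ ∫-pushforward (recordObs j) (fun (γ s) x) F ⟩
      ∫ (fun (γ s) x) (F ∘ᶠ recordObs j)
        ≈⟨ ∫-indicator (fun (γ s) x) (F ∘ᶠ recordObs j) (preimageₘ (recordObs (j ℕ.+ k)) S) at ⟩
      fun (κ s (j ℕ.+ k)) x ⟨ S ⟩                  ∎)
      where
      open ⊑-Reasoning
      F : MeasurableFunction (Obs n j ⊗ space)
      F = kernelAt (strengthen j (κ t k)) S
      at : ∀ z → apply F (fun (recordObs j) z) ≋
                 indicator (z ∈ₘ preimageₘ (recordObs (j ℕ.+ k)) S)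
      at z = begin-equality
        fun (γ t) z ⟨ A ⟩   ≈⟨ ≈∞⇒≋ (γ-cong t≈0 z A) ⟩
        fun (γ 0ᵣ) z ⟨ A ⟩  ≈⟨ ≈∞⇒≋ (γ-zero z A) ⟩
        indicator (z ∈ₘ A)
          ≈⟨ indicator-cong (subst (λ b → (lift b , z) ∈ₘ S) (sym (replicate-+ j)))
                            (subst (λ b → (lift b , z) ∈ₘ S) (replicate-+ j)) ⟩
        indicator (z ∈ₘ preimageₘ (recordObs (j ℕ.+ k)) S) ∎
        where
        o = lower (fun obs z)
        A : MeasurableSet space
        A = preimageₘ (recordObs k) (section (replicate j o) S)
        replicate-+ : ∀ j → replicate (j ℕ.+ k) o ≡ replicate j o ++ replicate k o
        replicate-+ zero    = refl
        replicate-+ (suc j) = cong (o ∷_) (replicate-+ j)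

    -- Chapman-Kolmogorov, with the empty record prepended.
    κ-+ : ∀ s t k x → fun (κ s 0 ⊙ κ t k) x ≈ₘ fun (κ (s +ᵣ t) k) x
    κ-+ s t k x S = ≋⇒≈∞ (begin-equality
      fun (κ s 0 ⊙ κ t k) x ⟨ S ⟩          ≈⟨ ⊙≋∫ (κ s 0) (κ t k) x S ⟩
      ∫ (fun (κ s 0) x) F                  ≈⟨ ∫-pushforward (recordObs 0) (fun (γ s) x) F ⟩
      ∫ (fun (γ s) x) (F ∘ᶠ recordObs 0)
        ≈⟨ IsIntegral⇒≋∫ (fun (γ s) x) (λ z → fun (γ t) z ⟨ C ⟩) (fun (γ (s +ᵣ t)) x ⟨ C ⟩)
             (F ∘ᶠ recordObs 0) (chapmanKolmogorov s t x C)
             (λ z → measure-cong (fun (γ t) z) {C} {preimageₘ (recordObs k) (section [] S)}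
               ((λ h → h) , (λ h → h))) ⟨
      fun (κ (s +ᵣ t) k) x ⟨ S ⟩           ∎)
      where
      open ⊑-Reasoning
      C : MeasurableSet space
      C = preimageₘ (recordObs k) S
      F : MeasurableFunction (Obs n 0 ⊗ space)
      F = kernelAt (strengthen 0 (κ t k)) S

    recast-≈ : ∀ {k} (e : k ≡ k) (μ ν : Carrier (N n k space)) → μ ≈ₘ ν → recast e ν ≈ₘ μ
    recast-≈ {k} e μ ν μ≈ν = begin
      recast e ν   ≈⟨ recast-refl e ν ⟩
      ν            ≈⟨ μ≈ν ⟨
      μ            ∎
      where open ≈ₘ-Reasoning (Obs n k ⊗ space)

    -- Associativity brings the last letter of a word next to the appended one, and `h` fuses the
    -- two. It is used from right to left, hence `sym e` and the cancelling recasts.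
    merge : ∀ {i} (a : Hom space (N n i space)) s j t k s′ →
            (∀ y → fun (κ s j ⊙ κ t k) y ≈ₘ fun (κ s′ (j ℕ.+ k)) y) →
            (e : i ℕ.+ (j ℕ.+ k) ≡ (i ℕ.+ j) ℕ.+ k) → ∀ x →
            recast e (fun (a ⊙ κ s′ (j ℕ.+ k)) x) ≈ₘ fun ((a ⊙ κ s j) ⊙ κ t k) x
    merge {i} a s j t k s′ h e x = begin
      recast e (fun (a ⊙ κ s′ (j ℕ.+ k)) x)
        ≈⟨ recast-cong e (fun (a ⊙ (κ s j ⊙ κ t k)) x) (fun (a ⊙ κ s′ (j ℕ.+ k)) x)
             (⊙-cong a a (κ s j ⊙ κ t k) (κ s′ (j ℕ.+ k)) (≈ₘ-refl (fun a x)) h) ⟨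
      recast e (fun (a ⊙ (κ s j ⊙ κ t k)) x)
        ≈⟨ recast-cong e (recast (sym e) ν) (fun (a ⊙ (κ s j ⊙ κ t k)) x)
             (⊙-assoc a (κ s j) (κ t k) x (sym e)) ⟨
      recast e (recast (sym e) ν)   ≈⟨ recast-trans (sym e) e refl ν ⟩
      recast refl ν                 ≈⟨ recast-refl refl ν ⟩
      ν                             ∎
      where
      open ≈ₘ-Reasoning (Obs n ((i ℕ.+ j) ℕ.+ k) ⊗ space)
      ν : Carrier (N n ((i ℕ.+ j) ℕ.+ k) space)
      ν = fun ((a ⊙ κ s j) ⊙ κ t k) x

    -- Follows the cases of `append`: fusion by `κ-zeroʳ` if `t` is zero, by `κ-+` if the last count
    -- is zero, and otherwise the word merely grows by one letter.
    law-append : ∀ v t k d (e : count (append v t k d) ≡ count v ℕ.+ k) x →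
                 recast e (fun (law (append v t k d)) x) ≈ₘ fun (law v ⊙ κ t k) x
    law-append (base s j) t k (yes t≈0) e x =
      recast-≈ e (fun (κ s j ⊙ κ t k) x) (fun (κ s (j ℕ.+ k)) x) (κ-zeroʳ s j t k t≈0 x)
    law-append (base s zero) t k (no t≉0) e x =
      recast-≈ e (fun (κ s 0 ⊙ κ t k) x) (fun (κ (s +ᵣ t) k) x) (κ-+ s t k x)
    law-append (base s (suc j)) t k (no t≉0) e x =
      recast-refl e (fun (κ s (suc j) ⊙ κ t k) x)
    law-append (snoc w p s s≉0 j) t k (yes t≈0) e x =
      merge (law w) s j t k s (κ-zeroʳ s j t k t≈0) e x
    law-append (snoc w p s s≉0 zero) t k (no t≉0) e x =
      merge (law w) s 0 t k (s +ᵣ t) (κ-+ s t k) e x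
    law-append (snoc w p s s≉0 (suc j)) t k (no t≉0) e x =
      recast-refl e (fun ((law w ⊙ κ s (suc j)) ⊙ κ t k) x)

    -- Induction on `w`, the argument on which `_·_` recurses; associativity of `⊙` moves the last
    -- letter back into the second word.
    law-· : ∀ v w (e : count (v · w) ≡ count v ℕ.+ count w) x →
            recast e (fun (law (v · w)) x) ≈ₘ fun (law v ⊙ law w) x
    law-· v (base t k) e x = law-append v t k em₀ e x
    law-· v (snoc w p t t≉0 k) e x = begin
      recast e ν                ≈⟨ recast-trans e₁ e₂ e ν ⟨
      recast e₂ (recast e₁ ν)
        ≈⟨ recast-cong e₂ (recast e₁ ν) (fun ((law v ⊙ law w) ⊙ κ t k) x)
             (⊙-recast (law (v · w)) (law v ⊙ law w) (κ t k) (count-· v w) e₁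
               (law-· v w (count-· v w) x)) ⟩
      recast e₂ (fun ((law v ⊙ law w) ⊙ κ t k) x)
        ≈⟨ ⊙-assoc (law v) (law w) (κ t k) x e₂ ⟩
      fun (law v ⊙ (law w ⊙ κ t k)) x ∎
      where
      open ≈ₘ-Reasoning (Obs n (count v ℕ.+ (count w ℕ.+ k)) ⊗ space)
      e₁ : count (v · w) ℕ.+ k ≡ (count v ℕ.+ count w) ℕ.+ k
      e₁ = cong (ℕ._+ k) (count-· v w)
      e₂ : (count v ℕ.+ count w) ℕ.+ k ≡ count v ℕ.+ (count w ℕ.+ k)
      e₂ = ℕₚ.+-assoc (count v) (count w) k
      ν : Carrier (N n (count (v · w) ℕ.+ k) space)
      ν = fun (law (v · w) ⊙ κ t k) x

    coalgebra : GradedCoalgebra n space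
    coalgebra = record
      { structure      = law
      ; respects       = λ {v} {w} v≈w e x → law-respects v w v≈w e x
      ; unit           = law-unit
      ; multiplication = λ v w x → ⊙-isMultiplication (law v) (law w) x
          (recast (count-· v w) (fun (law (v · w)) x)) (law-· v w (count-· v w) x)
      }

  -- Homomorphisms induced by maps of processes

  module _ {n : ℕ} (𝒳 𝒵 : ObservedProcess n) where

    private
      module 𝒳 = ObservedProcess 𝒳
      module 𝒵 = ObservedProcess 𝒵

    -- For a longer word, the single-letter case shows that the integrand of the last letter factors
    -- through `q`; change of variables and the induction hypothesis for the prefix then move the
    -- integral to `𝒵`.
    coalgebra-homomorphism : (q : Hom 𝒳.space 𝒵.space) →
      (∀ t x → fun (𝒵.γ t) (fun q x) ≈ₘ pushforward q (fun (𝒳.γ t) x)) →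
      (∀ x → fun 𝒵.obs (fun q x) ≡ fun 𝒳.obs x) →
      IsHomomorphism 𝒳.coalgebra 𝒵.coalgebra q
    coalgebra-homomorphism q q-γ q-obs (base t k) x S = ≋⇒≈∞ (begin-equality
      fun (𝒳.γ t) x ⟨ preimageₘ (𝒳.recordObs k) (preimageₘ (Obs n k id⊗ q) S) ⟩
        ≈⟨ measure-cong (fun (𝒳.γ t) x) {preimageₘ (𝒳.recordObs k) (preimageₘ (Obs n k id⊗ q) S)}
             {preimageₘ q (preimageₘ (𝒵.recordObs k) S)}
             ( (λ {y} → subst (λ b → (lift (replicate k (lower b)) , fun q y) ∈ₘ S) (sym (q-obs y)))
             , (λ {y} → subst (λ b → (lift (replicate k (lower b)) , fun q y) ∈ₘ S) (q-obs y))) ⟩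
      fun (𝒳.γ t) x ⟨ preimageₘ q (preimageₘ (𝒵.recordObs k) S) ⟩
        ≈⟨ ≈∞⇒≋ (q-γ t x (preimageₘ (𝒵.recordObs k) S)) ⟨
      fun (𝒵.γ t) (fun q x) ⟨ preimageₘ (𝒵.recordObs k) S ⟩ ∎)
      where open ⊑-Reasoning
    coalgebra-homomorphism q q-γ q-obs (snoc w p t t≉0 k) x S = ≋⇒≈∞ (begin-equality
      fun (𝒳.law w ⊙ 𝒳.κ t k) x ⟨ S′ ⟩        ≈⟨ ⊙≋∫ (𝒳.law w) (𝒳.κ t k) x S′ ⟩
      ∫ (fun (𝒳.law w) x) F
        ≈⟨ ∫-cong (fun (𝒳.law w) x) F (G ∘ᶠ (Obs n j id⊗ q)) F≋G∘q ⟩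
      ∫ (fun (𝒳.law w) x) (G ∘ᶠ (Obs n j id⊗ q))
        ≈⟨ ∫-pushforward (Obs n j id⊗ q) (fun (𝒳.law w) x) G ⟨
      ∫ (mapN q (fun (𝒳.law w) x)) G
        ≈⟨ ∫-≈ (mapN q (fun (𝒳.law w) x)) (fun (𝒵.law w) (fun q x))
             (coalgebra-homomorphism q q-γ q-obs w x) G ⟩
      ∫ (fun (𝒵.law w) (fun q x)) G           ≈⟨ ⊙≋∫ (𝒵.law w) (𝒵.κ t k) (fun q x) S ⟨
      fun (𝒵.law w ⊙ 𝒵.κ t k) (fun q x) ⟨ S ⟩ ∎)
      where
      open ⊑-Reasoning
      j : ℕ
      j = count w
      S′ : MeasurableSet (Obs n (j ℕ.+ k) ⊗ 𝒳.space)
      S′ = preimageₘ (Obs n (j ℕ.+ k) id⊗ q) S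
      F : MeasurableFunction (Obs n j ⊗ 𝒳.space)
      F = kernelAt (strengthen j (𝒳.κ t k)) S′
      G : MeasurableFunction (Obs n j ⊗ 𝒵.space)
      G = kernelAt (strengthen j (𝒵.κ t k)) S
      F≋G∘q : ∀ p → apply F p ≋ apply (G ∘ᶠ (Obs n j id⊗ q)) p
      F≋G∘q (b , y) = ≋-trans
        (measure-cong (fun (𝒳.κ t k) y)
          {section (lower b) S′} {preimageₘ (Obs n k id⊗ q) (section (lower b) S)}
          ((λ h → h) , (λ h → h)))
        (≈∞⇒≋ (coalgebra-homomorphism q q-γ q-obs (base t k) y (section (lower b) S)))

  -- The quotient by a bisimulation

  -- The σ-algebra is the largest one which makes the projection measurable.
  quotient : (X : MeasurableSpace) {R : Rel (Carrier X) 1ℓ} → IsEquivalence R → MeasurableSpace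
  quotient X {R} R-equiv = record
    { setoid       = record { Carrier = Carrier X ; _≈_ = R ; isEquivalence = R-equiv }
    ; Measurable   = λ A → X.Measurable A × (∀ {x y} → R x y → A x → A y)
    ; extensional  = proj₂
    ; measurable-≐ = λ (f , g) (m , closed) →
        X.measurable-≐ ((λ a → f a) , (λ b → g b)) m , λ xRy b → f (closed xRy (g b))
    ; whole        = X.whole , λ _ _ → tt
    ; complement   = λ (m , closed) → X.complement m , λ xRy ¬a a →
        ¬a (closed (IsEquivalence.sym R-equiv xRy) a)
    ; union        = λ A → X.union (λ n → proj₁ (A n)) , λ { xRy (n , a) → n , proj₂ (A n) xRy a }
    }
    where module X = MeasurableSpace X

  -- From path laws to the quotient process

  module _ {n : ℕ} (𝒳 : FellerDynkinProcess n) where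

    open FellerDynkinProcess 𝒳
    open Trajectory

    observedProcess : ObservedProcess n
    observedProcess = record
      { space = space ; γ = γ ; γ-cong = γ-cong ; γ-zero = γ-zero
      ; chapmanKolmogorov = chapmanKolmogorov ; obs = obs }

    corresponding : Corresponding 𝒳 (ObservedProcess.coalgebra observedProcess)
    corresponding = record
      -- The two recording maps agree on points, so the two preimages have the same elements.
      { single = λ t k x S → ≋⇒≈∞ (measure-cong (fun (γ t) x)
          {preimageₘ (recordObs k) S} {preimageₘ (record-obs 𝒳 k) S} ((λ h → h) , (λ h → h)))
      ; step   = λ w _ t _ k x → ⊙-isMultiplication (law w) (κ t k) x (fun (law w ⊙ κ t k) x)
          (≈ₘ-refl (fun (law w ⊙ κ t k) x))
      }
      where open ObservedProcess observedProcess using (recordObs; law; κ)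

    aliveIn : MeasurableSet space → MeasurableSet (space ∂)
    aliveIn C = (λ { (just z) → z ∈ₘ C ; nothing → ⊥ }) ,meas measurable C

    evaluateAt : ℝ≥0 → Hom (trajectories 𝒳) (space ∂)
    evaluateAt t = record
      { fun      = λ ω → at ω t
      ; fun-cong = λ e → e t
      ; preimage = λ {A} m → generator (cylinder t tt (A ,meas m))
      }

    -- The Markov property at time 0, where the trajectory has law δ_x.
    pathLaw-at : ∀ {x P} → IsPathLaw 𝒳 x P → ∀ t C →
                 P ⟨ at∈ 𝒳 (0ᵣ +ᵣ t) (aliveIn C) ⟩ ≋ fun (γ t) x ⟨ C ⟩
    pathLaw-at {x} {P} P-law t C = begin-equality
      P ⟨ at∈ 𝒳 (0ᵣ +ᵣ t) D ⟩
        ≈⟨ measure-cong P {at∈ 𝒳 (0ᵣ +ᵣ t) D} {forgetTime 𝒳 whole₀ ∩ₘ at∈ 𝒳 (0ᵣ +ᵣ t) D}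
             ((λ h → tt , h) , proj₂) ⟩
      P ⟨ forgetTime 𝒳 whole₀ ∩ₘ at∈ 𝒳 (0ᵣ +ᵣ t) D ⟩
        ≈⟨ IsIntegral⇒≋∫ P (λ ω → ⟦ ω ∈ₘ whole₀ ⟧· γ∂ 𝒳 t (at ω 0ᵣ) D) _
             (g ∘ᶠ evaluateAt 0ᵣ) (markov 0ᵣ t whole₀ D) (λ ω → ⟦⟧·-true _ tt) ⟩
      ∫ P (g ∘ᶠ evaluateAt 0ᵣ)               ≈⟨ ∫-pushforward (evaluateAt 0ᵣ) P g ⟨
      ∫ (pushforward (evaluateAt 0ᵣ) P) g
        ≈⟨ ∫-≈ (pushforward (evaluateAt 0ᵣ) P) (dirac {space ∂} (just x)) initial g ⟩
      ∫ (dirac {space ∂} (just x)) g         ≈⟨ ∫-dirac (just x) g ⟩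
      apply g (just x)                       ≈⟨ g-just x ⟨
      fun (γ t) x ⟨ C ⟩                      ∎
      where
      open ⊑-Reasoning
      open IsPathLaw P-law
      D : MeasurableSet (space ∂)
      D = aliveIn C
      whole₀ : MeasurableSet (evaluationSpace 𝒳 (_≤ᵣ 0ᵣ))
      whole₀ = wholeₘ
      -- The cemetery point lies outside `D`, so the missing-mass term of `γ∂` vanishes.
      g-just : ∀ z → fun (γ t) z ⟨ C ⟩ ≋ γ∂ 𝒳 t (just z) D
      g-just z = begin-equality
        fun (γ t) z ⟨ C ⟩               ≈⟨ ⊕-identityʳ _ ⟨
        fun (γ t) z ⟨ C ⟩ ⊕ 0∞
          ≈⟨ ⊕-cong (measure-cong (fun (γ t) z) {C} {alive D} ((λ h → h) , (λ h → h)))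
                    (≋-sym (⟦⟧·-false dead (λ h → h))) ⟩
        fun (γ t) z ⟨ alive D ⟩ ⊕ ⟦ nothing ∈ₘ D ⟧· dead   ≈⟨ +∞≋⊕ _ _ ⟨
        γ∂ 𝒳 t (just z) D               ∎
        where
        dead : [0,∞]
        dead = 1- (fun (γ t) z ⟨ wholeₘ ⟩)
      -- Measurability on `space ∂` is by definition measurability on the live points, where
      -- `g-just` gives the values.
      g : MeasurableFunction (space ∂)
      g = (λ m → γ∂ 𝒳 t m D) ,mf
          IsMeasurable-cong {space} g-just (apply-measurable (kernelAt (γ t) C))

    module _ (P : PathLaws 𝒳) {R : Rel (Carrier space) 1ℓ} (R-bisim : IsBisimulation 𝒳 P R) where

      open IsBisimulation R-bisim

      bisimilar⇒≋ : ∀ {x y} → R x y → ∀ t C → (∀ {z z′} → R z z′ → z ∈ₘ C → z′ ∈ₘ C) →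
                    fun (γ t) x ⟨ C ⟩ ≋ fun (γ t) y ⟨ C ⟩
      bisimilar⇒≋ {x} {y} xRy t C closed = begin-equality
        fun (γ t) x ⟨ C ⟩       ≈⟨ pathLaw-at (proj₂ (P x)) t C ⟨
        proj₁ (P x) ⟨ V ⟩       ≈⟨ ≈∞⇒≋ (samePathLaw xRy V V-closed) ⟩
        proj₁ (P y) ⟨ V ⟩       ≈⟨ pathLaw-at (proj₂ (P y)) t C ⟩
        fun (γ t) y ⟨ C ⟩       ∎
        where
        open ⊑-Reasoning
        V : MeasurableSet (trajectories 𝒳)
        -- The Markov property delivers the time in the form `0ᵣ +ᵣ t`; keeping it avoids a
        -- transport along its equivalence with `t`.
        V = at∈ 𝒳 (0ᵣ +ᵣ t) (aliveIn C)
        closed∂ : ∀ {m m′} → Maybeₚ.Pointwise R m m′ → m ∈ₘ aliveIn C → m′ ∈ₘ aliveIn C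
        closed∂ (Maybeₚ.just zRz′) z∈C = closed zRz′ z∈C
        V-closed : TimeClosed 𝒳 P R V
        V-closed ω ω′ ω∈V ωRω′ = closed∂ (ωRω′ (0ᵣ +ᵣ t)) ω∈V

      quotientSpace : MeasurableSpace
      quotientSpace = quotient space isEquivalence

      projection : Hom space quotientSpace
      projection = record { fun = λ x → x ; fun-cong = ≈⇒R ; preimage = proj₁ }

      bisimilar⇒≈ₘ : ∀ {x y} → R x y → ∀ t →
                     pushforward projection (fun (γ t) x) ≈ₘ pushforward projection (fun (γ t) y)
      bisimilar⇒≈ₘ xRy t A =
        ≋⇒≈∞ (bisimilar⇒≋ xRy t (preimageₘ projection A) (proj₂ (measurable A)))

      -- `bisimilar⇒≈ₘ` is used twice: it makes the kernel well defined on classes, and it makes its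
      -- superlevel sets `R`-closed, as measurability in the quotient demands.
      quotient-γ : ℝ≥0 → Hom quotientSpace (𝒢 quotientSpace)
      quotient-γ t = kernel (λ x → pushforward projection (fun (γ t) x))
        (λ xRy → bisimilar⇒≈ₘ xRy t)
        (λ A q → apply-measurable (kernelAt (γ t) (preimageₘ projection A)) q ,
                 λ xRy → proj₁ (bisimilar⇒≈ₘ xRy t A) q)

      quotientProcess : ObservedProcess n
      quotientProcess = record
        { space             = quotientSpace
        ; γ                 = quotient-γ
        ; γ-cong            = λ s≈t x A → γ-cong s≈t x (preimageₘ projection A)
        ; γ-zero            = λ x A → γ-zero x (preimageₘ projection A)
        ; chapmanKolmogorov = λ s t x C →
            ≋∫⇒IsIntegral (pushforward projection (fun (γ s) x))
              (λ z → fun (quotient-γ t) z ⟨ C ⟩) (fun (quotient-γ (s +ᵣ t)) x ⟨ C ⟩)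
              (kernelAt (quotient-γ t) C)
            (λ _ → ≋-refl _)
            -- The integrand factors through the projection, so the integral over the state space
            -- equals the one over the quotient against the pushed-forward measure.
            (≋-trans
              (IsIntegral⇒≋∫ (fun (γ s) x) _ _ (kernelAt (quotient-γ t) C ∘ᶠ projection)
                (chapmanKolmogorov s t x (preimageₘ projection C)) (λ _ → ≋-refl _))
              (≋-sym (∫-pushforward projection (fun (γ s) x) (kernelAt (quotient-γ t) C))))
        ; obs               = record
            { fun      = fun obs
            ; fun-cong = sameObs
            ; preimage = λ {A} m → preimage obs {A} m , λ xRy → subst A (sameObs xRy)
            }
        }

theorem3p12 : (em : ExcludedMiddle 1ℓ) → let open Classical em in
    (n : ℕ) (𝒳 : FellerDynkinProcess n) (P : PathLaws 𝒳)
    (x y : Carrier (FellerDynkinProcess.space 𝒳)) →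
    Bisimilar 𝒳 P x y →
    Σ[ γ̂ ∈ GradedCoalgebra n (FellerDynkinProcess.space 𝒳) ]
    (Corresponding 𝒳 γ̂ × BehaviourallyEquivalent γ̂ γ̂ x y)
theorem3p12 em n 𝒳 P x y (R , R-bisim , xRy) =
  𝒪.coalgebra , corresponding 𝒳 ,
  -- Both legs of the cospan are the projection, and equality in the quotient is `R`, so `xRy` is
  -- the required identification.
  quotientSpace 𝒳 P R-bisim , 𝒬.coalgebra , q , q , q-hom , q-hom , xRy
  where
  open Classical em
  open WithExcludedMiddle em
  module 𝒪 = ObservedProcess (observedProcess 𝒳)
  module 𝒬 = ObservedProcess (quotientProcess 𝒳 P R-bisim)
  q : Hom 𝒪.space 𝒬.space
  q = projection 𝒳 P R-bisim
  q-hom : IsHomomorphism 𝒪.coalgebra 𝒬.coalgebra q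
  q-hom = coalgebra-homomorphism (observedProcess 𝒳) (quotientProcess 𝒳 P R-bisim) q
    (λ t x → ≈ₘ-refl (pushforward q (fun (𝒪.γ t) x))) (λ _ → refl)
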